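{- Let $b$ be a positive integer and let $M$ be a bipartite plane map of outer degree $2b$ having no face of degree less than $2b$. Then $M$ admits a $b/(b-1)$-orientation if and only if $M$ has girth $2b$. In this case, there exists a unique $b/(b-1)$-orientation of $M$ that is suitable.
   Context: A planar map is a connected graph (loops and multiple edges allowed) embedded without edge-crossings in the oriented sphere, considered up to continuous deformation; its faces are the connected components of the complement. Each edge consists of two half-edges, each incident to one endpoint. A corner is the angular section between two consecutive half-edges around a vertex; the degree of a vertex or face is its number of incident corners. The girth is the minimal length of a cycle. A map is bipartite if its vertices can be 2-colored so that every edge joins vertices of different colors. A plane map is a planar map with a distinguished face, the root-face, drawn as the unbounded (outer) face; its degree is the outer degree. Vertices, edges, half-edges incident to (lying on edges incident to) the root-face are outer, the others inner; faces other than the root-face are inner. A biorientation assigns to each half-edge a direction: ingoing (toward its vertex) or outgoing. An edge is $i$-way if exactly $i$ of its half-edges are ingoing. An edge $\{u,v\}$ can be traversed from $u$ to $v$ if it is 2-way, or 1-way with its ingoing half-edge at $v$. A biorientation is accessible from a vertex $v$ if every vertex can be reached from $v$ by a path traversing each edge in an allowed direction. A counterclockwise circuit is a simple cycle $C$ such that every edge of $C$ can be traversed in the direction that keeps the interior of $C$ on its left. A biorientation of a plane map is minimal if it has no counterclockwise circuit. A $\mathbb{Z}$-biorientation is a biorientation with an integer weight on each half-edge, positive if the half-edge is ingoing and non-positive if outgoing. The weight of an edge is the sum of the weights of its two half-edges; the weight of a vertex is the sum of the weights of the ingoing half-edges incident to it; the weight $w(f)$ of a face $f$ is the sum of the weights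 of the outgoing half-edges $h$ incident to $f$ such that $f$ lies on the right of $h$ (when $h$ is traversed from its vertex toward the middle of its edge). A $\mathbb{Z}$-biorientation of a plane map is admissible if the contour of the outer face is a simple cycle of 1-way edges each having weight $0$ on its outgoing half-edge and $1$ on its ingoing half-edge, and every inner half-edge incident to an outer vertex is outgoing. It is suitable if it is minimal, admissible, and accessible from every outer vertex. A $b/(b-1)$-orientation of $M$ is an admissible $\mathbb{Z}$-biorientation in which every outgoing half-edge has weight $0$ or $-1$, and (i) each inner edge has weight $b-1$, (ii) each inner vertex has weight $b$, (iii) each inner face $f$ satisfies $\deg(f)/2+w(f)=b$. -}

module Defs where

open import Data.Nat as ℕ using (ℕ; zero; suc; _≤_; _<_)
open import Data.Nat.DivMod using (_mod_; _/_)
open import Data.Integer as ℤ using (ℤ; +_; 0ℤ; 1ℤ; -1ℤ)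
open import Data.Fin as Fin using (Fin; toℕ)
open import Data.Fin.Properties using (_≟_)
open import Data.Bool using (Bool; true; false; if_then_else_)
open import Data.List using (List; map; upTo)
import Data.List.Relation.Unary.Any as Any
open import Data.Product using (Σ; ∃; ∃-syntax; _×_; _,_)
import Data.List.Relation.Unary.All as All
open import Data.Sum using (_⊎_)
open import Relation.Nullary using (¬_; Dec; yes; no)
open import Relation.Nullary.Decidable using (⌊_⌋)
open import Relation.Binary.PropositionalEquality using (_≡_; _≢_)
open import Function using (_∘_)

iter : ∀ {n} → (Fin n → Fin n) → ℕ → Fin n → Fin n
iter p zero    i = i
iter p (suc k) i = p (iter p k i)

sumℤ : ∀ {n} → (Fin n → ℤ) → ℤ
sumℤ {zero}  f = 0ℤ
sumℤ {suc n} f = f Fin.zero ℤ.+ sumℤ (f ∘ Fin.suc)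

countB : ∀ {n} → (Fin n → Bool) → ℕ
countB {zero}  P = zero
countB {suc n} P = (if P Fin.zero then 1 else 0) ℕ.+ countB (P ∘ Fin.suc)

-- the orbit of i under p, listed as p^0 i, ..., p^(n-1) i
-- (this exhausts the orbit since p acts on an n-element set)
orbit : ∀ {n} → (Fin n → Fin n) → Fin n → List (Fin n)
orbit {n} p i = map (λ k → iter p k i) (upTo n)

inOrbit? : ∀ {n} (p : Fin n → Fin n) (i j : Fin n) → Bool
inOrbit? p i j = ⌊ Any.any? (j ≟_) (orbit p i) ⌋

SameOrbit : ∀ {n} → (Fin n → Fin n) → Fin n → Fin n → Set
SameOrbit p i j = ∃[ k ] (iter p k i ≡ j)

orbitSize : ∀ {n} → (Fin n → Fin n) → Fin n → ℕ
orbitSize p i = countB (inOrbit? p i)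

isMinInOrbit : ∀ {n} → (Fin n → Fin n) → Fin n → Bool
isMinInOrbit p i = ⌊ All.all? (λ j → toℕ i ℕ.≤? toℕ j) (orbit p i) ⌋

numOrbits : ∀ {n} → (Fin n → Fin n) → ℕ
numOrbits p = countB (isMinInOrbit p)

next : ∀ {k} → Fin k → Fin k
next {suc m} i = suc (toℕ i) mod suc m

-- Combinatorial maps on the half-edge set Fin n.
--  σ : counterclockwise rotation of half-edges around their vertex
--      (vertices = σ-orbits, corners = pairs (σ⁻¹ h , h))
--  α : fixed-point-free involution pairing the two half-edges of an edge
--  φ = σ ∘ α : faces = φ-orbits; the φ-orbit of h is the face lying on
--      the right of h (h traversed from its vertex towards the middle
--      of its edge); it corresponds to the corner (σ⁻¹ h , h).

data Reach {n} (σ α : Fin n → Fin n) (h : Fin n) : Fin n → Set where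
  here  : Reach σ α h h
  viaσ  : ∀ {g} → Reach σ α h g → Reach σ α h (σ g)
  viaα  : ∀ {g} → Reach σ α h g → Reach σ α h (α g)

record PlanarMap (n : ℕ) : Set where
  field
    σ σ⁻¹ α   : Fin n → Fin n
    σ-inv₁    : ∀ h → σ (σ⁻¹ h) ≡ h
    σ-inv₂    : ∀ h → σ⁻¹ (σ h) ≡ h
    α-invol   : ∀ h → α (α h) ≡ h
    α-nofix   : ∀ h → α h ≢ h
    connected : ∀ h h' → Reach σ α h h'
  φ : Fin n → Fin n
  φ = σ ∘ α
  field
    -- genus 0 (Euler's formula V - E + F = 2 with E = n/2)
    euler     : 2 ℕ.* numOrbits σ ℕ.+ 2 ℕ.* numOrbits φ ≡ n ℕ.+ 4

  SameVertex : Fin n → Fin n → Set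
  SameVertex = SameOrbit σ
  SameFace : Fin n → Fin n → Set
  SameFace = SameOrbit φ

  vertexOf? : Fin n → Fin n → Bool
  vertexOf? = inOrbit? σ
  faceOf? : Fin n → Fin n → Bool
  faceOf? = inOrbit? φ

  faceDeg : Fin n → ℕ
  faceDeg = orbitSize φ

  -- a simple cycle of length k: c i is a half-edge leaving the i-th
  -- vertex of the cycle towards the (i+1)-th (cyclically)
  record IsCycle (k : ℕ) (c : Fin k → Fin n) : Set where
    field
      nonempty : 1 ≤ k
      closed   : ∀ i → SameVertex (α (c i)) (c (next i))
      vDistinct : ∀ i j → SameVertex (c i) (c j) → i ≡ j
      eDistinct : ∀ i j → i ≢ j → (c j ≢ c i) × (c j ≢ α (c i))

  HasGirth : ℕ → Set
  HasGirth g = (∃[ c ] IsCycle g c)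
             × (∀ k (c : Fin k → Fin n) → IsCycle k c → g ≤ k)

  Bipartite : Set
  Bipartite = Σ (Fin n → Bool) λ col → ((∀ h → col (σ h) ≡ col h) × (∀ h → col (α h) ≢ col h))

-- a plane map: the root face is the face on the right of half-edge r
record PlaneMap (n : ℕ) : Set where
  field
    pmap : PlanarMap n
    root : Fin n
  open PlanarMap pmap public

  InRoot : Fin n → Set
  InRoot h = SameFace root h

  outerDeg : ℕ
  outerDeg = faceDeg root

  OuterHE : Fin n → Set
  OuterHE h = InRoot h ⊎ InRoot (α h)
  InnerHE : Fin n → Set
  InnerHE h = ¬ OuterHE h
  -- inner edges (given by either of their half-edges)
  InnerEdge : Fin n → Set
  InnerEdge = InnerHE
  OuterVertex : Fin n → Set
  OuterVertex h = ∃[ g ] (SameVertex h g × InRoot g)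
  InnerVertex : Fin n → Set
  InnerVertex h = ¬ OuterVertex h
  InnerFace : Fin n → Set
  InnerFace h = ¬ SameFace root h

  contour : Fin outerDeg → Fin n
  contour i = iter φ (toℕ i) root

-- ℤ-biorientations: a weight on each half-edge; a half-edge is ingoing
-- iff its weight is positive (outgoing iff non-positive).

ZBiorientation : ℕ → Set
ZBiorientation n = Fin n → ℤ

module _ {n} (M : PlaneMap n) (w : ZBiorientation n) where
  open PlaneMap M

  Ingoing : Fin n → Set
  Ingoing h = 0ℤ ℤ.< w h
  Outgoing : Fin n → Set
  Outgoing h = w h ℤ.≤ 0ℤ

  ingoing? : Fin n → Bool
  ingoing? h = ⌊ 0ℤ ℤ.<? w h ⌋

  edgeWeight : Fin n → ℤ
  edgeWeight h = w h ℤ.+ w (α h)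

  vertexWeight : Fin n → ℤ
  vertexWeight h = sumℤ (λ g → if vertexOf? h g ∧ ingoing? g then w g else 0ℤ)
    where open import Data.Bool using (_∧_)

  faceWeight : Fin n → ℤ
  faceWeight h = sumℤ (λ g → if faceOf? h g ∧ not (ingoing? g) then w g else 0ℤ)
    where open import Data.Bool using (_∧_; not)

  -- the edge of h can be traversed starting from the vertex of h
  Traversable : Fin n → Set
  Traversable h = Ingoing (α h)

  data OReach (h₀ : Fin n) : Fin n → Set where
    start : ∀ {h} → SameVertex h₀ h → OReach h₀ h
    step  : ∀ {h h'} → OReach h₀ h → Traversable h → SameVertex (α h) h' → OReach h₀ h'

  AccessibleFrom : Fin n → Set
  AccessibleFrom h₀ = ∀ h → OReach h₀ h

  -- faces on the left of a cycle c: reachable in the dual from the face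
  -- on the left of c 0 (= face on the right of α (c 0)) without crossing
  -- an edge of c
  data LeftOf {k} (c : Fin k → Fin n) (i₀ : Fin k) : Fin n → Set where
    base  : ∀ {g} → SameFace (α (c i₀)) g → LeftOf c i₀ g
    cross : ∀ {g g'} → LeftOf c i₀ g →
            (∀ i → (g ≢ c i) × (g ≢ α (c i))) →
            SameFace (α g) g' → LeftOf c i₀ g'

  -- counterclockwise circuit: simple cycle, every edge traversable in the
  -- direction of the cycle, with the interior (side not containing the
  -- root face) on its left
  CCWCircuit : Set
  CCWCircuit = ∃[ k ] Σ (Fin k → Fin n) λ c →
    IsCycle k c × (∀ i → Traversable (c i)) ×
    Σ (1 ≤ k) λ k≥1 → ¬ LeftOf c (Fin.fromℕ< k≥1) root

  Minimal : Set
  Minimal = ¬ CCWCircuit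

  Admissible : Set
  Admissible =
    IsCycle outerDeg contour ×
    (∀ h → InRoot h →
       (w h ≡ 0ℤ × w (α h) ≡ 1ℤ) ⊎ (w h ≡ 1ℤ × w (α h) ≡ 0ℤ)) ×
    (∀ h → InnerHE h → OuterVertex h → Outgoing h)

  Suitable : Set
  Suitable = Minimal × Admissible × (∀ h₀ → OuterVertex h₀ → AccessibleFrom h₀)

  IsBOrientation : ℕ → Set
  IsBOrientation b =
    Admissible ×
    (∀ h → Outgoing h → w h ≡ 0ℤ ⊎ w h ≡ -1ℤ) ×
    (∀ h → InnerEdge h → edgeWeight h ≡ + b ℤ.- 1ℤ) ×
    (∀ h → InnerVertex h → vertexWeight h ≡ + b) ×
    (∀ h → InnerFace h → + (faceDeg h / 2) ℤ.+ faceWeight h ≡ + b)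

{-# OPTIONS --safe #-}
-- Summing the conditions on the vertices, edges and faces inside a cycle of
-- length k and comparing with Euler's relation gives k ≥ 2b.
--
-- Conversely, put a new vertex in each face and join it to the corners of the
-- face.  An orientation of this star map splits the weight b - 1 of each inner
-- edge between its ends and the weight 1 of each new edge between face and
-- vertex, with prescribed totals at all vertices and faces.  It exists by Hall's
-- condition: for a subgraph with at least one cycle this is Euler's relation,
-- as every face of the subgraph is bounded by a cycle and has degree at least 2b.
-- After pushing weight counterclockwise as long as possible, a half-edge
-- whose right face sends a unit across it carries no weight itself, and giving
-- it the weight -1 turns the star orientation into a minimal b/(b-1)-orientation.
-- A strong component that is not reached from the outer cycle and has no
-- entrance would contradict Euler's relation, again by summing weights.
--
-- Two suitable orientations differ in the star map by the coboundary of a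
-- function p on triangles; if p > 0 somewhere, the region cut off from the root
-- by {p ≤ 0} contains a counterclockwise circuit of the first orientation.
--
-- The topology of the sphere enters through complementary spanning trees of the
-- map and its dual.  Most goals are decidable, so classical arguments are carried
-- out under a double negation, for which the do-notation is used.
module Submission where

open import Defs
open import Data.Nat as ℕ using (ℕ; zero; suc; z≤n; s≤s)
import Data.Nat.Properties as ℕₚ
import Data.Nat.DivMod as DM
open import Data.Nat.Induction using (<-wellFounded)
open import Induction.WellFounded using (Acc; acc)
open import Data.Integer as ℤ using (ℤ; +_; -[1+_]; 0ℤ; 1ℤ; -1ℤ; _+_; _*_; _-_; -_; _≤_; _<_; _⊓_; ∣_∣; +≤+; +<+; -≤+)
import Data.Integer.Properties as ℤₚ
open import Data.Integer.Tactic.RingSolver using (solve-∀)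
open import Data.Fin as Fin using (Fin; toℕ)
import Data.Fin.Properties as Finₚ
open import Data.Bool using (Bool; true; false; if_then_else_; _∧_; _∨_; not)
import Data.Bool.Properties as Boolₚ
import Data.List.Relation.Unary.Any as Any
import Data.List.Relation.Unary.All as All
open import Data.List.Membership.Propositional.Properties using (∈-map⁺; ∈-map⁻; ∈-upTo⁺)
open import Data.Vec using (Vec; []; _∷_; lookup; tabulate)
open import Data.Vec.Properties using (lookup∘tabulate)
open import Data.Product using (Σ; ∃; ∃-syntax; _×_; _,_; proj₁; proj₂)
open import Data.Sum using (_⊎_; inj₁; inj₂; [_,_]′)
open import Data.Empty using (⊥; ⊥-elim)
open import Data.Unit using (⊤; tt)
open import Relation.Binary.Definitions using (tri<; tri≈; tri>)
open import Relation.Nullary using (¬_; Dec; yes; no)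
open import Relation.Nullary.Decidable using (⌊_⌋; ¬?; _×-dec_; _⊎-dec_; _→-dec_; map′; decidable-stable)
open import Relation.Binary.PropositionalEquality using (_≡_; _≢_; refl; sym; trans; cong; cong₂; subst; subst₂; module ≡-Reasoning)
open import Function using (_∘_; _⇔_; mk⇔; case_of_)

-- A half-edge stands at once for a corner, a side of a face and a triangle of the star map, so
-- functions on half-edges serve as chains in every dimension, and `σ`, `φ`, `α` give their
-- coboundaries. That a cycle separates its two sides is expressed by an integer function on faces
-- that jumps by one across the cycle.
--
-- The girth, Hall and accessibility counts share one shape: Euler's relation enters as an
-- inequality for a subgraph, multiplied by `b`, and the weight conditions cancel everything but
-- nonnegative terms.
--
-- Hall's theorem does not accept the weights -1; faces become nodes in order to remove them. A unit
-- that a face gives to a vertex plays the part of a -1, and the amount left to the face is its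
-- degree minus the number of such units, which condition (iii) fixes as deg/2 + b. This dictionary
-- fails if a unit crosses an edge whose near end carries weight or if two units cross it in
-- opposite directions. Minimality of the star orientation excludes both (`transfer`), so it already
-- serves the existence and not only the uniqueness.
--
-- The weights must be an actual function, so existence under a double negation is turned into a
-- finite search (`good`).

infixl 6 _⊞_
infixl 7 _⊠_

-- Booleans, indicators and inequalities with explicit slack

true≢false : ∀ {b} → b ≡ true → b ≡ false → ⊥
true≢false refl ()

bool : ∀ b → (b ≡ true) ⊎ (b ≡ false)
bool true  = inj₁ refl
bool false = inj₂ refl

¬true⇒false : ∀ {b} → ¬ (b ≡ true) → b ≡ false
¬true⇒false {true}  ¬t = ⊥-elim (¬t refl)
¬true⇒false {false} ¬t = refl

⇔⇒≡ : ∀ {a b} → (a ≡ true → b ≡ true) → (b ≡ true → a ≡ true) → a ≡ b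
⇔⇒≡ {true}  f g = sym (f refl)
⇔⇒≡ {false} {true}  f g = g refl
⇔⇒≡ {false} {false} f g = refl

⌊⌋-true : ∀ {A : Set} (d : Dec A) → A → ⌊ d ⌋ ≡ true
⌊⌋-true (yes _) a = refl
⌊⌋-true (no ¬a) a = ⊥-elim (¬a a)

⌊⌋-sound : ∀ {A : Set} (d : Dec A) → ⌊ d ⌋ ≡ true → A
⌊⌋-sound (yes a) _ = a

⌊⌋-false : ∀ {A : Set} (d : Dec A) → ¬ A → ⌊ d ⌋ ≡ false
⌊⌋-false (yes a) ¬a = ⊥-elim (¬a a)
⌊⌋-false (no _)  ¬a = refl

⌊⌋-refute : ∀ {A : Set} (d : Dec A) → ⌊ d ⌋ ≡ false → ¬ A
⌊⌋-refute (no ¬a) _ = ¬a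

∧-true : ∀ {a b} → a ∧ b ≡ true → (a ≡ true) × (b ≡ true)
∧-true {true} {true} _ = refl , refl

𝟙 : Bool → ℤ
𝟙 true  = 1ℤ
𝟙 false = 0ℤ

0≤𝟙 : ∀ b → 0ℤ ≤ 𝟙 b
0≤𝟙 true  = +≤+ z≤n
0≤𝟙 false = +≤+ z≤n

𝟙≤1 : ∀ b → 𝟙 b ≤ 1ℤ
𝟙≤1 true  = ℤₚ.≤-refl
𝟙≤1 false = +≤+ z≤n

𝟙-∧ : ∀ a b → 𝟙 (a ∧ b) ≡ 𝟙 a * 𝟙 b
𝟙-∧ true  b = sym (ℤₚ.*-identityˡ _)
𝟙-∧ false b = refl

𝟙-not : ∀ a → 𝟙 (not a) ≡ 1ℤ - 𝟙 a
𝟙-not true  = refl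
𝟙-not false = refl

𝟙-*-cong : ∀ b {x y} → (b ≡ true → x ≡ y) → 𝟙 b * x ≡ 𝟙 b * y
𝟙-*-cong true  e = cong (1ℤ *_) (e refl)
𝟙-*-cong false e = refl

0≤+ : ∀ {k} → 0ℤ ≤ + k
0≤+ = +≤+ z≤n

_⊞_ : ∀ {a b} → 0ℤ ≤ a → 0ℤ ≤ b → 0ℤ ≤ a + b
_⊞_ = ℤₚ.+-mono-≤

_⊠_ : ∀ {a b} → 0ℤ ≤ a → 0ℤ ≤ b → 0ℤ ≤ a * b
_⊠_ {+ m} {+ k} _ _ = subst (0ℤ ≤_) (ℤₚ.pos-* m k) 0≤+

gap : ∀ {a b} → a ≤ b → 0ℤ ≤ b - a
gap = ℤₚ.i≤j⇒0≤j-i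

-- The form in which the counting arguments end: a visibly nonnegative slack, and a ring identity
-- that recognises it as the difference of the two sides.
≤-by : ∀ {a b s} → 0ℤ ≤ s → s ≡ b - a → a ≤ b
≤-by 0≤s refl = ℤₚ.0≤i-j⇒j≤i 0≤s

𝟙-*-mono : ∀ b {x y} → (b ≡ true → x ≤ y) → 𝟙 b * x ≤ 𝟙 b * y
𝟙-*-mono true  {x} {y} l rewrite ℤₚ.*-identityˡ x | ℤₚ.*-identityˡ y = l refl
𝟙-*-mono false l = ℤₚ.≤-refl

0<⇒1≤ : ∀ {a} → 0ℤ < a → 1ℤ ≤ a
0<⇒1≤ (+<+ (s≤s z≤n)) = +≤+ (s≤s z≤n)

1≤⇒0< : ∀ {a} → 1ℤ ≤ a → 0ℤ < a
1≤⇒0< (+≤+ (s≤s z≤n)) = +<+ (s≤s z≤n)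

<⇒1≤- : ∀ {a b} → a < b → 1ℤ ≤ b - a
<⇒1≤- {a} {b} a<b = 0<⇒1≤ (subst (_< b - a) (ℤₚ.+-inverseʳ a) (ℤₚ.+-monoˡ-< (- a) a<b))

-- Finite sums

private
  interchange : ∀ a b c d → (a + b) + (c + d) ≡ (a + c) + (b + d)
  interchange = solve-∀

-- Opaque, so that the number of summands can be inferred by unification.
opaque
  ∑ : ∀ {n} → (Fin n → ℤ) → ℤ
  ∑ = sumℤ

opaque
  unfolding ∑

  ∑≡sumℤ : ∀ {n} (f : Fin n → ℤ) → sumℤ f ≡ ∑ f
  ∑≡sumℤ f = refl

  sum-cong : ∀ {n} {f g : Fin n → ℤ} → (∀ i → f i ≡ g i) → ∑ f ≡ ∑ g
  sum-cong {zero}  e = refl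
  sum-cong {suc n} e = cong₂ _+_ (e Fin.zero) (sum-cong (e ∘ Fin.suc))

  sum-zero : ∀ {n} {f : Fin n → ℤ} → (∀ i → f i ≡ 0ℤ) → ∑ f ≡ 0ℤ
  sum-zero {zero}  e = refl
  sum-zero {suc n} e = cong₂ _+_ (e Fin.zero) (sum-zero (e ∘ Fin.suc))

  sum-+ : ∀ {n} (f g : Fin n → ℤ) → ∑ (λ i → f i + g i) ≡ ∑ f + ∑ g
  sum-+ {zero}  f g = refl
  sum-+ {suc n} f g = trans (cong (_+_ (f Fin.zero + g Fin.zero)) (sum-+ (f ∘ Fin.suc) (g ∘ Fin.suc)))
    (interchange (f Fin.zero) (g Fin.zero) _ _)

  sum-* : ∀ {n} c (f : Fin n → ℤ) → ∑ (λ i → c * f i) ≡ c * ∑ f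
  sum-* {zero}  c f = sym (ℤₚ.*-zeroʳ c)
  sum-* {suc n} c f = trans (cong (_+_ (c * f Fin.zero)) (sum-* c (f ∘ Fin.suc)))
    (sym (ℤₚ.*-distribˡ-+ c (f Fin.zero) _))

  sum-≤ : ∀ {n} {f g : Fin n → ℤ} → (∀ i → f i ≤ g i) → ∑ f ≤ ∑ g
  sum-≤ {zero}  l = ℤₚ.≤-refl
  sum-≤ {suc n} l = ℤₚ.+-mono-≤ (l Fin.zero) (sum-≤ (l ∘ Fin.suc))

  sum-nonneg : ∀ {n} {f : Fin n → ℤ} → (∀ i → 0ℤ ≤ f i) → 0ℤ ≤ ∑ f
  sum-nonneg {zero}  l = ℤₚ.≤-refl
  sum-nonneg {suc n} l = l Fin.zero ⊞ sum-nonneg (l ∘ Fin.suc)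

  term≤sum : ∀ {n} {f : Fin n → ℤ} → (∀ i → 0ℤ ≤ f i) → ∀ i → f i ≤ ∑ f
  term≤sum {suc n} {f} l Fin.zero =
    subst (_≤ ∑ f) (ℤₚ.+-identityʳ (f Fin.zero)) (ℤₚ.+-monoʳ-≤ (f Fin.zero) (sum-nonneg (l ∘ Fin.suc)))
  term≤sum {suc n} {f} l (Fin.suc i) =
    subst (_≤ ∑ f) (ℤₚ.+-identityˡ (f (Fin.suc i))) (ℤₚ.+-mono-≤ (l Fin.zero) (term≤sum (l ∘ Fin.suc) i))

  sum-swap : ∀ {m n} (f : Fin m → Fin n → ℤ) →
    ∑ (λ i → ∑ (λ j → f i j)) ≡ ∑ (λ j → ∑ (λ i → f i j))
  sum-swap {zero}  {n} f = sym (sum-zero {n} {λ _ → 0ℤ} (λ _ → refl))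
  sum-swap {suc m} {n} f = trans (cong (_+_ (∑ (f Fin.zero))) (sum-swap (f ∘ Fin.suc)))
    (sym (sum-+ {n} (f Fin.zero) (λ j → ∑ (λ i → f (Fin.suc i) j))))

  sum-single : ∀ {n} {f : Fin n → ℤ} i → (∀ j → j ≢ i → f j ≡ 0ℤ) → ∑ f ≡ f i
  sum-single {suc n} {f} Fin.zero e =
    trans (cong (_+_ (f Fin.zero)) (sum-zero {n} (λ j → e (Fin.suc j) λ ()))) (ℤₚ.+-identityʳ _)
  sum-single {suc n} {f} (Fin.suc i) e =
    trans (cong₂ _+_ (e Fin.zero λ ()) (sum-single i (λ j j≢i → e (Fin.suc j) (j≢i ∘ Finₚ.suc-injective))))
          (ℤₚ.+-identityˡ _)

  sum-1 : ∀ n → ∑ {n} (λ _ → 1ℤ) ≡ + n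
  sum-1 zero    = refl
  sum-1 (suc n) = cong (_+_ 1ℤ) (sum-1 n)

  countB-sum : ∀ {n} (P : Fin n → Bool) → + countB P ≡ ∑ (λ i → 𝟙 (P i))
  countB-sum {zero}  P = refl
  countB-sum {suc n} P with P Fin.zero
  ... | true  = cong (_+_ 1ℤ) (countB-sum (P ∘ Fin.suc))
  ... | false = trans (countB-sum (P ∘ Fin.suc)) (sym (ℤₚ.+-identityˡ _))

  sum-↑ : ∀ m {n} (f : Fin (m ℕ.+ n) → ℤ) →
    ∑ f ≡ ∑ (λ i → f (i Fin.↑ˡ n)) + ∑ (λ j → f (m Fin.↑ʳ j))
  sum-↑ zero    f = sym (ℤₚ.+-identityˡ _)
  sum-↑ (suc m) f = trans (cong (_+_ (f Fin.zero)) (sum-↑ m (f ∘ Fin.suc))) (sym (ℤₚ.+-assoc (f Fin.zero) _ _))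

sum-neg : ∀ {n} (f : Fin n → ℤ) → ∑ (λ i → - f i) ≡ - ∑ f
sum-neg f = trans (sum-cong (λ i → sym (ℤₚ.-1*i≡-i (f i)))) (trans (sum-* -1ℤ f) (ℤₚ.-1*i≡-i _))

sum-minus : ∀ {n} (f g : Fin n → ℤ) → ∑ (λ i → f i - g i) ≡ ∑ f - ∑ g
sum-minus f g = trans (sum-+ f (λ i → - g i)) (cong (_+_ (∑ f)) (sum-neg g))

sum≡0⇒term≡0 : ∀ {n} {f : Fin n → ℤ} → (∀ i → 0ℤ ≤ f i) → ∑ f ≡ 0ℤ → ∀ i → f i ≡ 0ℤ
sum≡0⇒term≡0 l e i = ℤₚ.≤-antisym (subst (_ ≤_) e (term≤sum l i)) (l i)

infix 8 _≡ᵇ_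
_≡ᵇ_ : ∀ {n} → Fin n → Fin n → Bool
i ≡ᵇ j = ⌊ i Finₚ.≟ j ⌋

≡ᵇ-refl : ∀ {n} (i : Fin n) → (i ≡ᵇ i) ≡ true
≡ᵇ-refl i = ⌊⌋-true (i Finₚ.≟ i) refl

≡ᵇ-sound : ∀ {n} {i j : Fin n} → (i ≡ᵇ j) ≡ true → i ≡ j
≡ᵇ-sound = ⌊⌋-sound (_ Finₚ.≟ _)

≡ᵇ-false : ∀ {n} {i j : Fin n} → i ≢ j → (i ≡ᵇ j) ≡ false
≡ᵇ-false = ⌊⌋-false (_ Finₚ.≟ _)

sum-pick : ∀ {n} (f : Fin n → ℤ) i → ∑ (λ j → 𝟙 (j ≡ᵇ i) * f j) ≡ f i
sum-pick f i = trans (sum-single i (λ j j≢i → cong (λ b → 𝟙 b * f j) (≡ᵇ-false j≢i)))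
  (trans (cong (λ b → 𝟙 b * f i) (≡ᵇ-refl i)) (ℤₚ.*-identityˡ _))

sum-perm : ∀ {n} (π π⁻¹ : Fin n → Fin n) → (∀ i → π (π⁻¹ i) ≡ i) → (∀ i → π⁻¹ (π i) ≡ i) →
  (f : Fin n → ℤ) → ∑ (f ∘ π) ≡ ∑ f
sum-perm π π⁻¹ inv₁ inv₂ f = begin
  ∑ (λ i → f (π i))                               ≡⟨ sum-cong (λ i → sym (sum-pick f (π i))) ⟩
  ∑ (λ i → ∑ (λ j → 𝟙 (j ≡ᵇ π i) * f j))       ≡⟨ sum-swap _ ⟩
  ∑ (λ j → ∑ (λ i → 𝟙 (j ≡ᵇ π i) * f j))       ≡⟨ sum-cong (λ j → trans
      (sum-single (π⁻¹ j) (λ i i≢ → cong (λ b → 𝟙 b * f j)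
        (≡ᵇ-false (λ e → i≢ (trans (sym (inv₂ i)) (cong π⁻¹ (sym e)))))))
      (trans (cong (λ b → 𝟙 b * f j) (⌊⌋-true (_ Finₚ.≟ _) (sym (inv₁ j)))) (ℤₚ.*-identityˡ _))) ⟩
  ∑ f ∎
  where open ≡-Reasoning

-- Capping the terms at the bound does no harm: either one term alone reaches `B`, or the cap
-- affects no term.
sum-⊓ : ∀ {n} {f : Fin n → ℤ} {B} → 0ℤ ≤ B → (∀ i → 0ℤ ≤ f i) → B ≤ ∑ f →
  B ≤ ∑ (λ i → f i ⊓ B)
sum-⊓ {n} {f} {B} 0≤B 0≤f B≤ with Finₚ.any? (λ i → B ℤ.≤? f i)
... | yes (i , B≤f) = ℤₚ.≤-trans (ℤₚ.≤-reflexive (sym (ℤₚ.i≥j⇒i⊓j≡j B≤f)))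
        (term≤sum {f = λ j → f j ⊓ B} (λ j → ℤₚ.⊓-glb (0≤f j) 0≤B) i)
... | no none = subst (B ≤_) (sum-cong (λ i → sym (ℤₚ.i≤j⇒i⊓j≡i (ℤₚ.<⇒≤ (ℤₚ.≰⇒> (λ l → none (i , l))))))) B≤

-- Sums over initial segments, least witnesses

rsum : ℕ → (ℕ → ℤ) → ℤ
rsum zero    F = 0ℤ
rsum (suc k) F = rsum k F + F k

rsum-cong : ∀ k {F G} → (∀ i → i ℕ.< k → F i ≡ G i) → rsum k F ≡ rsum k G
rsum-cong zero    e = refl
rsum-cong (suc k) e = cong₂ _+_ (rsum-cong k (λ i i<k → e i (ℕₚ.m<n⇒m<1+n i<k))) (e k ℕₚ.≤-refl)

rsum-zero : ∀ k {F} → (∀ i → i ℕ.< k → F i ≡ 0ℤ) → rsum k F ≡ 0ℤ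
rsum-zero zero    e = refl
rsum-zero (suc k) e = cong₂ _+_ (rsum-zero k (λ i i<k → e i (ℕₚ.m<n⇒m<1+n i<k))) (e k ℕₚ.≤-refl)

rsum-1 : ∀ k → rsum k (λ _ → 1ℤ) ≡ + k
rsum-1 zero    = refl
rsum-1 (suc k) = trans (cong (_+ 1ℤ) (rsum-1 k)) (cong +_ (ℕₚ.+-comm k 1))

rsum-single : ∀ {k F} i → i ℕ.< k → (∀ j → j ℕ.< k → j ≢ i → F j ≡ 0ℤ) → rsum k F ≡ F i
rsum-single {suc k} {F} i i<k e with i ℕₚ.≟ k
... | yes refl = trans (cong (_+ F k) (rsum-zero k (λ j j<k → e j (ℕₚ.m<n⇒m<1+n j<k) (ℕₚ.<⇒≢ j<k))))
                       (ℤₚ.+-identityˡ _)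
... | no i≢k = trans (cong₂ _+_ (rsum-single i (ℕₚ.≤∧≢⇒< (ℕ.s≤s⁻¹ i<k) i≢k)
                                  (λ j j<k → e j (ℕₚ.m<n⇒m<1+n j<k)))
                                (e k ℕₚ.≤-refl (λ k≡i → i≢k (sym k≡i))))
                     (ℤₚ.+-identityʳ _)

rsum-swap : ∀ {n} k (F : ℕ → Fin n → ℤ) →
  rsum k (λ i → ∑ (F i)) ≡ ∑ (λ g → rsum k (λ i → F i g))
rsum-swap zero    F = sym (sum-zero (λ _ → refl))
rsum-swap (suc k) F = trans (cong (_+ ∑ (F k)) (rsum-swap k F)) (sym (sum-+ _ _))

rsum-*ʳ : ∀ k F c → rsum k (λ i → F i * c) ≡ rsum k F * c
rsum-*ʳ zero    F c = refl
rsum-*ʳ (suc k) F c = trans (cong (_+ F k * c) (rsum-*ʳ k F c)) (sym (ℤₚ.*-distribʳ-+ c (rsum k F) (F k)))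

opaque
  least : (P : ℕ → Set) → (∀ k → Dec (P k)) → ∃ P → ∃[ k ] (P k × (∀ j → j ℕ.< k → ¬ P j))
  least P P? (k , pk) = go k k ℕₚ.≤-refl pk (<-wellFounded k)
    where
    go : ∀ m k → k ℕ.≤ m → P k → Acc ℕ._<_ k → ∃[ k ] (P k × (∀ j → j ℕ.< k → ¬ P j))
    go m k k≤m pk (acc rs) with Finₚ.any? (λ (i : Fin k) → P? (toℕ i))
    ... | yes (i , p) = go m (toℕ i) (ℕₚ.≤-trans (ℕₚ.<⇒≤ (Finₚ.toℕ<n i)) k≤m) p (rs (Finₚ.toℕ<n i))
    ... | no none = k , pk , λ j j<k pj → none (Fin.fromℕ< j<k , subst P (sym (Finₚ.toℕ-fromℕ< j<k)) pj)

-- Orbits of a permutation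

module Orbits {n : ℕ} (π π⁻¹ : Fin n → Fin n)
  (inv₁ : ∀ h → π (π⁻¹ h) ≡ h) (inv₂ : ∀ h → π⁻¹ (π h) ≡ h) where

  infix 4 _~_
  _~_ : Fin n → Fin n → Set
  _~_ = SameOrbit π

  π-injective : ∀ {g h} → π g ≡ π h → g ≡ h
  π-injective e = trans (sym (inv₂ _)) (trans (cong π⁻¹ e) (inv₂ _))

  iter-+ : ∀ j k h → iter π (j ℕ.+ k) h ≡ iter π j (iter π k h)
  iter-+ zero    k h = refl
  iter-+ (suc j) k h = cong π (iter-+ j k h)

  iter-injective : ∀ k {g h} → iter π k g ≡ iter π k h → g ≡ h
  iter-injective zero    e = e
  iter-injective (suc k) e = iter-injective k (π-injective e)

  opaque
    returns : ∀ h → ∃[ k ] (iter π (suc k) h ≡ h × k ℕ.< n)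
    returns h with Finₚ.pigeonhole (ℕₚ.n<1+n n) (λ i → iter π (toℕ i) h)
    ... | i , j , i<j , e = k , sym (iter-injective (toℕ i)
            (trans e (trans (cong (λ t → iter π t h) (trans (sym split) (ℕₚ.+-comm (suc k) (toℕ i))))
              (iter-+ (toℕ i) (suc k) h)))) ,
            ℕₚ.≤-trans (ℕₚ.m+n≤o⇒m≤o (suc k) (ℕₚ.≤-reflexive split)) (ℕ.s≤s⁻¹ (Finₚ.toℕ<n j))
      where
      k : ℕ
      k = toℕ j ℕ.∸ suc (toℕ i)
      split : suc k ℕ.+ toℕ i ≡ toℕ j
      split = trans (sym (ℕₚ.+-suc k (toℕ i))) (ℕₚ.m∸n+n≡m i<j)

  private
    leastReturn : ∀ h → ∃[ k ] (iter π (suc k) h ≡ h × (∀ j → j ℕ.< k → ¬ iter π (suc j) h ≡ h))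
    leastReturn h = least (λ k → iter π (suc k) h ≡ h) (λ k → _ Finₚ.≟ _)
      (proj₁ (returns h) , proj₁ (proj₂ (returns h)))

  period : Fin n → ℕ
  period h = suc (proj₁ (leastReturn h))

  iter-period : ∀ h → iter π (period h) h ≡ h
  iter-period h = proj₁ (proj₂ (leastReturn h))

  period≤n : ∀ h → period h ℕ.≤ n
  period≤n h = ℕₚ.≰⇒> λ n≤ → proj₂ (proj₂ (leastReturn h)) (proj₁ (returns h))
    (ℕₚ.≤-trans (proj₂ (proj₂ (returns h))) n≤) (proj₁ (proj₂ (returns h)))

  iter-period-* : ∀ q h → iter π (q ℕ.* period h) h ≡ h
  iter-period-* zero    h = refl
  iter-period-* (suc q) h = trans (iter-+ (period h) (q ℕ.* period h) h)
    (trans (cong (iter π (period h)) (iter-period-* q h)) (iter-period h))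

  iter-% : ∀ k h → iter π k h ≡ iter π (k DM.% period h) h
  iter-% k h = trans (cong (λ t → iter π t h) (DM.m≡m%n+[m/n]*n k (period h)))
    (trans (iter-+ (k DM.% period h) _ h) (cong (iter π (k DM.% period h)) (iter-period-* (k DM./ period h) h)))

  iter-distinct : ∀ {h i j} → j ℕ.< period h → i ℕ.< j → iter π i h ≢ iter π j h
  iter-distinct {h} {i} {j} j< i<j e =
    proj₂ (proj₂ (leastReturn h)) k
      (ℕₚ.≤-trans (ℕₚ.m+n≤o⇒m≤o (suc k) (ℕₚ.≤-reflexive split)) (ℕ.s≤s⁻¹ j<))
      (sym (iter-injective i (trans e (trans (cong (λ t → iter π t h) (trans (sym split) (ℕₚ.+-comm (suc k) i)))
        (iter-+ i (suc k) h)))))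
    where
    k = j ℕ.∸ suc i
    split : suc k ℕ.+ i ≡ j
    split = trans (sym (ℕₚ.+-suc k i)) (ℕₚ.m∸n+n≡m i<j)

  iter-injective< : ∀ {h i j} → i ℕ.< period h → j ℕ.< period h → iter π i h ≡ iter π j h → i ≡ j
  iter-injective< {h} {i} {j} i< j< e with ℕₚ.<-cmp i j
  ... | tri< i<j _ _ = ⊥-elim (iter-distinct j< i<j e)
  ... | tri≈ _ i≡j _ = i≡j
  ... | tri> _ _ j<i = ⊥-elim (iter-distinct i< j<i (sym e))

  ~-bounded : ∀ {g h} → g ~ h → ∃[ k ] (k ℕ.< period g × iter π k g ≡ h)
  ~-bounded {g} (k , e) = k DM.% period g , DM.m%n<n k (period g) , trans (sym (iter-% k g)) e

  ~-refl : ∀ {h} → h ~ h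
  ~-refl = 0 , refl

  ~-reflexive : ∀ {g h} → g ≡ h → g ~ h
  ~-reflexive e = 0 , e

  ~-trans : ∀ {f g h} → f ~ g → g ~ h → f ~ h
  ~-trans {f} (j , refl) (k , e) = k ℕ.+ j , trans (iter-+ k j f) e

  ~-sym : ∀ {g h} → g ~ h → h ~ g
  ~-sym {g} g~h with ~-bounded g~h
  ... | k , k< , refl = period g ℕ.∸ k , trans (sym (iter-+ (period g ℕ.∸ k) k g))
    (trans (cong (λ t → iter π t g) (ℕₚ.m∸n+n≡m (ℕₚ.<⇒≤ k<))) (iter-period g))

  ~-π : ∀ {h} → h ~ π h
  ~-π = 1 , refl

  opaque
    in? : Fin n → Fin n → Bool
    in? = inOrbit? π

    in?≡ : ∀ g h → inOrbit? π g h ≡ in? g h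
    in?≡ g h = refl

    in?-true : ∀ {g h} → g ~ h → in? g h ≡ true
    in?-true {g} {h} g~h with ~-bounded g~h
    ... | k , k< , refl = ⌊⌋-true (Any.any? (h Finₚ.≟_) (orbit π g))
      (∈-map⁺ (λ k → iter π k g) (∈-upTo⁺ (ℕₚ.≤-trans k< (period≤n g))))

    in?-sound : ∀ {g h} → in? g h ≡ true → g ~ h
    in?-sound {g} {h} e with ∈-map⁻ (λ k → iter π k g) (⌊⌋-sound (Any.any? (h Finₚ.≟_) (orbit π g)) e)
    ... | k , _ , h≡ = k , sym h≡

  infix 4 _~?_
  _~?_ : ∀ g h → Dec (g ~ h)
  g ~? h = map′ in?-sound in?-true (in? g h Boolₚ.≟ true)

  in?-false : ∀ {g h} → ¬ (g ~ h) → in? g h ≡ false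
  in?-false ¬g~h = ¬true⇒false (¬g~h ∘ in?-sound)

  in?-congʳ : ∀ {g h h'} → h ~ h' → in? g h ≡ in? g h'
  in?-congʳ h~h' = ⇔⇒≡ (λ e → in?-true (~-trans (in?-sound e) h~h'))
                       (λ e → in?-true (~-trans (in?-sound e) (~-sym h~h')))

  in?-congˡ : ∀ {g g' h} → g ~ g' → in? g h ≡ in? g' h
  in?-congˡ g~g' = ⇔⇒≡ (λ e → in?-true (~-trans (~-sym g~g') (in?-sound e)))
                       (λ e → in?-true (~-trans g~g' (in?-sound e)))

  in?-sym : ∀ g h → in? g h ≡ in? h g
  in?-sym g h = ⇔⇒≡ (in?-true ∘ ~-sym ∘ in?-sound) (in?-true ∘ ~-sym ∘ in?-sound)

  Invariant : {A : Set} → (Fin n → A) → Set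
  Invariant A = ∀ h → A (π h) ≡ A h

  ~-invariant : {B : Set} {A : Fin n → B} → Invariant A → ∀ {g h} → g ~ h → A g ≡ A h
  ~-invariant {A = A} inv {g} (k , refl) = go k
    where
    go : ∀ k → A g ≡ A (iter π k g)
    go zero    = refl
    go (suc k) = trans (go k) (sym (inv _))

  opaque
    min? : Fin n → Bool
    min? = isMinInOrbit π

    min?-sound : ∀ {h} → min? h ≡ true → ∀ {g} → h ~ g → toℕ h ℕ.≤ toℕ g
    min?-sound {h} e h~g with ~-bounded h~g
    ... | k , k< , refl = All.lookup (⌊⌋-sound (All.all? (λ j → toℕ h ℕ.≤? toℕ j) (orbit π h)) e)
      (∈-map⁺ (λ k → iter π k h) (∈-upTo⁺ (ℕₚ.≤-trans k< (period≤n h))))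

    min?-true : ∀ {h} → (∀ {g} → h ~ g → toℕ h ℕ.≤ toℕ g) → min? h ≡ true
    min?-true {h} le = ⌊⌋-true (All.all? (λ j → toℕ h ℕ.≤? toℕ j) (orbit π h))
      (All.tabulate λ g∈ → case ∈-map⁻ (λ k → iter π k h) g∈ of λ { (k , _ , refl) → le (k , refl) })

    numOrbits≡ : + numOrbits π ≡ ∑ (λ r → 𝟙 (min? r))
    numOrbits≡ = countB-sum min?

  private
    minimum : ∀ h → ∃[ r ] (h ~ r × min? r ≡ true)
    minimum h with least (λ t → ∃[ r ] (toℕ r ≡ t × h ~ r))
                     (λ t → Finₚ.any? (λ r → (toℕ r ℕₚ.≟ t) ×-dec (h ~? r))) (toℕ h , h , refl , ~-refl)
    ... | t , (r , refl , h~r) , smaller = r , h~r ,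
      min?-true (λ {g} r~g → ℕₚ.≮⇒≥ (λ g<r → smaller (toℕ g) g<r (g , refl , ~-trans h~r r~g)))

  opaque
    rep : Fin n → Fin n
    rep h = proj₁ (minimum h)

    ~-rep : ∀ {h} → h ~ rep h
    ~-rep {h} = proj₁ (proj₂ (minimum h))

    min?-rep : ∀ h → min? (rep h) ≡ true
    min?-rep h = proj₂ (proj₂ (minimum h))

  min?-unique : ∀ {g h} → min? g ≡ true → min? h ≡ true → g ~ h → g ≡ h
  min?-unique mg mh g~h = Finₚ.toℕ-injective (ℕₚ.≤-antisym (min?-sound mg g~h) (min?-sound mh (~-sym g~h)))

  rep-cong : ∀ {g h} → g ~ h → rep g ≡ rep h
  rep-cong {g} {h} g~h = min?-unique (min?-rep g) (min?-rep h) (~-trans (~-sym ~-rep) (~-trans g~h ~-rep))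

  -- Written over the whole set with an indicator, so that it can be exchanged with other sums.
  osum : (Fin n → ℤ) → Fin n → ℤ
  osum f h = ∑ (λ g → 𝟙 (in? h g) * f g)

  osum-cong : ∀ {f f'} {h} → (∀ g → h ~ g → f g ≡ f' g) → osum f h ≡ osum f' h
  osum-cong e = sum-cong (λ g → 𝟙-*-cong (in? _ g) (λ t → e g (in?-sound t)))

  osum-π : ∀ f h → osum (f ∘ π) h ≡ osum f h
  osum-π f h = trans (sum-cong (λ g → cong (λ b → 𝟙 b * f (π g)) (in?-congʳ {h} ~-π)))
    (sum-perm π π⁻¹ inv₁ inv₂ (λ g → 𝟙 (in? h g) * f g))

  osum-~ : ∀ f {g h} → g ~ h → osum f g ≡ osum f h
  osum-~ f g~h = sum-cong (λ x → cong (λ b → 𝟙 b * f x) (in?-congˡ g~h))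

  osum-+ : ∀ f g h → osum (λ x → f x + g x) h ≡ osum f h + osum g h
  osum-+ f g h = trans (sum-cong (λ x → ℤₚ.*-distribˡ-+ (𝟙 (in? h x)) (f x) (g x))) (sum-+ _ _)

  osum-neg : ∀ f h → osum (λ x → - f x) h ≡ - osum f h
  osum-neg f h = trans (sum-cong (λ x → sym (ℤₚ.neg-distribʳ-* (𝟙 (in? h x)) (f x)))) (sum-neg _)

  osum-minus : ∀ f g h → osum (λ x → f x - g x) h ≡ osum f h - osum g h
  osum-minus f g h = trans (osum-+ f (λ x → - g x) h) (cong (_+_ (osum f h)) (osum-neg g h))

  osum-mono : ∀ {f f'} {h} → (∀ g → h ~ g → f g ≤ f' g) → osum f h ≤ osum f' h
  osum-mono {h = h} e = sum-≤ (λ g → 𝟙-*-mono (in? h g) (λ t → e g (in?-sound t)))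

  osum-nonneg : ∀ {f} h → (∀ g → 0ℤ ≤ f g) → 0ℤ ≤ osum f h
  osum-nonneg h l = sum-nonneg (λ g → 0≤𝟙 (in? h g) ⊠ l g)

  term≤osum : ∀ {f h} → (∀ g → 0ℤ ≤ f g) → ∀ {g} → h ~ g → f g ≤ osum f h
  term≤osum {f} {h} l {g} h~g = subst (_≤ osum f h)
    (trans (cong (λ b → 𝟙 b * f g) (in?-true h~g)) (ℤₚ.*-identityˡ _))
    (term≤sum {f = λ x → 𝟙 (in? h x) * f x} (λ x → 0≤𝟙 (in? h x) ⊠ l x) g)

  osum≡0⇒term≡0 : ∀ {f h} → (∀ g → 0ℤ ≤ f g) → osum f h ≡ 0ℤ → ∀ {g} → h ~ g → f g ≡ 0ℤ
  osum≡0⇒term≡0 {f} l e {g} h~g = ℤₚ.≤-antisym (subst (f g ≤_) e (term≤osum l h~g)) (l g)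

  -- A partition of unity: multiplying by it inserts a sum over orbits, named by their least
  -- elements, into any other sum.
  fibre : ∀ h → ∑ (λ r → 𝟙 (min? r) * 𝟙 (in? r h)) ≡ 1ℤ
  fibre h = trans (sum-single (rep h) other)
    (cong₂ (λ a b → 𝟙 a * 𝟙 b) (min?-rep h) (in?-true (~-sym ~-rep)))
    where
    other : ∀ r → r ≢ rep h → 𝟙 (min? r) * 𝟙 (in? r h) ≡ 0ℤ
    other r r≢ with bool (min? r) | bool (in? r h)
    ... | inj₂ e | _ = cong (λ b → 𝟙 b * 𝟙 (in? r h)) e
    ... | _ | inj₂ e = trans (cong (λ b → 𝟙 (min? r) * 𝟙 b) e) (ℤₚ.*-zeroʳ (𝟙 (min? r)))
    ... | inj₁ m | inj₁ e = ⊥-elim (r≢ (min?-unique m (min?-rep h) (~-trans (in?-sound e) ~-rep)))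

  sum-by-orbits : ∀ {A : Fin n → Bool} → Invariant A → (f : Fin n → ℤ) →
    ∑ (λ h → 𝟙 (A h) * f h) ≡ ∑ (λ r → 𝟙 (min? r) * (𝟙 (A r) * osum f r))
  sum-by-orbits {A} inv f = begin
    ∑ (λ h → 𝟙 (A h) * f h)
      ≡⟨ sum-cong (λ h → trans (sym (ℤₚ.*-identityʳ _)) (trans (cong (𝟙 (A h) * f h *_) (sym (fibre h)))
          (sym (sum-* (𝟙 (A h) * f h) (λ r → 𝟙 (min? r) * 𝟙 (in? r h)))))) ⟩
    ∑ (λ h → ∑ (λ r → 𝟙 (A h) * f h * (𝟙 (min? r) * 𝟙 (in? r h))))
      ≡⟨ sum-swap _ ⟩
    ∑ (λ r → ∑ (λ h → 𝟙 (A h) * f h * (𝟙 (min? r) * 𝟙 (in? r h))))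
      ≡⟨ sum-cong (λ r → trans (sum-cong (λ h → term r h)) 
          (trans (sum-* (𝟙 (min? r)) (λ h → 𝟙 (A r) * (𝟙 (in? r h) * f h)))
            (cong (𝟙 (min? r) *_) (sum-* (𝟙 (A r)) (λ h → 𝟙 (in? r h) * f h))))) ⟩
    ∑ (λ r → 𝟙 (min? r) * (𝟙 (A r) * osum f r)) ∎
    where
    open ≡-Reasoning
    shuffle : ∀ a x m i → a * x * (m * i) ≡ m * (i * (a * x))
    shuffle = solve-∀
    shuffle' : ∀ a x m i → m * (i * (a * x)) ≡ m * (a * (i * x))
    shuffle' = solve-∀
    term : ∀ r h → 𝟙 (A h) * f h * (𝟙 (min? r) * 𝟙 (in? r h)) ≡ 𝟙 (min? r) * (𝟙 (A r) * (𝟙 (in? r h) * f h))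
    term r h = trans (shuffle (𝟙 (A h)) (f h) (𝟙 (min? r)) (𝟙 (in? r h)))
      (trans (cong (𝟙 (min? r) *_) (𝟙-*-cong (in? r h)
        (λ t → cong (λ b → 𝟙 b * f h) (sym (~-invariant inv (in?-sound t))))))
        (shuffle' (𝟙 (A r)) (f h) (𝟙 (min? r)) (𝟙 (in? r h))))

  #orb : (Fin n → Bool) → ℤ
  #orb A = ∑ (λ r → 𝟙 (min? r) * 𝟙 (A r))

  -- `t` picks one element in each orbit in `A`, so its fixed points count these orbits. Applied to
  -- parent edges it counts the edges of a forest.
  transversal : ∀ {A : Fin n → Bool} {t : Fin n → Fin n} → Invariant A →
    (∀ {g h} → g ~ h → t g ≡ t h) → (∀ {h} → A h ≡ true → h ~ t h) →
    ∑ (λ h → 𝟙 (A h) * 𝟙 (t h ≡ᵇ h)) ≡ #orb A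
  transversal {A} {t} inv t-cong t-orbit = trans (sum-by-orbits inv _)
    (sum-cong (λ r → cong (𝟙 (min? r) *_)
      (trans (𝟙-*-cong (A r) (λ a → one r a)) (ℤₚ.*-identityʳ _))))
    where
    one : ∀ r → A r ≡ true → osum (λ h → 𝟙 (t h ≡ᵇ h)) r ≡ 1ℤ
    one r a = trans (sum-single (t r) other)
      (cong₂ (λ a b → 𝟙 a * 𝟙 b) (in?-true (t-orbit a)) (⌊⌋-true (_ Finₚ.≟ _) (sym (t-cong (t-orbit a)))))
      where
      other : ∀ h → h ≢ t r → 𝟙 (in? r h) * 𝟙 (t h ≡ᵇ h) ≡ 0ℤ
      other h h≢ with bool (in? r h)
      ... | inj₂ e = cong (λ b → 𝟙 b * 𝟙 (t h ≡ᵇ h)) e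
      ... | inj₁ e = trans (cong (λ b → 𝟙 (in? r h) * 𝟙 b)
              (≡ᵇ-false (λ th≡h → h≢ (trans (sym th≡h) (sym (t-cong (in?-sound e)))))))
              (ℤₚ.*-zeroʳ (𝟙 (in? r h)))

  #orb-* : ∀ {A} → Invariant A → ∀ c (f : Fin n → ℤ) → (∀ h → A h ≡ true → osum f h ≡ c) →
    ∑ (λ h → 𝟙 (A h) * f h) ≡ c * #orb A
  #orb-* {A} inv c f e = trans (sum-by-orbits inv f)
    (trans (sum-cong (λ r → trans (cong (𝟙 (min? r) *_) (𝟙-*-cong (A r) (e r))) (shuffle (𝟙 (min? r)) (𝟙 (A r)) c)))
      (sum-* c (λ r → 𝟙 (min? r) * 𝟙 (A r))))
    where
    shuffle : ∀ m a c → m * (a * c) ≡ c * (m * a)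
    shuffle = solve-∀

  rsum-period : ∀ f h → rsum (period h) (λ i → f (iter π i h)) ≡ osum f h
  rsum-period f h = begin
    rsum (period h) (λ i → f (iter π i h))
      ≡⟨ rsum-cong (period h) (λ i _ → sym (sum-pick f (iter π i h))) ⟩
    rsum (period h) (λ i → ∑ (λ g → 𝟙 (g ≡ᵇ iter π i h) * f g))
      ≡⟨ rsum-swap (period h) _ ⟩
    ∑ (λ g → rsum (period h) (λ i → 𝟙 (g ≡ᵇ iter π i h) * f g))
      ≡⟨ sum-cong (λ g → trans (rsum-*ʳ (period h) _ (f g)) (cong (_* f g) (hits g))) ⟩
    osum f h ∎
    where
    open ≡-Reasoning
    hits : ∀ g → rsum (period h) (λ i → 𝟙 (g ≡ᵇ iter π i h)) ≡ 𝟙 (in? h g)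
    hits g with h ~? g
    ... | no ¬h~g = trans (rsum-zero (period h) (λ i _ → cong 𝟙 (≡ᵇ-false (λ e → ¬h~g (i , sym e)))))
                      (cong 𝟙 (sym (in?-false ¬h~g)))
    ... | yes h~g with ~-bounded h~g
    ... | k , k< , refl = trans (rsum-single k k< (λ j j< j≢k → cong 𝟙 (≡ᵇ-false (λ e → j≢k (iter-injective< j< k< (sym e))))))
                            (trans (cong 𝟙 (≡ᵇ-refl (iter π k h))) (cong 𝟙 (sym (in?-true h~g))))

  osum-1 : ∀ h → osum (λ _ → 1ℤ) h ≡ + orbitSize π h
  osum-1 h = trans (sum-cong (λ g → ℤₚ.*-identityʳ _)) (trans (sum-cong (λ g → cong 𝟙 (sym (in?≡ h g)))) (sym (countB-sum (inOrbit? π h))))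

  period≡size : ∀ h → period h ≡ orbitSize π h
  period≡size h = ℤₚ.+-injective (trans (sym (rsum-1 (period h))) (trans (rsum-period (λ _ → 1ℤ) h) (osum-1 h)))

  private
    partial : (Fin n → ℤ) → Fin n → ℕ → ℤ
    partial ζ r k = rsum k (λ i → ζ (iter π i r))

  -- The values are partial sums from the representative of the orbit; the vanishing of the total is
  -- what makes the last step of the round trip fit.
  integrate : (ζ : Fin n → ℤ) → (∀ h → osum ζ h ≡ 0ℤ) →
    Σ (Fin n → ℤ) λ p → ∀ h → p (π h) - p h ≡ ζ h
  integrate ζ zero-sum = p , diff
    where
    pos : ∀ h → ∃[ k ] (k ℕ.< period (rep h) × iter π k (rep h) ≡ h)
    pos h = ~-bounded (~-sym ~-rep)
    p : Fin n → ℤ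
    p h = partial ζ (rep h) (proj₁ (pos h))
    cancel : ∀ a b → (a + b) - a ≡ b
    cancel = solve-∀
    cancel₀ : ∀ a b → a + b ≡ 0ℤ → 0ℤ - a ≡ b
    cancel₀ a b e = trans (cong (_- a) (sym e)) (cancel a b)
    value : ∀ {h} k → k ℕ.< period (rep h) → iter π k (rep h) ≡ h → p h ≡ partial ζ (rep h) k
    value {h} k k< e = cong (partial ζ (rep h))
      (iter-injective< (proj₁ (proj₂ (pos h))) k< (trans (proj₂ (proj₂ (pos h))) (sym e)))
    r≡ : ∀ h → rep (π h) ≡ rep h
    r≡ h = rep-cong (~-sym ~-π)
    diff : ∀ h → p (π h) - p h ≡ ζ h
    diff h = cases (suc k ℕₚ.≟ period (rep h))
      where
      k = proj₁ (pos h)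
      e : iter π k (rep h) ≡ h
      e = proj₂ (proj₂ (pos h))
      cases : Dec (suc k ≡ period (rep h)) → p (π h) - p h ≡ ζ h
      cases (no ≢p) = trans (cong (_- p h)
          (trans (value {π h} (suc k) lt (trans (cong (λ r → iter π (suc k) r) (r≡ h)) (cong π e)))
            (cong (λ r → partial ζ r (suc k)) (r≡ h))))
          (trans (cancel (p h) _) (cong ζ e))
        where
        lt : suc k ℕ.< period (rep (π h))
        lt = subst (λ r → suc k ℕ.< period r) (sym (r≡ h)) (ℕₚ.≤∧≢⇒< (proj₁ (proj₂ (pos h))) ≢p)
      cases (yes ≡p) = trans (cong (_- p h) (value {π h} 0 (s≤s z≤n) back))
          (trans (cancel₀ (p h) _ (trans (cong (partial ζ (rep h)) ≡p)
            (trans (rsum-period ζ (rep h)) (zero-sum (rep h))))) (cong ζ e))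
        where
        back : rep (π h) ≡ π h
        back = trans (r≡ h) (trans (sym (iter-period (rep h)))
          (trans (cong (λ t → iter π t (rep h)) (sym ≡p)) (cong π e)))

  #orb-not : ∀ A → #orb (λ h → not (A h)) ≡ ∑ (λ r → 𝟙 (min? r)) - #orb A
  #orb-not A = trans (sum-cong (λ r → trans (cong (𝟙 (min? r) *_) (𝟙-not (A r))) (distrib (𝟙 (min? r)) (𝟙 (A r)))))
    (sum-minus _ _)
    where
    distrib : ∀ m a → m * (1ℤ - a) ≡ m - m * a
    distrib = solve-∀

  #orb-in? : ∀ h → #orb (in? h) ≡ 1ℤ
  #orb-in? h = trans (sum-cong (λ r → cong (λ b → 𝟙 (min? r) * 𝟙 b) (in?-sym h r))) (fibre h)

-- Classical reasoning under a double negation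

infixl 1 _>>=_

_>>=_ : {A B : Set} → ¬ ¬ A → (A → ¬ ¬ B) → ¬ ¬ B
(a >>= f) ¬b = a (λ x → f x ¬b)

return : {A : Set} → A → ¬ ¬ A
return a ¬a = ¬a a

excluded-middle : (A : Set) → ¬ ¬ Dec A
excluded-middle A ¬d = ¬d (no (λ a → ¬d (yes a)))

¬¬-∀ : ∀ {n} {P : Fin n → Set} → (∀ i → ¬ ¬ P i) → ¬ ¬ (∀ i → P i)
¬¬-∀ {zero}  p = return (λ ())
¬¬-∀ {suc n} p = do
  p₀ ← p Fin.zero
  ps ← ¬¬-∀ (p ∘ Fin.suc)
  return (λ { Fin.zero → p₀ ; (Fin.suc i) → ps i })

record Decides {n} (P : Fin n → Set) (A : Fin n → Bool) : Set where
  field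
    sound  : ∀ {h} → A h ≡ true → P h
    refute : ∀ {h} → A h ≡ false → ¬ P h
  complete : ∀ {h} → P h → A h ≡ true
  complete {h} p = [ (λ t → t) , (λ f → ⊥-elim (refute f p)) ]′ (bool (A h))
  reject : ∀ {h} → ¬ P h → A h ≡ false
  reject ¬p = ¬true⇒false (¬p ∘ sound)

decides : ∀ {n} {P : Fin n → Set} (d : ∀ h → Dec (P h)) → Decides P (λ h → ⌊ d h ⌋)
decides d = record { sound = λ {h} → ⌊⌋-sound (d h) ; refute = λ {h} → ⌊⌋-refute (d h) }

-- Sets that are known only through a property, such as a reachable part, become Boolean and can
-- then be summed over.
classify : ∀ {n} (P : Fin n → Set) → ¬ ¬ Σ (Fin n → Bool) (Decides P)
classify P = do
  d ← ¬¬-∀ (λ i → excluded-middle (P i))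
  return ((λ i → ⌊ d i ⌋) , decides d)

¬¬-least : (P : ℕ → Set) → ∃ P → ¬ ¬ (∃[ k ] (P k × (∀ j → j ℕ.< k → ¬ P j)))
¬¬-least P (k , pk) = go k pk (<-wellFounded k)
  where
  go : ∀ k → P k → Acc ℕ._<_ k → ¬ ¬ (∃[ k ] (P k × (∀ j → j ℕ.< k → ¬ P j)))
  go k pk (acc rs) ¬least = ¬least (k , pk , λ j j<k pj → go j pj (rs j<k) ¬least)

bounded : ∀ {n} (f : Fin n → ℕ) → ∃[ N ] (∀ i → f i ℕ.≤ N)
bounded {zero}  f = 0 , λ ()
bounded {suc n} f with bounded (f ∘ Fin.suc)
... | N , le = f Fin.zero ℕ.+ N , λ { Fin.zero → ℕₚ.m≤m+n _ N ; (Fin.suc i) → ℕₚ.≤-trans (le i) (ℕₚ.m≤n+m N _) }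

-- Rooted spanning forests of an orbit graph

module Forests {n : ℕ} (π π⁻¹ : Fin n → Fin n)
  (inv₁ : ∀ h → π (π⁻¹ h) ≡ h) (inv₂ : ∀ h → π⁻¹ (π h) ≡ h)
  (α : Fin n → Fin n) (α-invol : ∀ h → α (α h) ≡ h) where

  open Orbits π π⁻¹ inv₁ inv₂

  -- A rooted spanning forest of the graph whose nodes are the orbits of π and
  -- whose edges are the pairs {h , α h}: parent h is the half-edge of the orbit
  -- of h on the edge towards its parent.
  record Forest (Rt : Fin n → Bool) (X : Fin n → Set) : Set where
    field
      depth        : Fin n → ℕ
      parent       : Fin n → Fin n
      depth-~      : ∀ {g h} → g ~ h → depth g ≡ depth h
      parent-~     : ∀ {g h} → g ~ h → parent g ≡ parent h
      parent-orbit : ∀ {h} → Rt h ≡ false → h ~ parent h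
      parent-X     : ∀ {h} → Rt h ≡ false → X (parent h)
      parent-depth : ∀ {h} → Rt h ≡ false → depth (α (parent h)) ℕ.< depth h

    tree : Fin n → Bool
    tree h = not (Rt h) ∧ (parent h ≡ᵇ h)

    tree-sound : ∀ {h} → tree h ≡ true → (Rt h ≡ false) × (parent h ≡ h)
    tree-sound {h} t with Rt h
    ... | false = refl , ≡ᵇ-sound t

    tree-X : ∀ {h} → tree h ≡ true → X h
    tree-X t with tree-sound t
    ... | r , e = subst X e (parent-X r)

    tree-depth : ∀ {h} → tree h ≡ true → depth (α h) ℕ.< depth h
    tree-depth {h} t with tree-sound t
    ... | r , e = subst (λ x → depth (α x) ℕ.< depth h) e (parent-depth r)

    tree-α : ∀ {h} → tree h ≡ true → tree (α h) ≡ true → ⊥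
    tree-α {h} t t' = ℕₚ.<-asym (tree-depth t) (subst (λ x → depth x ℕ.< depth (α h)) (α-invol h) (tree-depth t'))

    -- Each orbit outside the roots has one edge to its parent, and `tree` marks that edge at the
    -- end of the child only.
    count-tree : Invariant Rt → ∑ (λ h → 𝟙 (tree h)) ≡ #orb (λ h → not (Rt h))
    count-tree inv = trans (sum-cong (λ h → 𝟙-∧ (not (Rt h)) (parent h ≡ᵇ h)))
      (transversal (λ h → cong not (inv h)) parent-~ (λ {h} e → parent-orbit (not-true e)))
      where
      not-true : ∀ {b} → not b ≡ true → b ≡ false
      not-true {false} _ = refl

  -- The length is an index so that shortest paths can be chosen; their lengths are the depths of a
  -- forest.
  data Conn (Rt : Fin n → Bool) (X : Fin n → Set) : ℕ → Fin n → Set where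
    at    : ∀ {h} → Rt h ≡ true → Conn Rt X 0 h
    cross : ∀ {ℓ g h} → Conn Rt X ℓ g → X g → α g ~ h → Conn Rt X (suc ℓ) h

  Connected : (Fin n → Bool) → (Fin n → Set) → Fin n → Set
  Connected Rt X h = ∃[ ℓ ] Conn Rt X ℓ h

  module _ {Rt : Fin n → Bool} {X : Fin n → Set} (inv : Invariant Rt) where

    Conn-~ : ∀ {ℓ g h} → g ~ h → Conn Rt X ℓ g → Conn Rt X ℓ h
    Conn-~ g~h (at r)          = at (trans (sym (~-invariant inv g~h)) r)
    Conn-~ g~h (cross c x g'~) = cross c x (~-trans g'~ g~h)

    private
      Shortest : Fin n → Set
      Shortest r = ∃[ ℓ ] (Conn Rt X ℓ r × (∀ j → j ℕ.< ℓ → ¬ Conn Rt X j r))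

      last : ∀ {ℓ h} → Conn Rt X ℓ h → Fin n
      last {h = h} (at _)      = h
      last (cross {g = g} _ _ _) = α g

    -- The last edge of a shortest path from the roots comes from a node of smaller depth, so these
    -- edges form a forest. The double negation is the price of choosing shortest paths over an
    -- undecided edge set.
    grow : (∀ {h} → X h → X (α h)) → (∀ h → Connected Rt X h) → ¬ ¬ Forest Rt X
    grow X-α conn = do
      s ← ¬¬-∀ {P = Shortest} (λ r → ¬¬-least (λ ℓ → Conn Rt X ℓ r) (conn r))
      return (forest s)
      where
      forest : (∀ r → Shortest r) → Forest Rt X
      forest s = record
        { depth = depth
        ; parent = λ h → last (path (rep h))
        ; depth-~ = λ g~h → cong (λ r → proj₁ (s r)) (rep-cong g~h)
        ; parent-~ = λ g~h → cong (λ r → last (path r)) (rep-cong g~h)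
        ; parent-orbit = λ {h} r → ~-trans ~-rep (~-sym (last-~ (path (rep h)) (rep-nonroot r)))
        ; parent-X = λ {h} r → last-X (path (rep h)) (rep-nonroot r)
        ; parent-depth = λ {h} r → last-depth (path (rep h)) (rep-nonroot r)
        }
        where
        depth : Fin n → ℕ
        depth h = proj₁ (s (rep h))
        path : ∀ r → Conn Rt X (proj₁ (s r)) r
        path r = proj₁ (proj₂ (s r))
        rep-nonroot : ∀ {h} → Rt h ≡ false → Rt (rep h) ≡ false
        rep-nonroot r = trans (sym (~-invariant inv ~-rep)) r
        depth≤ : ∀ {ℓ h} → Conn Rt X ℓ h → depth h ℕ.≤ ℓ
        depth≤ {ℓ} {h} c = ℕₚ.≮⇒≥ (λ lt → proj₂ (proj₂ (s (rep h))) ℓ lt (Conn-~ ~-rep c))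
        last-~ : ∀ {ℓ h} (c : Conn Rt X ℓ h) → Rt h ≡ false → last c ~ h
        last-~ (at t) f = ⊥-elim (true≢false t f)
        last-~ (cross c x e) f = e
        last-X : ∀ {ℓ h} (c : Conn Rt X ℓ h) → Rt h ≡ false → X (last c)
        last-X (at t) f = ⊥-elim (true≢false t f)
        last-X (cross c x e) f = X-α x
        last-depth : ∀ {ℓ h} (c : Conn Rt X ℓ h) → Rt h ≡ false → depth (α (last c)) ℕ.< ℓ
        last-depth (at t) f = ⊥-elim (true≢false t f)
        last-depth (cross {g = g} c x e) f = s≤s (subst (λ x → depth x ℕ.≤ _) (sym (α-invol g)) (depth≤ c))

    -- Leaves first: at a deepest node only the edge to the parent can carry flow.
    peel : (T : Forest Rt X) (δ : Fin n → ℤ) → (∀ h → δ (α h) ≡ - δ h) →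
      (∀ h → Rt h ≡ false → osum δ h ≡ 0ℤ) →
      (∀ h → Forest.tree T h ≡ false → Forest.tree T (α h) ≡ false → δ h ≡ 0ℤ) → ∀ h → δ h ≡ 0ℤ
    peel T δ anti conserved supp h = [ onTree h , (λ t → [ flip , supp h t ]′ (bool (tree (α h)))) ]′ (bool (tree h))
      where
      open Forest T
      N = proj₁ (bounded depth)
      unflip : ∀ g → δ (α g) ≡ 0ℤ → δ g ≡ 0ℤ
      unflip g e = ℤₚ.neg-injective (trans (sym (anti g)) e)
      -- `k` bounds the number of levels from `g` down to the deepest nodes; at `k = 0` the depth of
      -- `g` would exceed the maximum `N`.
      go : ∀ k g → tree g ≡ true → N ℕ.< depth g ℕ.+ k → δ g ≡ 0ℤ
      go zero g t lt = ⊥-elim (ℕₚ.<⇒≱ lt (ℕₚ.≤-trans (ℕₚ.≤-reflexive (ℕₚ.+-identityʳ _)) (proj₂ (bounded depth) g)))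
      go (suc k) g t lt = trans (sym (trans (sum-single g other)
          (trans (cong (λ b → 𝟙 b * δ g) (in?-true ~-refl)) (ℤₚ.*-identityˡ _))))
          (conserved g (proj₁ (tree-sound t)))
        where
        zero-at : ∀ x → g ~ x → x ≢ g → δ x ≡ 0ℤ
        zero-at x g~x x≢g with bool (tree x) | bool (tree (α x))
        ... | inj₁ tx | _ = ⊥-elim (x≢g (trans (sym (proj₂ (tree-sound tx)))
                              (trans (sym (parent-~ g~x)) (proj₂ (tree-sound t)))))
        ... | inj₂ fx | inj₂ fαx = supp x fx fαx
        ... | inj₂ fx | inj₁ tαx = unflip x (go k (α x) tαx
                (ℕₚ.<-≤-trans lt (subst (ℕ._≤ depth (α x) ℕ.+ k) (sym (ℕₚ.+-suc (depth g) k))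
                  (ℕₚ.+-monoˡ-≤ k (subst (ℕ._< depth (α x)) (trans (cong depth (α-invol x)) (sym (depth-~ g~x)))
                    (tree-depth tαx))))))
        other : ∀ x → x ≢ g → 𝟙 (in? g x) * δ x ≡ 0ℤ
        other x x≢g = trans (𝟙-*-cong (in? g x) (λ i → zero-at x (in?-sound i) x≢g)) (ℤₚ.*-zeroʳ (𝟙 (in? g x)))
      onTree : ∀ g → tree g ≡ true → δ g ≡ 0ℤ
      onTree g t = go (suc N) g t (ℕₚ.m≤n+m (suc N) (depth g))
      flip : tree (α h) ≡ true → δ h ≡ 0ℤ
      flip t = unflip h (onTree (α h) t)

-- Tree and cotree, Euler's relation, potentials

private
  𝟙-injective : ∀ {a b} → 𝟙 a ≡ 𝟙 b → a ≡ b
  𝟙-injective {true}  {true}  _ = refl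
  𝟙-injective {false} {false} _ = refl

  at-most-one : ∀ a b c d → (a ≡ true → b ≡ true → ⊥) → (c ≡ true → d ≡ true → ⊥) →
    (c ≡ true → (a ≡ false) × (b ≡ false)) → (d ≡ true → (a ≡ false) × (b ≡ false)) →
    𝟙 a + 𝟙 b + 𝟙 c + 𝟙 d ≤ 1ℤ
  at-most-one true  true  _     _     ab _ _ _ = ⊥-elim (ab refl refl)
  at-most-one true  false true  _     _ _ c _ = ⊥-elim (true≢false refl (proj₁ (c refl)))
  at-most-one true  false false true  _ _ _ d = ⊥-elim (true≢false refl (proj₁ (d refl)))
  at-most-one true  false false false _ _ _ _ = ℤₚ.≤-refl
  at-most-one false true  true  _     _ _ c _ = ⊥-elim (true≢false refl (proj₂ (c refl)))
  at-most-one false true  false true  _ _ _ d = ⊥-elim (true≢false refl (proj₂ (d refl)))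
  at-most-one false true  false false _ _ _ _ = ℤₚ.≤-refl
  at-most-one false false true  true  _ cd _ _ = ⊥-elim (cd refl refl)
  at-most-one false false true  false _ _ _ _ = ℤₚ.≤-refl
  at-most-one false false false true  _ _ _ _ = ℤₚ.≤-refl
  at-most-one false false false false _ _ _ _ = +≤+ z≤n

module Planar {n : ℕ} (M : PlanarMap n) where
  open PlanarMap M

  φ⁻¹ : Fin n → Fin n
  φ⁻¹ h = α (σ⁻¹ h)

  φ-inv₁ : ∀ h → φ (φ⁻¹ h) ≡ h
  φ-inv₁ h = trans (cong σ (α-invol _)) (σ-inv₁ h)

  φ-inv₂ : ∀ h → φ⁻¹ (φ h) ≡ h
  φ-inv₂ h = trans (cong α (σ-inv₂ _)) (α-invol h)

  module V = Orbits σ σ⁻¹ σ-inv₁ σ-inv₂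
  module F = Orbits φ φ⁻¹ φ-inv₁ φ-inv₂
  module VF = Forests σ σ⁻¹ σ-inv₁ σ-inv₂ α α-invol
  module FF = Forests φ φ⁻¹ φ-inv₁ φ-inv₂ α α-invol

  φα≡σ : ∀ h → φ (α h) ≡ σ h
  φα≡σ h = cong σ (α-invol h)

  α-face-σ : ∀ {h} → α h F.~ σ h
  α-face-σ {h} = F.~-trans F.~-π (F.~-reflexive (φα≡σ h))

  α-vertex-φ : ∀ {h} → α h V.~ φ h
  α-vertex-φ = V.~-π

  sum-α : ∀ f → ∑ (f ∘ α) ≡ ∑ f
  sum-α = sum-perm α α α-invol α-invol

  all-half-edges : ∀ {S : Fin n → Bool} → V.Invariant S → (∀ h → S (α h) ≡ S h) →
    ∀ {r} → S r ≡ true → ∀ h → S h ≡ true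
  all-half-edges {S} S-σ S-α {r} Sr h = go (connected r h)
    where
    go : ∀ {h} → Reach σ α r h → S h ≡ true
    go here     = Sr
    go (viaσ c) = trans (S-σ _) (go c)
    go (viaα c) = trans (S-α _) (go c)

  module _ {H Rt R : Fin n → Bool} where

    Across : Fin n → Set
    Across h = H h ≡ false

    record TreeCotree : Set where
      field
        cotree : FF.Forest Rt Across
        tree   : VF.Forest R (λ h → (FF.Forest.tree cotree h ≡ false) × (FF.Forest.tree cotree (α h) ≡ false))
      t* = FF.Forest.tree cotree
      t  = VF.Forest.tree tree
      cover : Fin n → ℤ
      cover h = 𝟙 (t* h) + 𝟙 (t* (α h)) + 𝟙 (t h) + 𝟙 (t (α h))

    module _ (Rt-φ : F.Invariant Rt) (H-α : ∀ h → H (α h) ≡ H h) (R-σ : V.Invariant R) where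

      -- The vertices joined to R off the cotree form a set whose coboundary is
      -- supported on the cotree and conserved at the faces, hence is empty.
      tree-cotree : (∀ h → FF.Connected Rt Across h) → ∃[ r ] (R r ≡ true) → ¬ ¬ TreeCotree
      tree-cotree conn (r , Rr) = do
        cot ← FF.grow Rt-φ (λ {h} e → trans (H-α h) e) conn
        let t* = FF.Forest.tree cot
            X : Fin n → Set
            X = λ h → (t* h ≡ false) × (t* (α h) ≡ false)
            X-α : ∀ {h} → X h → X (α h)
            X-α {h} = λ { (a , b) → b , trans (cong t* (α-invol h)) a }
        (S , dS) ← classify (VF.Connected R X)
        let open Decides dS
            S-~ : ∀ {g h} → g V.~ h → S g ≡ true → S h ≡ true
            S-~ = λ e s → complete (proj₁ (sound s) , VF.Conn-~ R-σ e (proj₂ (sound s)))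
            S-σ : V.Invariant S
            S-σ = λ h → ⇔⇒≡ (S-~ (V.~-sym V.~-π)) (S-~ V.~-π)
            S-cross : ∀ {h} → X h → S h ≡ true → S (α h) ≡ true
            S-cross = λ x s → complete (suc (proj₁ (sound s)) , VF.cross (proj₂ (sound s)) x V.~-refl)
            s = λ h → 𝟙 (S h)
            δ = λ h → s (α h) - s h
            δ-anti : ∀ h → δ (α h) ≡ - δ h
            δ-anti = λ h → trans (cong (λ x → s x - s (α h)) (α-invol h)) (swap (s h) (s (α h)))
            δ-conserved : ∀ h → F.osum δ h ≡ 0ℤ
            δ-conserved = λ h → trans (F.osum-minus (s ∘ α) s h) (trans (cong (_- F.osum s h)
              (trans (F.osum-cong (λ g _ → cong 𝟙 (sym (S-σ (α g))))) (F.osum-π s h))) (ℤₚ.+-inverseʳ (F.osum s h)))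
            δ-supp : ∀ h → t* h ≡ false → t* (α h) ≡ false → δ h ≡ 0ℤ
            δ-supp = λ h a b → trans (cong (λ c → 𝟙 c - s h) (⇔⇒≡
                (λ e → subst (λ x → S x ≡ true) (α-invol h) (S-cross (X-α (a , b)) e)) (S-cross (a , b))))
              (ℤₚ.+-inverseʳ (s h))
            S-α : ∀ h → S (α h) ≡ S h
            S-α = λ h → 𝟙-injective (ℤₚ.i-j≡0⇒i≡j (s (α h)) (s h)
              (FF.peel Rt-φ cot δ δ-anti (λ h _ → δ-conserved h) δ-supp h))
        tr ← VF.grow R-σ X-α (λ h → sound (all-half-edges S-σ S-α (complete (0 , VF.at Rr)) h))
        return (record { cotree = cot ; tree = tr })
        where
        swap : ∀ a b → a - b ≡ - (b - a)
        swap = solve-∀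

      module _ (T : TreeCotree) where
        open TreeCotree T

        private
          t-off : ∀ {h} → t h ≡ true → (t* h ≡ false) × (t* (α h) ≡ false)
          t-off = VF.Forest.tree-X tree

        -- The tree avoids the edges of the cotree, and each forest marks an edge at one end only.
        cover≤1 : ∀ h → cover h ≤ 1ℤ
        cover≤1 h = at-most-one (t* h) (t* (α h)) (t h) (t (α h)) (FF.Forest.tree-α cotree) (VF.Forest.tree-α tree)
          t-off (λ e → subst (λ x → t* x ≡ false) (α-invol h) (proj₂ (t-off e)) , proj₁ (t-off e))

        -- A forest has as many edges as non-root nodes, so Euler's formula expresses the number of
        -- covered half-edges through the numbers of roots.
        sum-cover : ∑ cover ≡ (+ n + + 4) - (+ 2 * F.#orb Rt + + 2 * V.#orb R)
        sum-cover = begin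
          ∑ cover
            ≡⟨ trans (sum-+ _ (λ h → 𝟙 (t (α h)))) (cong₂ _+_ (trans (sum-+ _ (λ h → 𝟙 (t h)))
                 (cong (_+ ∑ (λ h → 𝟙 (t h))) (trans (sum-+ _ _) (cong (_+_ (∑ (λ h → 𝟙 (t* h)))) (sum-α (λ h → 𝟙 (t* h)))))))
                 (sum-α (λ h → 𝟙 (t h)))) ⟩
          ∑ (λ h → 𝟙 (t* h)) + ∑ (λ h → 𝟙 (t* h)) + ∑ (λ h → 𝟙 (t h)) + ∑ (λ h → 𝟙 (t h))
            ≡⟨ cong₂ (λ a b → a + a + b + b)
                 (trans (FF.Forest.count-tree cotree Rt-φ) (F.#orb-not Rt))
                 (trans (VF.Forest.count-tree tree R-σ) (V.#orb-not R)) ⟩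
          (f# - F.#orb Rt) + (f# - F.#orb Rt) + (v# - V.#orb R) + (v# - V.#orb R)
            ≡⟨ arrange f# (F.#orb Rt) v# (V.#orb R) ⟩
          (+ 2 * v# + + 2 * f#) - (+ 2 * F.#orb Rt + + 2 * V.#orb R)
            ≡⟨ cong (_- (+ 2 * F.#orb Rt + + 2 * V.#orb R)) euler' ⟩
          (+ n + + 4) - (+ 2 * F.#orb Rt + + 2 * V.#orb R) ∎
          where
          open ≡-Reasoning
          f# = ∑ (λ r → 𝟙 (F.min? r))
          v# = ∑ (λ r → 𝟙 (V.min? r))
          arrange : ∀ f a v b → (f - a) + (f - a) + (v - b) + (v - b) ≡ (+ 2 * v + + 2 * f) - (+ 2 * a + + 2 * b)
          arrange = solve-∀
          euler' : + 2 * v# + + 2 * f# ≡ + n + + 4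
          euler' = trans (sym (cong₂ (λ a b → + 2 * a + + 2 * b) V.numOrbits≡ F.numOrbits≡))
            (trans (cong₂ _+_ (sym (ℤₚ.pos-* 2 (numOrbits σ))) (sym (ℤₚ.pos-* 2 (numOrbits φ)))) (cong +_ euler))

      -- Euler's relation for the subgraph with vertex set R and edge set H: every
      -- face of that subgraph contains a face in Rt.
      euler-inequality : (∀ h → H h ≡ true → R h ≡ true) → (∀ h → FF.Connected Rt Across h) →
        ∃[ r ] (R r ≡ true) → ∑ (λ h → 𝟙 (H h)) + + 4 ≤ + 2 * F.#orb Rt + + 2 * V.#orb R
      euler-inequality H⇒R conn r = decidable-stable (_ ℤ.≤? _) (do
        T ← tree-cotree conn r
        return (bound T))
        where
        bound : TreeCotree → ∑ (λ h → 𝟙 (H h)) + + 4 ≤ + 2 * F.#orb Rt + + 2 * V.#orb R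
        bound T = ≤-by (gap total) (trans (cong₂ _-_ (trans (sum-minus _ _) (cong (_- hs) (sum-1 n))) (sum-cover T))
            (arrange (+ n) hs (+ 2 * F.#orb Rt + + 2 * V.#orb R)))
          where
          open TreeCotree T
          hs = ∑ (λ h → 𝟙 (H h))
          arrange : ∀ m h x → (m - h) - ((m + + 4) - x) ≡ x - (h + + 4)
          arrange = solve-∀
          -- The edges of `H` stay uncovered: the cotree avoids them by its choice of edges, the
          -- tree because both of their ends are roots.
          none : ∀ h → H h ≡ true → cover h ≡ 0ℤ
          none h Hh = cong₂ _+_ (cong₂ _+_ (cong₂ _+_ (cong 𝟙 a) (cong 𝟙 b)) (cong 𝟙 c)) (cong 𝟙 d)
            where
            Hαh = trans (H-α h) Hh
            a : t* h ≡ false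
            a = ¬true⇒false (λ e → true≢false Hh (FF.Forest.tree-X cotree e))
            b : t* (α h) ≡ false
            b = ¬true⇒false (λ e → true≢false Hαh (FF.Forest.tree-X cotree e))
            c : t h ≡ false
            c = ¬true⇒false (λ e → true≢false (H⇒R h Hh) (proj₁ (VF.Forest.tree-sound tree e)))
            d : t (α h) ≡ false
            d = ¬true⇒false (λ e → true≢false (H⇒R (α h) Hαh) (proj₁ (VF.Forest.tree-sound tree e)))
          pointwise : ∀ h b → H h ≡ b → cover h ≤ 1ℤ - 𝟙 b
          pointwise h true  e = ℤₚ.≤-reflexive (none h e)
          pointwise h false e = cover≤1 T h
          total : ∑ cover ≤ ∑ (λ h → 1ℤ - 𝟙 (H h))
          total = sum-≤ (λ h → pointwise h (H h) refl)

  faces-connected : ∀ r h → FF.Connected (F.in? r) (λ _ → false ≡ false) h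
  faces-connected r h = go (connected r h)
    where
    go : ∀ {h} → Reach σ α r h → FF.Connected (F.in? r) (λ _ → false ≡ false) h
    go here     = 0 , FF.at (F.in?-true F.~-refl)
    go (viaσ c) = suc (proj₁ (go c)) , FF.cross (proj₂ (go c)) refl α-face-σ
    go (viaα c) = suc (proj₁ (go c)) , FF.cross (proj₂ (go c)) refl F.~-refl

  in?-invariant-F : ∀ r → F.Invariant (F.in? r)
  in?-invariant-F r h = F.in?-congʳ (F.~-sym F.~-π)

  in?-invariant-V : ∀ r → V.Invariant (V.in? r)
  in?-invariant-V r h = V.in?-congʳ (V.~-sym V.~-π)

  -- Integrate along the cotree; what remains lives on the tree and is peeled off.
  potential : Fin n → (δ : Fin n → ℤ) → (∀ h → δ (α h) ≡ - δ h) → (∀ h → V.osum δ h ≡ 0ℤ) →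
    ¬ ¬ (Σ (Fin n → ℤ) λ q → (∀ h → q (φ h) ≡ q h) × (∀ h → q (α h) - q h ≡ δ h))
  potential r δ δ-anti δ-conserved = do
    T ← tree-cotree {λ _ → false} {F.in? r} {V.in? r} (in?-invariant-F r) (λ _ → refl) (in?-invariant-V r)
          (faces-connected r) (r , V.in?-true V.~-refl)
    return (build T)
    where
    build : TreeCotree {λ _ → false} {F.in? r} {V.in? r} →
      Σ (Fin n → ℤ) λ q → (∀ h → q (φ h) ≡ q h) × (∀ h → q (α h) - q h ≡ δ h)
    build T = q , (λ h → q-~ (F.~-sym F.~-π)) , λ h → sym (ℤₚ.i-j≡0⇒i≡j _ _ (δ₁≡0 h))
      where
      open TreeCotree T
      open FF.Forest cotree using (depth; parent; depth-~; parent-~; tree-sound; tree-depth)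
      -- With a single root face and a single root vertex the bound `cover ≤ 1` is attained in
      -- total, hence everywhere: each edge lies in the tree or in the cotree.
      full : ∀ h → cover h ≡ 1ℤ
      full h = sym (ℤₚ.i-j≡0⇒i≡j 1ℤ (cover h) (sum≡0⇒term≡0 (λ h → gap (cover≤1 (in?-invariant-F r) (λ _ → refl) (in?-invariant-V r) T h)) total h))
        where
        arrange : ∀ m → m - ((m + + 4) - (+ 2 * 1ℤ + + 2 * 1ℤ)) ≡ 0ℤ
        arrange = solve-∀
        total : ∑ (λ h → 1ℤ - cover h) ≡ 0ℤ
        total = trans (sum-minus _ _) (trans (cong₂ _-_ (sum-1 n)
          (trans (sum-cover (in?-invariant-F r) (λ _ → refl) (in?-invariant-V r) T)
            (cong₂ (λ a b → (+ n + + 4) - (+ 2 * a + + 2 * b)) (F.#orb-in? r) (V.#orb-in? r)))) (arrange (+ n)))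
      -- The first argument is fuel for the descent to the root face; by `qf-stable` every amount
      -- above the depth gives the same value.
      qf : ℕ → Fin n → ℤ
      qf zero    h = 0ℤ
      qf (suc k) h = if F.in? r h then 0ℤ else qf k (α (parent h)) - δ (parent h)
      qf-~ : ∀ k {g h} → g F.~ h → qf k g ≡ qf k h
      qf-~ zero    e = refl
      qf-~ (suc k) e = cong₂ (λ b p → if b then 0ℤ else qf k (α p) - δ p) (F.in?-congʳ e) (parent-~ e)
      qf-stable : ∀ k k' h → depth h ℕ.< k → depth h ℕ.< k' → qf k h ≡ qf k' h
      qf-stable (suc k) (suc k') h (s≤s lt) (s≤s lt') = cases (bool (F.in? r h))
        where
        cases : (F.in? r h ≡ true) ⊎ (F.in? r h ≡ false) → qf (suc k) h ≡ qf (suc k') h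
        cases (inj₁ e) = trans (cong (if_then 0ℤ else (qf k (α (parent h)) - δ (parent h))) e)
          (sym (cong (if_then 0ℤ else (qf k' (α (parent h)) - δ (parent h))) e))
        cases (inj₂ e) = cong (λ x → if F.in? r h then 0ℤ else x - δ (parent h))
          (qf-stable k k' (α (parent h)) (ℕₚ.<-≤-trans (FF.Forest.parent-depth cotree e) lt)
            (ℕₚ.<-≤-trans (FF.Forest.parent-depth cotree e) lt'))
      q : Fin n → ℤ
      q h = qf (suc (depth h)) h
      q-~ : ∀ {g h} → g F.~ h → q g ≡ q h
      q-~ {g} {h} e = trans (cong (λ d → qf (suc d) g) (depth-~ e)) (qf-~ (suc (depth h)) e)
      onTree : ∀ h → t* h ≡ true → δ h - (q (α h) - q h) ≡ 0ℤ
      onTree h e = trans (cong (λ x → δ h - (q (α h) - x)) q≡) (arrange (δ h) (q (α h)))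
        where
        arrange : ∀ d a → d - (a - (a - d)) ≡ 0ℤ
        arrange = solve-∀
        q≡ : q h ≡ q (α h) - δ h
        q≡ = trans (cong (if_then 0ℤ else (qf (depth h) (α (parent h)) - δ (parent h))) (proj₁ (tree-sound e)))
          (trans (cong (λ x → qf (depth h) (α x) - δ x) (proj₂ (tree-sound e)))
            (cong (_- δ h) (qf-stable (depth h) (suc (depth (α h))) (α h) (tree-depth e) ℕₚ.≤-refl)))
      δ₁ : Fin n → ℤ
      δ₁ h = δ h - (q (α h) - q h)
      δ₁-anti : ∀ h → δ₁ (α h) ≡ - δ₁ h
      δ₁-anti h = trans (cong₂ (λ d x → d - (q x - q (α h))) (δ-anti h) (α-invol h)) (arrange (δ h) (q h) (q (α h)))
        where
        arrange : ∀ d a b → (- d) - (a - b) ≡ - (d - (b - a))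
        arrange = solve-∀
      -- The coboundary of a face function is conserved at a vertex: `α g` and `σ g` lie in one
      -- face, so its sum telescopes under `σ`.
      δ₁-conserved : ∀ h → V.osum δ₁ h ≡ 0ℤ
      δ₁-conserved h = trans (V.osum-minus δ (λ g → q (α g) - q g) h) (trans (cong₂ _-_ (δ-conserved h)
        (trans (V.osum-minus (q ∘ α) q h) (trans (cong (_- V.osum q h)
          (trans (V.osum-cong (λ g _ → q-~ α-face-σ)) (V.osum-π q h))) (ℤₚ.+-inverseʳ (V.osum q h))))) refl)
      δ₁-supp : ∀ h → t h ≡ false → t (α h) ≡ false → δ₁ h ≡ 0ℤ
      δ₁-supp h a b = cases (bool (t* h)) (bool (t* (α h)))
        where
        cases : (t* h ≡ true) ⊎ (t* h ≡ false) → (t* (α h) ≡ true) ⊎ (t* (α h) ≡ false) → δ₁ h ≡ 0ℤ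
        cases (inj₁ e) _ = onTree h e
        cases _ (inj₁ e) = ℤₚ.neg-injective (trans (sym (δ₁-anti h)) (onTree (α h) e))
        cases (inj₂ e) (inj₂ e') = ⊥-elim (absurd (trans (sym (full h))
          (cong₂ _+_ (cong₂ _+_ (cong₂ _+_ (cong 𝟙 e) (cong 𝟙 e')) (cong 𝟙 a)) (cong 𝟙 b))))
          where
          absurd : 1ℤ ≡ 0ℤ → ⊥
          absurd ()
      δ₁≡0 : ∀ h → δ₁ h ≡ 0ℤ
      δ₁≡0 = VF.peel (in?-invariant-V r) tree δ₁ δ₁-anti (λ h _ → δ₁-conserved h) δ₁-supp

  -- The same for the map obtained by adding a vertex in each face: ω lives on the
  -- edges, ζ on the new edges, and h stands for the triangle on the right of h.
  star-potential : Fin n → (ω ζ : Fin n → ℤ) → (∀ h → ω (α h) ≡ - ω h) → (∀ h → F.osum ζ h ≡ 0ℤ) →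
    (∀ h → V.osum (λ g → ω g + ζ (α g)) h ≡ 0ℤ) →
    ¬ ¬ (Σ (Fin n → ℤ) λ p → (∀ h → p (φ h) - p h ≡ ζ h) × (∀ h → p (α h) - p h ≡ ω h))
  star-potential r ω ζ ω-anti ζ-conserved vertex = do
    (q , q-φ , q-α) ← potential r δ δ-anti δ-conserved
    return ((λ h → p₀ h + q h) ,
      (λ h → trans (cong (λ x → (p₀ (φ h) + x) - (p₀ h + q h)) (q-φ h)) (trans (drop (p₀ (φ h)) (p₀ h) (q h)) (p₀-φ h))) ,
      (λ h → trans (regroup (p₀ (α h)) (q (α h)) (p₀ h) (q h)) (trans (cong (_+_ (p₀ (α h) - p₀ h)) (q-α h)) (back (p₀ (α h) - p₀ h) (ω h)))))
    where
    p₀ = proj₁ (F.integrate ζ ζ-conserved)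
    p₀-φ = proj₂ (F.integrate ζ ζ-conserved)
    drop : ∀ a b q → (a + q) - (b + q) ≡ a - b
    drop = solve-∀
    regroup : ∀ a x b y → (a + x) - (b + y) ≡ (a - b) + (x - y)
    regroup = solve-∀
    back : ∀ d w → d + (w - d) ≡ w
    back = solve-∀
    -- Integrating `ζ` leaves a constant on each face undetermined. These constants form the face
    -- potential that repairs the defect `δ` across the old edges.
    δ : Fin n → ℤ
    δ h = ω h - (p₀ (α h) - p₀ h)
    δ-anti : ∀ h → δ (α h) ≡ - δ h
    δ-anti h = trans (cong₂ (λ d x → d - (p₀ x - p₀ (α h))) (ω-anti h) (α-invol h)) (arrange (ω h) (p₀ h) (p₀ (α h)))
      where
      arrange : ∀ d a b → (- d) - (a - b) ≡ - (d - (b - a))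
      arrange = solve-∀
    δ≡ : ∀ h → δ h ≡ (ω h + ζ (α h)) - (p₀ (σ h) - p₀ h)
    δ≡ h = trans (arrange (ω h) (p₀ (α h)) (p₀ h) (p₀ (φ (α h))))
      (cong₂ (λ z x → (ω h + z) - (p₀ x - p₀ h)) (p₀-φ (α h)) (φα≡σ h))
      where
      arrange : ∀ w a b c → w - (a - b) ≡ (w + (c - a)) - (c - b)
      arrange = solve-∀
    δ-conserved : ∀ h → V.osum δ h ≡ 0ℤ
    δ-conserved h = trans (V.osum-cong (λ g _ → δ≡ g)) (trans (V.osum-minus _ _ h) (trans (cong₂ _-_ (vertex h)
      (trans (V.osum-minus (p₀ ∘ σ) p₀ h) (trans (cong (_- V.osum p₀ h) (V.osum-π p₀ h)) (ℤₚ.+-inverseʳ (V.osum p₀ h))))) refl))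

-- Cyclic indices

toℕ-mod : ∀ t m → toℕ (t DM.mod suc m) ≡ t DM.% suc m
toℕ-mod t m = Finₚ.toℕ-fromℕ< (DM.m%n<n t (suc m))

private
  %-absorb : ∀ t s m → (t DM.% suc m ℕ.+ s) DM.% suc m ≡ (t ℕ.+ s) DM.% suc m
  %-absorb t s m = sym (trans (cong (DM._% suc m) split) (DM.[m+kn]%n≡m%n (r ℕ.+ s) (t DM./ suc m) (suc m)))
    where
    r = t DM.% suc m
    split : t ℕ.+ s ≡ (r ℕ.+ s) ℕ.+ (t DM./ suc m) ℕ.* suc m
    split = trans (cong (ℕ._+ s) (DM.m≡m%n+[m/n]*n t (suc m)))
      (trans (ℕₚ.+-assoc r _ s) (trans (cong (r ℕ.+_) (ℕₚ.+-comm _ s)) (sym (ℕₚ.+-assoc r s _))))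

next-mod : ∀ t m → next (t DM.mod suc m) ≡ suc t DM.mod suc m
next-mod t m = Finₚ.toℕ-injective (trans (toℕ-mod (suc (toℕ (t DM.mod suc m))) m) (trans (cong (λ x → suc x DM.% suc m) (toℕ-mod t m))
  (trans (cong (DM._% suc m) (ℕₚ.+-comm 1 (t DM.% suc m))) (trans (%-absorb t 1 m)
    (trans (cong (DM._% suc m) (ℕₚ.+-comm t 1)) (sym (toℕ-mod (suc t) m)))))))

mod-toℕ : ∀ {m} (i : Fin (suc m)) → toℕ i DM.mod suc m ≡ i
mod-toℕ {m} i = Finₚ.toℕ-injective (trans (toℕ-mod (toℕ i) m) (DM.m<n⇒m%n≡m (Finₚ.toℕ<n i)))

prev : ∀ {k} → Fin k → Fin k
prev {suc m} i = (toℕ i ℕ.+ m) DM.mod suc m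

next-prev : ∀ {k} (i : Fin k) → next (prev i) ≡ i
next-prev {suc m} i = trans (next-mod (toℕ i ℕ.+ m) m) (Finₚ.toℕ-injective (trans (toℕ-mod (suc (toℕ i ℕ.+ m)) m)
  (trans (cong (DM._% suc m) (sym (ℕₚ.+-suc (toℕ i) m))) (trans (DM.[m+n]%n≡m%n (toℕ i) (suc m)) (DM.m<n⇒m%n≡m (Finₚ.toℕ<n i))))))

prev-next : ∀ {k} (i : Fin k) → prev (next i) ≡ i
prev-next {suc m} i = Finₚ.toℕ-injective (trans (toℕ-mod (toℕ (next i) ℕ.+ m) m) (trans (cong (λ x → (x ℕ.+ m) DM.% suc m) (toℕ-mod (suc (toℕ i)) m))
  (trans (%-absorb (suc (toℕ i)) m m) (trans (cong (DM._% suc m) (sym (ℕₚ.+-suc (toℕ i) m)))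
    (trans (DM.[m+n]%n≡m%n (toℕ i) (suc m)) (DM.m<n⇒m%n≡m (Finₚ.toℕ<n i)))))))

next-< : ∀ {m} (i : Fin (suc m)) → toℕ i ℕ.< m → toℕ (next i) ≡ suc (toℕ i)
next-< {m} i i<m = trans (toℕ-mod (suc (toℕ i)) m) (DM.m<n⇒m%n≡m (s≤s i<m))

next-last : ∀ {m} (i : Fin (suc m)) → toℕ i ≡ m → toℕ (next i) ≡ 0
next-last {m} i i≡m = trans (toℕ-mod (suc (toℕ i)) m) (trans (cong (λ x → suc x DM.% suc m) i≡m) (DM.n%n≡0 (suc m)))

prev-induction : ∀ {k} (P : Fin k → Set) → (∀ i → P (next i) → P i) → ∀ i → P i → ∀ j → P j
prev-induction {suc m} P back i Pi j = subst P (mod-toℕ j) (down (toℕ i) (toℕ j) (subst P (sym (mod-toℕ i)) Pi))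
  where
  lower : ∀ d t → P ((d ℕ.+ t) DM.mod suc m) → P (t DM.mod suc m)
  lower zero    t p = p
  lower (suc d) t p = lower d t (back _ (subst P (sym (next-mod (d ℕ.+ t) m)) p))
  down : ∀ s t → P (s DM.mod suc m) → P (t DM.mod suc m)
  -- Stepping down from `s` to `t` may have to pass zero. The `t * m` additional steps replace the
  -- start by `s + t * suc m`, which is the same index.
  down s t p = lower (s ℕ.+ t ℕ.* m) t (subst P (Finₚ.toℕ-injective
      (trans (toℕ-mod s m) (trans (sym (trans (cong (DM._% suc m) (wrap s t)) (DM.[m+kn]%n≡m%n s t (suc m)))) (sym (toℕ-mod (s ℕ.+ t ℕ.* m ℕ.+ t) m))))) p)
    where
    wrap : ∀ s t → s ℕ.+ t ℕ.* m ℕ.+ t ≡ s ℕ.+ t ℕ.* suc m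
    wrap s t = trans (ℕₚ.+-assoc s _ t) (cong (s ℕ.+_) (trans (ℕₚ.+-comm _ t) (sym (ℕₚ.*-suc t m))))

-- Simple cycles of a planar map

module Cycles {n : ℕ} (M : PlanarMap n) where
  open PlanarMap M
  open Planar M

  module _ {k : ℕ} {c : Fin k → Fin n} (cyc : IsCycle k c) where
    open IsCycle cyc

    OffCycle : Fin n → Set
    OffCycle g = ∀ i → (g ≢ c i) × (g ≢ α (c i))

    -- Vertices are not repeated on the cycle, so a turn about one of them meets a single departing
    -- and a single arriving half-edge. This controls every rotation argument along a cycle.
    at-vertex : ∀ i {g} → g V.~ c (next i) → (∀ j → g ≡ c j → g ≡ c (next i)) × (∀ j → g ≡ α (c j) → g ≡ α (c i))
    at-vertex i g~ =
      (λ j e → trans e (cong c (vDistinct j (next i) (V.~-trans (V.~-reflexive (sym e)) g~)))) ,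
      (λ j e → trans e (cong (λ x → α (c x)) (trans (sym (prev-next j)) (trans (cong prev
        (vDistinct (next j) (next i) (V.~-trans (V.~-sym (closed j)) (V.~-trans (V.~-reflexive (sym e)) g~)))) (prev-next i)))))

    -- The Jordan curve theorem, as the potential of the unit flow along the cycle.
    jordan : Fin n → ¬ ¬ (Σ (Fin n → ℤ) λ q → (∀ h → q (φ h) ≡ q h) ×
      (∀ g → OffCycle g → q (α g) ≡ q g) × (∀ i → q (α (c i)) ≡ q (c i) + 1ℤ))
    jordan r = do
      (q , q-φ , q-α) ← potential r δ δ-anti δ-conserved
      return (q , q-φ , (λ g off → ℤₚ.i-j≡0⇒i≡j _ _ (trans (q-α g) (δ-off g off))) ,
        λ i → trans (back (q (α (c i))) (q (c i))) (cong (_+_ (q (c i))) (trans (q-α (c i)) (δ-on i))))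
      where
      back : ∀ a b → a ≡ b + (a - b)
      back = solve-∀
      -- Counted with a sign for the direction, so that conservation at a vertex is the cancellation
      -- of the departure along `c (next i)` with the arrival along `c i`.
      δ : Fin n → ℤ
      δ g = ∑ (λ i → 𝟙 (g ≡ᵇ c i) - 𝟙 (α g ≡ᵇ c i))
      δ-anti : ∀ g → δ (α g) ≡ - δ g
      δ-anti g = trans (sum-cong (λ i → trans (cong (λ x → 𝟙 (α g ≡ᵇ c i) - 𝟙 (x ≡ᵇ c i)) (α-invol g))
        (swap (𝟙 (α g ≡ᵇ c i)) (𝟙 (g ≡ᵇ c i))))) (sum-neg _)
        where
        swap : ∀ a b → a - b ≡ - (b - a)
        swap = solve-∀
      δ-off : ∀ g → OffCycle g → δ g ≡ 0ℤ
      δ-off g off = sum-zero (λ i → cong₂ (λ a b → 𝟙 a - 𝟙 b) (≡ᵇ-false (proj₁ (off i)))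
        (≡ᵇ-false (λ e → proj₂ (off i) (trans (sym (α-invol g)) (cong α e)))))
      δ-on : ∀ i → δ (c i) ≡ 1ℤ
      δ-on i = trans (sum-single i (λ j j≢i → cong₂ (λ a b → 𝟙 a - 𝟙 b)
            (≡ᵇ-false (λ e → proj₁ (eDistinct i j (λ e' → j≢i (sym e'))) (sym e)))
            (≡ᵇ-false (λ e → proj₂ (eDistinct i j (λ e' → j≢i (sym e'))) (sym e)))))
          (cong₂ (λ a b → 𝟙 a - 𝟙 b) (≡ᵇ-refl (c i)) (≡ᵇ-false (α-nofix (c i))))
      α-≡ᵇ : ∀ g x → (α g ≡ᵇ x) ≡ (g ≡ᵇ α x)
      α-≡ᵇ g x = ⇔⇒≡ (λ e → ⌊⌋-true (_ Finₚ.≟ _) (trans (sym (α-invol g)) (cong α (≡ᵇ-sound e))))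
        (λ e → ⌊⌋-true (_ Finₚ.≟ _) (trans (cong α (≡ᵇ-sound e)) (α-invol x)))
      pick : ∀ h x → ∑ (λ g → 𝟙 (V.in? h g) * 𝟙 (g ≡ᵇ x)) ≡ 𝟙 (V.in? h x)
      pick h x = trans (sum-cong (λ g → ℤₚ.*-comm (𝟙 (V.in? h g)) _)) (sum-pick (λ g → 𝟙 (V.in? h g)) x)
      column : ∀ h i → ∑ (λ g → 𝟙 (V.in? h g) * (𝟙 (g ≡ᵇ c i) - 𝟙 (α g ≡ᵇ c i))) ≡ 𝟙 (V.in? h (c i)) - 𝟙 (V.in? h (c (next i)))
      column h i = trans (sum-cong (λ g → trans (distrib (𝟙 (V.in? h g)) _ _)
          (cong (λ b → 𝟙 (V.in? h g) * 𝟙 (g ≡ᵇ c i) - 𝟙 (V.in? h g) * 𝟙 b) (α-≡ᵇ g (c i)))))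
        (trans (sum-minus _ _) (cong₂ _-_ (pick h (c i)) (trans (pick h (α (c i))) (cong 𝟙 (V.in?-congʳ (closed i))))))
        where
        distrib : ∀ a b c → a * (b - c) ≡ a * b - a * c
        distrib = solve-∀
      δ-conserved : ∀ h → V.osum δ h ≡ 0ℤ
      δ-conserved h = trans (sum-cong (λ g → sym (sum-* (𝟙 (V.in? h g)) _))) (trans (sum-swap _)
        (trans (sum-cong (column h)) (trans (sum-minus (λ i → 𝟙 (V.in? h (c i))) (λ i → 𝟙 (V.in? h (c (next i)))))
          (trans (cong (_-_ (∑ (λ i → 𝟙 (V.in? h (c i))))) (sum-perm next prev next-prev prev-next (λ i → 𝟙 (V.in? h (c i)))))
          (ℤₚ.+-inverseʳ (∑ (λ i → 𝟙 (V.in? h (c i)))))))))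

  mkCycle : ∀ m (x : ℕ → Fin n) → (∀ t → t ℕ.< m → α (x t) V.~ x (suc t)) → α (x m) V.~ x 0 →
    (∀ i j → i ℕ.≤ m → j ℕ.≤ m → x i V.~ x j → i ≡ j) →
    (∀ i j → i ℕ.≤ m → j ℕ.≤ m → i ≢ j → x j ≢ α (x i)) → IsCycle (suc m) (λ i → x (toℕ i))
  mkCycle m x steps close distinct noback = record
    { nonempty = s≤s z≤n
    ; closed = closed
    ; vDistinct = λ i j e → Finₚ.toℕ-injective (distinct _ _ (bound i) (bound j) e)
    ; eDistinct = λ i j i≢j → (λ e → i≢j (Finₚ.toℕ-injective (distinct _ _ (bound i) (bound j) (V.~-reflexive (sym e))))) ,
        noback _ _ (bound i) (bound j) (λ e → i≢j (Finₚ.toℕ-injective e))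
    }
    where
    bound : ∀ (i : Fin (suc m)) → toℕ i ℕ.≤ m
    bound i = ℕ.s≤s⁻¹ (Finₚ.toℕ<n i)
    closed : ∀ i → α (x (toℕ i)) V.~ x (toℕ (next i))
    closed i with toℕ i ℕₚ.≟ m
    ... | yes e = subst (λ t → α (x (toℕ i)) V.~ x t) (sym (next-last i e)) (subst (λ t → α (x t) V.~ x 0) (sym e) close)
    ... | no ≢m = subst (λ t → α (x (toℕ i)) V.~ x t) (sym (next-< i lt)) (steps (toℕ i) lt)
      where lt = ℕₚ.≤∧≢⇒< (bound i) ≢m

  -- Walking along the boundary of a set of faces, always with the set on the
  -- right, until a vertex is visited twice.
  boundary-cycle : ∀ {A : Fin n → Bool} → F.Invariant A → ∀ {h} → A h ≡ true → A (α h) ≡ false →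
    ∃[ k ] Σ (Fin k → Fin n) λ c → IsCycle k c × (∀ i → (A (c i) ≡ true) × (A (α (c i)) ≡ false))
  boundary-cycle {A} A-φ {h} Ah Aαh = suc m , (λ i → x (i₀ ℕ.+ toℕ i)) ,
    mkCycle m (λ t → x (i₀ ℕ.+ t)) steps close distinct noback , λ i → x-bd (i₀ ℕ.+ toℕ i)
    where
    Bd : Fin n → Set
    Bd g = (A g ≡ true) × (A (α g) ≡ false)
    A-σ : ∀ g → A (σ g) ≡ A (α g)
    A-σ g = sym (F.~-invariant A-φ α-face-σ)
    -- A turn about a vertex that starts in `A` and ends outside must cross an edge with `A` on its
    -- right and the complement on its left.
    rotate : ∀ k g {e} → A g ≡ true → A e ≡ false → iter σ k g ≡ e → Σ (Fin n) λ g' → Bd g' × g V.~ g'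
    rotate zero g Ag Ae refl = ⊥-elim (true≢false Ag Ae)
    rotate (suc k) g Ag Ae e = case bool (A (α g)) of λ
      { (inj₂ f) → g , (Ag , f) , V.~-refl
      ; (inj₁ t) → case rotate k (σ g) (trans (A-σ g) t) Ae
            (trans (sym (V.iter-+ k 1 g)) (trans (cong (λ j → iter σ j g) (ℕₚ.+-comm k 1)) e)) of λ
          { (g' , bd , σg~g') → g' , bd , V.~-trans V.~-π σg~g' } }
    succ : Σ (Fin n) Bd → Σ (Fin n) Bd
    succ (g , Ag , Aαg) = case V.~-sym (α-vertex-φ {g}) of λ
      { (k , e) → case rotate k (φ g) (trans (A-φ g) Ag) Aαg e of λ { (g' , bd , _) → g' , bd } }
    succ-~ : ∀ g → α (proj₁ g) V.~ proj₁ (succ g)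
    succ-~ (g , Ag , Aαg) = V.~-trans α-vertex-φ (proj₂ (proj₂ (rotate (proj₁ (V.~-sym (α-vertex-φ {g}))) (φ g)
      (trans (A-φ g) Ag) Aαg (proj₂ (V.~-sym (α-vertex-φ {g}))))))
    y : ℕ → Σ (Fin n) Bd
    y zero    = h , Ah , Aαh
    y (suc t) = succ (y t)
    x : ℕ → Fin n
    x t = proj₁ (y t)
    x-bd : ∀ t → Bd (x t)
    x-bd t = proj₂ (y t)
    Repeats : ℕ → Set
    Repeats j = Σ (Fin j) λ i → x (toℕ i) V.~ x j
    repeats : ∃ Repeats
    repeats = case Finₚ.pigeonhole (ℕₚ.n<1+n n) (λ i → V.rep (x (toℕ i))) of λ
      { (i , j , i<j , e) → toℕ j , Fin.fromℕ< i<j ,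
          subst (λ t → x t V.~ x (toℕ j)) (sym (Finₚ.toℕ-fromℕ< i<j))
            (V.~-trans V.~-rep (V.~-trans (V.~-reflexive e) (V.~-sym V.~-rep))) }
    first : ∃[ j ] (Repeats j × (∀ i → i ℕ.< j → ¬ Repeats i))
    first = least Repeats (λ j → Finₚ.any? (λ i → x (toℕ i) V.~? x j)) repeats
    j₀ i₀ m : ℕ
    j₀ = proj₁ first
    i₀ = toℕ (proj₁ (proj₁ (proj₂ first)))
    m  = j₀ ℕ.∸ suc i₀
    split : suc (i₀ ℕ.+ m) ≡ j₀
    split = ℕₚ.m+[n∸m]≡n (Finₚ.toℕ<n (proj₁ (proj₁ (proj₂ first))))
    steps : ∀ t → t ℕ.< m → α (x (i₀ ℕ.+ t)) V.~ x (i₀ ℕ.+ suc t)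
    steps t _ = V.~-trans (succ-~ (y (i₀ ℕ.+ t))) (V.~-reflexive (cong x (sym (ℕₚ.+-suc i₀ t))))
    close : α (x (i₀ ℕ.+ m)) V.~ x (i₀ ℕ.+ 0)
    close = V.~-trans (succ-~ (y (i₀ ℕ.+ m))) (V.~-trans (V.~-reflexive (cong x split))
      (V.~-trans (V.~-sym (proj₂ (proj₁ (proj₂ first)))) (V.~-reflexive (cong x (sym (ℕₚ.+-identityʳ i₀))))))
    distinct< : ∀ i j → i ℕ.< j → j ℕ.≤ m → ¬ x (i₀ ℕ.+ i) V.~ x (i₀ ℕ.+ j)
    distinct< i j i<j j≤m e = proj₂ (proj₂ first) (i₀ ℕ.+ j) (ℕₚ.≤-trans (s≤s (ℕₚ.+-monoʳ-≤ i₀ j≤m)) (ℕₚ.≤-reflexive split))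
      (Fin.fromℕ< lt , subst (λ t → x t V.~ x (i₀ ℕ.+ j)) (sym (Finₚ.toℕ-fromℕ< lt)) e)
      where lt = ℕₚ.+-monoʳ-< i₀ i<j
    distinct : ∀ i j → i ℕ.≤ m → j ℕ.≤ m → x (i₀ ℕ.+ i) V.~ x (i₀ ℕ.+ j) → i ≡ j
    distinct i j i≤ j≤ e with ℕₚ.<-cmp i j
    ... | tri< lt _ _ = ⊥-elim (distinct< i j lt j≤ e)
    ... | tri≈ _ eq _ = eq
    ... | tri> _ _ gt = ⊥-elim (distinct< j i gt i≤ (V.~-sym e))
    noback : ∀ i j → i ℕ.≤ m → j ℕ.≤ m → i ≢ j → x (i₀ ℕ.+ j) ≢ α (x (i₀ ℕ.+ i))
    noback i j _ _ _ e = true≢false (proj₁ (x-bd (i₀ ℕ.+ j))) (trans (cong A e) (proj₂ (x-bd (i₀ ℕ.+ i))))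

  module _ (Stp : Fin n → Set) where

    data To (h : Fin n) : ℕ → Fin n → Set where
      there : ∀ {g} → g V.~ h → To h 0 g
      step  : ∀ {ℓ g g'} → g V.~ g' → Stp g' → To h ℓ (α g') → To h (suc ℓ) g

    To-~ : ∀ {h ℓ g g'} → g V.~ g' → To h ℓ g' → To h ℓ g
    To-~ e (there e')    = there (V.~-trans e e')
    To-~ e (step e' s t) = step (V.~-trans e e') s t

    -- Along a shortest walk back to h the distance to h decreases, so no vertex is repeated.
    circuit : ∀ {h} → Stp h → ¬ Stp (α h) → ∃[ ℓ ] To h ℓ (α h) →
      ¬ ¬ (∃[ m ] Σ (Fin (suc m) → Fin n) λ c → IsCycle (suc m) c × (c Fin.zero ≡ h) × (∀ i → Stp (c i)))
    circuit {h} sh ¬sαh walk = do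
      (ℓ , w) ← ¬¬-least (λ ℓ → To h ℓ (α h)) walk
      return (ℓ , build ℓ w)
      where
      Least : ℕ → Fin n → Set
      Least ℓ g = To h ℓ g × (∀ j → j ℕ.< ℓ → ¬ To h j g)
      Least-unique : ∀ {ℓ ℓ' g g'} → g V.~ g' → Least ℓ g → Least ℓ' g' → ℓ ≡ ℓ'
      Least-unique {ℓ} {ℓ'} e (t , l) (t' , l') with ℕₚ.<-cmp ℓ ℓ'
      ... | tri< lt _ _ = ⊥-elim (l' ℓ lt (To-~ (V.~-sym e) t))
      ... | tri≈ _ eq _ = eq
      ... | tri> _ _ gt = ⊥-elim (l ℓ' gt (To-~ e t'))
      seq : ∀ {ℓ g} → To h ℓ g → ℕ → Fin n
      seq (there _)            t       = h
      seq (step {g' = g'} _ _ w) zero    = g'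
      seq (step _ _ w)         (suc t) = seq w t
      seq-start : ∀ {ℓ g} (w : To h ℓ g) → g V.~ seq w 0
      seq-start (there e)    = e
      seq-start (step e _ _) = e
      seq-stp : ∀ {ℓ g} (w : To h ℓ g) t → Stp (seq w t)
      seq-stp (there _)    t       = sh
      seq-stp (step _ s _) zero    = s
      seq-stp (step _ _ w) (suc t) = seq-stp w t
      seq-step : ∀ {ℓ g} (w : To h ℓ g) t → t ℕ.< ℓ → α (seq w t) V.~ seq w (suc t)
      seq-step (step _ _ w) zero    _        = seq-start w
      seq-step (step _ _ w) (suc t) (s≤s lt) = seq-step w t lt
      seq-end : ∀ {ℓ g} (w : To h ℓ g) → seq w ℓ ≡ h
      seq-end (there _)    = refl
      seq-end (step _ _ w) = seq-end w
      seq-least : ∀ {ℓ g} (w : To h ℓ g) → (∀ j → j ℕ.< ℓ → ¬ To h j g) → ∀ t → t ℕ.≤ ℓ → Least (ℓ ℕ.∸ t) (seq w t)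
      seq-least (there e) l zero _ = there V.~-refl , λ j ()
      seq-least (step e s w) l zero _ = step V.~-refl s w , λ j lt t → l j lt (To-~ e t)
      seq-least (step e s w) l (suc t) (s≤s le) = seq-least w (λ j lt t → l (suc j) (s≤s lt) (step e s t)) t le
      build : ∀ ℓ → Least ℓ (α h) → Σ (Fin (suc ℓ) → Fin n) λ c → IsCycle (suc ℓ) c × (c Fin.zero ≡ h) × (∀ i → Stp (c i))
      build ℓ (w , l) = (λ i → x (toℕ i)) , mkCycle ℓ x steps close distinct noback , refl , λ i → x-stp (toℕ i)
        where
        x : ℕ → Fin n
        x zero    = h
        x (suc t) = seq w t
        x-stp : ∀ t → Stp (x t)
        x-stp zero    = sh
        x-stp (suc t) = seq-stp w t
        steps : ∀ t → t ℕ.< ℓ → α (x t) V.~ x (suc t)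
        steps zero    _  = seq-start w
        steps (suc t) lt = seq-step w t (ℕₚ.<⇒≤ lt)
        close : α (x ℓ) V.~ x 0
        close = go ℓ refl
          where
          go : ∀ t → t ≡ ℓ → α (x t) V.~ h
          go zero    e = V.~-trans (seq-start w) (V.~-reflexive (trans (cong (seq w) e) (seq-end w)))
          go (suc t) e = V.~-trans (seq-step w t (ℕₚ.≤-reflexive e)) (V.~-reflexive (trans (cong (seq w) e) (seq-end w)))
        level : ℕ → ℕ
        level zero    = 0
        level (suc t) = ℓ ℕ.∸ t
        x-least : ∀ t → t ℕ.≤ ℓ → Least (level t) (x t)
        x-least zero    _  = there V.~-refl , λ j ()
        x-least (suc t) le = seq-least w l t (ℕₚ.<⇒≤ le)
        level-injective : ∀ i j → i ℕ.≤ ℓ → j ℕ.≤ ℓ → level i ≡ level j → i ≡ j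
        level-injective zero    zero    _ _ _ = refl
        level-injective zero    (suc j) _ j< e = ⊥-elim (ℕₚ.<⇒≢ (ℕₚ.m<n⇒0<n∸m j<) e)
        level-injective (suc i) zero    i< _ e = ⊥-elim (ℕₚ.<⇒≢ (ℕₚ.m<n⇒0<n∸m i<) (sym e))
        level-injective (suc i) (suc j) i< j< e = cong suc (ℕₚ.∸-cancelˡ-≡ (ℕₚ.<⇒≤ i<) (ℕₚ.<⇒≤ j<) e)
        distinct : ∀ i j → i ℕ.≤ ℓ → j ℕ.≤ ℓ → x i V.~ x j → i ≡ j
        distinct i j i≤ j≤ e = level-injective i j i≤ j≤ (Least-unique e (x-least i i≤) (x-least j j≤))
        follows : ∀ i j → i ℕ.≤ ℓ → j ℕ.≤ ℓ → x j ≡ α (x i) → (j ≡ suc i) ⊎ ((i ≡ ℓ) × (j ≡ 0))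
        follows i j i≤ j≤ e with i ℕₚ.≟ ℓ
        ... | yes i≡ℓ = inj₂ (i≡ℓ , distinct j 0 j≤ z≤n (V.~-trans (V.~-reflexive e) (subst (λ t → α (x t) V.~ x 0) (sym i≡ℓ) close)))
        ... | no i≢ℓ = inj₁ (distinct j (suc i) j≤ lt (V.~-trans (V.~-reflexive e) (steps i lt)))
          where lt = ℕₚ.≤∧≢⇒< i≤ i≢ℓ
        -- A closed walk of length two could run back along its own edge. This is the only
        -- degenerate case left by `follows`, and it is excluded because the edge of `h` admits
        -- steps in one direction only.
        x1≢ : x 1 ≢ α h
        x1≢ e = ¬sαh (subst Stp e (x-stp 1))
        noback : ∀ i j → i ℕ.≤ ℓ → j ℕ.≤ ℓ → i ≢ j → x j ≢ α (x i)
        noback i j i≤ j≤ i≢j e = cases (follows i j i≤ j≤ e) (follows j i j≤ i≤ e')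
          where
          e' : x i ≡ α (x j)
          e' = trans (sym (α-invol (x i))) (cong α (sym e))
          cases : (j ≡ suc i) ⊎ ((i ≡ ℓ) × (j ≡ 0)) → (i ≡ suc j) ⊎ ((j ≡ ℓ) × (i ≡ 0)) → ⊥
          cases (inj₁ refl) (inj₁ q) = ℕₚ.<-irrefl q (ℕₚ.m<n⇒m<1+n ℕₚ.≤-refl)
          cases (inj₁ refl) (inj₂ (_ , refl)) = x1≢ e
          cases (inj₂ (_ , refl)) (inj₁ refl) = x1≢ e'
          cases (inj₂ (_ , refl)) (inj₂ (_ , refl)) = i≢j refl

-- Fractional orientations with prescribed loads

private
  ℤpos : ℤ → ℤ
  ℤpos (+ k)    = + k
  ℤpos -[1+ k ] = 0ℤ

  0≤ℤpos : ∀ a → 0ℤ ≤ ℤpos a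
  0≤ℤpos (+ k)    = 0≤+
  0≤ℤpos -[1+ k ] = ℤₚ.≤-refl

  ℤpos-nonneg : ∀ {a} → 0ℤ ≤ a → ℤpos a ≡ a
  ℤpos-nonneg {+ k} _ = refl

  ℤpos-nonpos : ∀ {a} → a ≤ 0ℤ → ℤpos a ≡ 0ℤ
  ℤpos-nonpos {+ zero}    _ = refl
  ℤpos-nonpos {+ suc k}   (+≤+ ())
  ℤpos-nonpos { -[1+ k ]} _ = refl

  double-cancel : ∀ {a b} → + 2 * a ≡ + 2 * b → a ≡ b
  double-cancel {a} {b} = ℤₚ.*-cancelˡ-≡ (+ 2) a b

-- Hall's theorem for fractional orientations of a graph, by augmenting paths.
module Flow {N m : ℕ} (β : Fin N → Fin N) (β-invol : ∀ d → β (β d) ≡ d) (β-nofix : ∀ d → β d ≢ d)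
  (node : Fin N → Fin m) (cap : Fin N → ℤ) (cap-β : ∀ d → cap (β d) ≡ cap d) (0≤cap : ∀ d → 0ℤ ≤ cap d)
  (t : Fin m → ℤ) where

  record Assignment : Set where
    field
      x      : Fin N → ℤ
      nonneg : ∀ d → 0ℤ ≤ x d
      total  : ∀ d → x d + x (β d) ≡ cap d

  open Assignment

  load : (Fin N → ℤ) → Fin m → ℤ
  load x v = ∑ (λ d → 𝟙 (node d ≡ᵇ v) * x d)

  initial : Assignment
  initial = record { x = x₀ ; nonneg = nonneg₀ ; total = total₀ }
    where
    x₀ : Fin N → ℤ
    x₀ d = if ⌊ toℕ d ℕₚ.<? toℕ (β d) ⌋ then cap d else 0ℤ
    lower : ∀ d → toℕ d ℕ.< toℕ (β d) → x₀ d ≡ cap d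
    lower d lt = cong (if_then cap d else 0ℤ) (⌊⌋-true (toℕ d ℕₚ.<? toℕ (β d)) lt)
    upper : ∀ d → ¬ toℕ d ℕ.< toℕ (β d) → x₀ d ≡ 0ℤ
    upper d ≮ = cong (if_then cap d else 0ℤ) (⌊⌋-false (toℕ d ℕₚ.<? toℕ (β d)) ≮)
    nonneg₀ : ∀ d → 0ℤ ≤ x₀ d
    nonneg₀ d with toℕ d ℕₚ.<? toℕ (β d)
    ... | yes _ = 0≤cap d
    ... | no _  = ℤₚ.≤-refl
    total₀ : ∀ d → x₀ d + x₀ (β d) ≡ cap d
    total₀ d with ℕₚ.<-cmp (toℕ d) (toℕ (β d))
    ... | tri< lt _ ≯ = trans (cong₂ _+_ (lower d lt) (upper (β d) (λ l → ≯ (subst (λ e → toℕ (β d) ℕ.< toℕ e) (β-invol d) l)))) (ℤₚ.+-identityʳ _)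
    ... | tri≈ _ e _ = ⊥-elim (β-nofix d (Finₚ.toℕ-injective (sym e)))
    ... | tri> ≮ _ gt = trans (cong₂ _+_ (upper d ≮) (lower (β d) (subst (λ e → toℕ (β d) ℕ.< toℕ e) (sym (β-invol d)) gt)))
                          (trans (ℤₚ.+-identityˡ _) (cap-β d))

  private
    β-≡ᵇ : ∀ d e → (β e ≡ᵇ d) ≡ (e ≡ᵇ β d)
    β-≡ᵇ d e = ⇔⇒≡ (λ q → ⌊⌋-true (_ Finₚ.≟ _) (trans (sym (β-invol e)) (cong β (≡ᵇ-sound q))))
      (λ q → ⌊⌋-true (_ Finₚ.≟ _) (trans (cong β (≡ᵇ-sound q)) (β-invol d)))

  move : (a : Assignment) (d : Fin N) → 1ℤ ≤ x a d →
    Σ Assignment λ a' → (∀ e → e ≢ d → x a e ≤ x a' e) ×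
      (∀ v → load (x a') v ≡ load (x a) v - 𝟙 (node d ≡ᵇ v) + 𝟙 (node (β d) ≡ᵇ v))
  move a d 1≤ = record { x = x' ; nonneg = nonneg' ; total = total' } , grows , load'
    where
    x' : Fin N → ℤ
    x' e = x a e - 𝟙 (e ≡ᵇ d) + 𝟙 (e ≡ᵇ β d)
    nonneg' : ∀ e → 0ℤ ≤ x' e
    nonneg' e = lemma (e Finₚ.≟ d) ⊞ 0≤𝟙 (e ≡ᵇ β d)
      where
      lemma : Dec (e ≡ d) → 0ℤ ≤ x a e - 𝟙 (e ≡ᵇ d)
      lemma (yes refl) = gap (ℤₚ.≤-trans (𝟙≤1 (d ≡ᵇ d)) 1≤)
      lemma (no e≢d)   = subst (λ b → 0ℤ ≤ x a e - 𝟙 b) (sym (≡ᵇ-false e≢d)) (subst (0ℤ ≤_) (sym (ℤₚ.+-identityʳ _)) (nonneg a e))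
    total' : ∀ e → x' e + x' (β e) ≡ cap e
    total' e = trans (cong (λ y → x' e + (x a (β e) - y + 𝟙 (β e ≡ᵇ β d))) (cong 𝟙 (β-≡ᵇ d e)))
      (trans (cong (λ y → x' e + (x a (β e) - 𝟙 (e ≡ᵇ β d) + 𝟙 y)) (trans (β-≡ᵇ (β d) e) (cong (e ≡ᵇ_) (β-invol d))))
        (trans (arrange (x a e) (x a (β e)) (𝟙 (e ≡ᵇ d)) (𝟙 (e ≡ᵇ β d))) (total a e)))
      where
      arrange : ∀ p q i j → (p - i + j) + (q - j + i) ≡ p + q
      arrange = solve-∀
    grows : ∀ e → e ≢ d → x a e ≤ x' e
    grows e e≢d = ≤-by (0≤𝟙 (e ≡ᵇ β d)) (sym (trans (cong (λ b → (x a e - 𝟙 b + 𝟙 (e ≡ᵇ β d)) - x a e) (≡ᵇ-false e≢d)) (arrange (x a e) _)))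
      where
      arrange : ∀ p j → (p - 0ℤ + j) - p ≡ j
      arrange = solve-∀
    load' : ∀ v → load x' v ≡ load (x a) v - 𝟙 (node d ≡ᵇ v) + 𝟙 (node (β d) ≡ᵇ v)
    load' v = trans (sum-cong (λ e → arrange (𝟙 (node e ≡ᵇ v)) (x a e) (𝟙 (e ≡ᵇ d)) (𝟙 (e ≡ᵇ β d))))
      (trans (sum-+ _ _) (cong₂ _+_ (trans (sum-minus _ _) (cong (_-_ (load (x a) v)) (sum-pick (λ e → 𝟙 (node e ≡ᵇ v)) d)))
        (sum-pick (λ e → 𝟙 (node e ≡ᵇ v)) (β d))))
      where
      arrange : ∀ k p i j → k * (p - i + j) ≡ k * p - i * k + j * k
      arrange = solve-∀

  -- Read from the overloaded node `v` towards the deficient node `u`: each dart on the way holds a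
  -- unit that can pass to its other end. The predicate `P` on the nodes serves to record that `v`
  -- is not revisited.
  data Path (x : Fin N → ℤ) (P : Fin m → Set) (u : Fin m) : ℕ → Fin m → Set where
    done : P u → Path x P u 0 u
    hop  : ∀ {ℓ} d → P (node d) → 1ℤ ≤ x d → Path x P u ℓ (node (β d)) → Path x P u (suc ℓ) (node d)

  private
    path-start : ∀ {x P u ℓ a} → Path x P u ℓ a → P a
    path-start (done p)      = p
    path-start (hop d p _ _) = p

    snoc : ∀ {x ℓ a} d → 1ℤ ≤ x d → Path x (λ _ → ⊤) (node d) ℓ a → Path x (λ _ → ⊤) (node (β d)) (suc ℓ) a
    snoc d 1≤ (done _)       = hop d tt 1≤ (done tt)
    snoc d 1≤ (hop e _ l p) = hop e tt l (snoc d 1≤ p)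

    -- Moving a unit off `d` may exhaust `d`. After the last visit to `v` no dart starts at `v`, so
    -- the rest of the path survives the move.
    last-visit : ∀ {x P u v ℓ a} → v ≢ u → Path x P u ℓ a → Path x (_≢ v) u ℓ a ⊎
      (∃[ ℓ' ] Σ (Fin N) λ d → (ℓ' ℕ.< ℓ) × (node d ≡ v) × (1ℤ ≤ x d) × Path x (_≢ v) u ℓ' (node (β d)))
    last-visit v≢u (done _) = inj₁ (done (λ e → v≢u (sym e)))
    last-visit {v = v} v≢u (hop {ℓ} d _ 1≤ p) with last-visit v≢u p
    ... | inj₂ (ℓ' , e , lt , rest) = inj₂ (ℓ' , e , ℕₚ.m<n⇒m<1+n lt , rest)
    ... | inj₁ q with node d Finₚ.≟ v
    ... | yes e  = inj₂ (ℓ , d , ℕₚ.≤-refl , e , 1≤ , q)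
    ... | no d≢v = inj₁ (hop d d≢v 1≤ q)

    transport : ∀ {x x' : Fin N → ℤ} {v d₀ u ℓ a} → node d₀ ≡ v → (∀ e → e ≢ d₀ → x e ≤ x' e) →
      Path x (_≢ v) u ℓ a → Path x' (λ _ → ⊤) u ℓ a
    transport e grows (done _)       = done tt
    transport e grows (hop d d≢ 1≤ p) = hop d tt (ℤₚ.≤-trans 1≤ (grows d (λ { refl → d≢ e }))) (transport e grows p)

  augment : ∀ k {ℓ} → ℓ ℕ.≤ k → (a : Assignment) → ∀ {v u} → v ≢ u → Path (x a) (λ _ → ⊤) u ℓ v →
    Σ Assignment λ a' → ∀ z → load (x a') z ≡ load (x a) z - 𝟙 (v ≡ᵇ z) + 𝟙 (u ≡ᵇ z)
  augment k ℓ≤k a {v} {u} v≢u p with last-visit v≢u p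
  ... | inj₁ q = ⊥-elim (path-start q refl)
  ... | inj₂ (ℓ' , d , lt , refl , 1≤ , q) with move a d 1≤
  ... | a₁ , grows , load₁ with node (β d) Finₚ.≟ u
  ... | yes refl = a₁ , load₁
  ... | no ≢u with k
  ... | zero = ⊥-elim (ℕₚ.<⇒≱ lt (ℕₚ.≤-trans ℓ≤k z≤n))
  ... | suc k' with augment k' (ℕ.s≤s⁻¹ (ℕₚ.≤-trans lt ℓ≤k)) a₁ ≢u (transport refl grows q)
  ... | a' , load' = a' , λ z → trans (load' z) (trans (cong (λ y → y - 𝟙 (node (β d) ≡ᵇ z) + 𝟙 (u ≡ᵇ z)) (load₁ z))
        (arrange (load (x a) z) (𝟙 (node d ≡ᵇ z)) (𝟙 (node (β d) ≡ᵇ z)) (𝟙 (u ≡ᵇ z))))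
    where
    arrange : ∀ l i j k → (l - i + j) - j + k ≡ l - i + k
    arrange = solve-∀

  weighted-load : ∀ (s : Fin m → ℤ) y → ∑ (λ v → s v * load y v) ≡ ∑ (λ d → s (node d) * y d)
  weighted-load s y = trans (sum-cong (λ v → sym (sum-* (s v) _))) (trans (sum-swap _) (sum-cong (λ d →
    trans (sum-cong (λ v → trans (cong (λ b → s v * (𝟙 b * y d)) (flip d v)) (arrange (s v) (𝟙 (v ≡ᵇ node d)) (y d))))
      (sum-pick (λ v → s v * y d) (node d)))))
    where
    arrange : ∀ a i y → a * (i * y) ≡ i * (a * y)
    arrange = solve-∀
    flip : ∀ d v → (node d ≡ᵇ v) ≡ (v ≡ᵇ node d)
    flip d v = ⇔⇒≡ (λ e → ⌊⌋-true (_ Finₚ.≟ _) (sym (≡ᵇ-sound e))) (λ e → ⌊⌋-true (_ Finₚ.≟ _) (sym (≡ᵇ-sound e)))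

  symmetric-sum : ∀ (a : Assignment) (s : Fin N → ℤ) → (∀ d → s (β d) ≡ s d) →
    + 2 * ∑ (λ d → s d * x a d) ≡ ∑ (λ d → s d * cap d)
  symmetric-sum a s s-β = trans (double (∑ (λ d → s d * x a d))) (trans (cong (_+_ (∑ (λ d → s d * x a d)))
      (sym (trans (sum-cong (λ d → cong (_* x a (β d)) (sym (s-β d)))) (sum-perm β β β-invol β-invol (λ d → s d * x a d)))))
    (trans (sym (sum-+ _ _)) (sum-cong (λ d → trans (sym (ℤₚ.*-distribˡ-+ (s d) (x a d) (x a (β d)))) (cong (s d *_) (total a d))))))
    where
    double : ∀ z → + 2 * z ≡ z + z
    double = solve-∀

  module _ (balanced : ∑ cap ≡ + 2 * ∑ t)
    (hall : ∀ (R : Fin m → Bool) →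
      ∑ (λ d → 𝟙 (R (node d)) * 𝟙 (R (node (β d))) * cap d) ≤ + 2 * ∑ (λ v → 𝟙 (R v) * t v)) where

    Perfect : Set
    Perfect = Σ Assignment λ a → ∀ v → load (x a) v ≡ t v

    private
      total-load : ∀ a → ∑ (load (x a)) ≡ ∑ t
      total-load a = double-cancel (trans (cong (_*_ (+ 2))
          (trans (sum-cong (λ v → sym (ℤₚ.*-identityˡ _))) (weighted-load (λ _ → 1ℤ) (x a))))
        (trans (symmetric-sum a (λ _ → 1ℤ) (λ _ → refl)) (trans (sum-cong (λ d → ℤₚ.*-identityˡ _)) balanced)))

      excess : Assignment → Fin m → ℤ
      excess a v = ℤpos (load (x a) v - t v)

      no-excess : ∀ a → ¬ (∃[ v ] (t v < load (x a) v)) → ∀ v → load (x a) v ≡ t v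
      no-excess a none v = sym (ℤₚ.i-j≡0⇒i≡j _ _ (sum≡0⇒term≡0 (λ v → gap (ℤₚ.≮⇒≥ (λ lt → none (v , lt))))
        (trans (sum-minus t (load (x a))) (trans (cong (_-_ (∑ t)) (total-load a)) (ℤₚ.+-inverseʳ (∑ t)))) v))

      improve : ∀ a a' {v u} → t v < load (x a) v → load (x a) u < t u →
        (∀ z → load (x a') z ≡ load (x a) z - 𝟙 (v ≡ᵇ z) + 𝟙 (u ≡ᵇ z)) → ∑ (excess a') ≡ ∑ (excess a) - 1ℤ
      improve a a' {v} {u} tv uv load' = trans (sum-cong pointwise) (trans (sum-minus (excess a) (λ z → 𝟙 (z ≡ᵇ v)))
        (cong (_-_ (∑ (excess a))) (trans (sum-cong (λ z → sym (ℤₚ.*-identityʳ _))) (sum-pick (λ _ → 1ℤ) v))))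
        where
        v≢u : v ≢ u
        v≢u refl = ℤₚ.<-asym tv uv
        a₁ : ∀ l t → (l - 1ℤ + 0ℤ) - t ≡ (l - t) - 1ℤ
        a₁ = solve-∀
        a₂ : ∀ l t → (l - 0ℤ + 0ℤ) - t ≡ (l - t) - 0ℤ
        a₂ = solve-∀
        a₃ : ∀ l t → 0ℤ - ((l - 0ℤ + 1ℤ) - t) ≡ (t - l) - 1ℤ
        a₃ = solve-∀
        val : ∀ z {i j} → (v ≡ᵇ z) ≡ i → (u ≡ᵇ z) ≡ j → load (x a') z ≡ load (x a) z - 𝟙 i + 𝟙 j
        val z refl refl = load' z
        pointwise : ∀ z → excess a' z ≡ excess a z - 𝟙 (z ≡ᵇ v)
        pointwise z with z Finₚ.≟ v
        ... | yes refl = trans (cong (λ l → ℤpos (l - t v)) (val v (≡ᵇ-refl v) (≡ᵇ-false (λ e → v≢u (sym e)))))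
                (trans (cong ℤpos (a₁ (load (x a) v) (t v))) (trans (ℤpos-nonneg (gap (<⇒1≤- tv)))
                  (cong (_- 1ℤ) (sym (ℤpos-nonneg (gap (ℤₚ.<⇒≤ tv)))))))
        ... | no z≢v with z Finₚ.≟ u
        ... | yes refl = trans (cong (λ l → ℤpos (l - t u)) (val u (≡ᵇ-false v≢u) (≡ᵇ-refl u)))
                (trans (ℤpos-nonpos (≤-by (gap (<⇒1≤- uv)) (sym (a₃ (load (x a) u) (t u)))))
                  (sym (trans (ℤₚ.+-identityʳ _) (ℤpos-nonpos (ℤₚ.i≤j⇒i-j≤0 (ℤₚ.<⇒≤ uv))))))
        ... | no z≢u = trans (cong (λ l → ℤpos (l - t z)) (val z (≡ᵇ-false (λ e → z≢v (sym e))) (≡ᵇ-false (λ e → z≢u (sym e)))))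
                (trans (cong ℤpos (trans (a₂ (load (x a) z) (t z)) (ℤₚ.+-identityʳ (load (x a) z - t z)))) (sym (ℤₚ.+-identityʳ (excess a z))))

      -- No unit can pass out of `S`, so the load on `S` is exactly the capacity inside `S`. Hall's
      -- condition bounds this by the targets, which leaves no room for the surplus at `v` when no
      -- node of `S` is deficient.
      stuck : ∀ a {v} → t v < load (x a) v → (S : Fin m → Bool) → S v ≡ true →
        (∀ d → S (node d) ≡ true → 1ℤ ≤ x a d → S (node (β d)) ≡ true) →
        (∀ u → S u ≡ true → t u ≤ load (x a) u) → ⊥
      stuck a {v} tv S Sv closed ≥t = ℤₚ.<⇒≱ {0ℤ} {1ℤ} (+<+ (s≤s z≤n)) (ℤₚ.≤-trans one≤ nonpositive)
        where
        ts = ∑ (λ u → 𝟙 (S u) * t u)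
        hs = ∑ (λ d → 𝟙 (S (node d)) * 𝟙 (S (node (β d))) * cap d)
        split : ∑ (λ u → 𝟙 (S u) * (load (x a) u - t u)) ≡ ∑ (λ u → 𝟙 (S u) * load (x a) u) - ts
        split = trans (sum-cong (λ u → distrib (𝟙 (S u)) (load (x a) u) (t u))) (sum-minus _ _)
          where
          distrib : ∀ s l t → s * (l - t) ≡ s * l - s * t
          distrib = solve-∀
        inner : ∀ d → 𝟙 (S (node d)) * x a d ≡ 𝟙 (S (node d)) * 𝟙 (S (node (β d))) * x a d
        inner d = trans (𝟙-*-cong (S (node d)) (λ s → cases s (bool (S (node (β d)))))) (sym (ℤₚ.*-assoc (𝟙 (S (node d))) _ _))
          where
          cases : S (node d) ≡ true → (S (node (β d)) ≡ true) ⊎ (S (node (β d)) ≡ false) → x a d ≡ 𝟙 (S (node (β d))) * x a d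
          cases s (inj₁ e) = sym (trans (cong (λ b → 𝟙 b * x a d) e) (ℤₚ.*-identityˡ _))
          cases s (inj₂ e) = trans (ℤₚ.≤-antisym (ℤₚ.≮⇒≥ (λ 0< → true≢false (closed d s (0<⇒1≤ 0<)) e)) (nonneg a d))
            (sym (cong (λ b → 𝟙 b * x a d) e))
        hs≡ : hs ≡ + 2 * ∑ (λ u → 𝟙 (S u) * load (x a) u)
        hs≡ = sym (trans (cong (_*_ (+ 2)) (trans (weighted-load (λ u → 𝟙 (S u)) (x a)) (sum-cong inner)))
          (symmetric-sum a (λ d → 𝟙 (S (node d)) * 𝟙 (S (node (β d)))) (λ d →
            trans (cong (λ e → 𝟙 (S (node (β d))) * 𝟙 (S (node e))) (β-invol d)) (ℤₚ.*-comm (𝟙 (S (node (β d)))) _))))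
        one≤ : 1ℤ ≤ + 2 * ∑ (λ u → 𝟙 (S u) * (load (x a) u - t u))
        one≤ = ℤₚ.≤-trans (+≤+ (s≤s z≤n)) (ℤₚ.*-monoˡ-≤-nonNeg (+ 2) (ℤₚ.≤-trans
          (subst (1ℤ ≤_) (sym (trans (cong (λ b → 𝟙 b * (load (x a) v - t v)) Sv) (ℤₚ.*-identityˡ _))) (<⇒1≤- tv))
          (term≤sum {f = λ u → 𝟙 (S u) * (load (x a) u - t u)}
            (λ u → subst (_≤ 𝟙 (S u) * (load (x a) u - t u)) (ℤₚ.*-zeroʳ (𝟙 (S u))) (𝟙-*-mono (S u) (λ s → gap (≥t u s)))) v)))
        arrange : ∀ l t → + 2 * t - + 2 * l ≡ 0ℤ - + 2 * (l - t)
        arrange = solve-∀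
        nonpositive : + 2 * ∑ (λ u → 𝟙 (S u) * (load (x a) u - t u)) ≤ 0ℤ
        nonpositive = ≤-by (gap (hall S)) (trans (cong (_-_ (+ 2 * ts)) hs≡)
          (trans (arrange (∑ (λ u → 𝟙 (S u) * load (x a) u)) ts) (cong (λ y → 0ℤ - + 2 * y) (sym split))))

      descend : ∀ k a → ∑ (excess a) < + k → ¬ ¬ Perfect
      descend zero a lt = ⊥-elim (ℤₚ.<⇒≱ lt (sum-nonneg (λ v → 0≤ℤpos _)))
      descend (suc k) a lt with Finₚ.any? (λ v → t v ℤₚ.<? load (x a) v)
      ... | no none = return (a , no-excess a none)
      ... | yes (v , tv) = do
        (S , dS) ← classify (λ u → ∃[ ℓ ] Path (x a) (λ _ → ⊤) u ℓ v)
        find-deficit S dS (Finₚ.any? (λ u → (S u Boolₚ.≟ true) ×-dec (load (x a) u ℤₚ.<? t u)))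
        where
        find-deficit : ∀ S → Decides (λ u → ∃[ ℓ ] Path (x a) (λ _ → ⊤) u ℓ v) S →
          Dec (∃[ u ] (S u ≡ true × load (x a) u < t u)) → ¬ ¬ Perfect
        find-deficit S dS (no none) _ = stuck a tv S (complete (0 , done tt))
          (λ d s 1≤ → complete (_ , snoc d 1≤ (proj₂ (sound s)))) (λ u s → ℤₚ.≮⇒≥ (λ l → none (u , s , l)))
          where open Decides dS
        find-deficit S dS (yes (u , Su , uv)) = descend k a' (ℤₚ.≤-<-trans
            (ℤₚ.≤-reflexive (improve a a' tv uv (proj₂ aug))) smaller)
          where
          open Decides dS
          aug = augment (proj₁ (sound Su)) ℕₚ.≤-refl a {v} {u} (λ { refl → ℤₚ.<-asym tv uv }) (proj₂ (sound Su))
          a' = proj₁ aug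
          smaller : ∑ (excess a) - 1ℤ < + k
          smaller = ℤₚ.suc[i]≤j⇒i<j (ℤₚ.≤-trans (ℤₚ.≤-reflexive (arrange (∑ (excess a)))) (≤-by (gap (<⇒1≤- lt)) (arrange' (∑ (excess a)) (+ k))))
            where
            arrange : ∀ s → 1ℤ + (s - 1ℤ) ≡ s
            arrange = solve-∀
            arrange' : ∀ s k → ((1ℤ + k) - s) - 1ℤ ≡ k - s
            arrange' = solve-∀

    perfect : ¬ ¬ Perfect
    perfect = descend (suc ∣ ∑ (excess initial) ∣) initial
      (ℤₚ.≤-<-trans (ℤₚ.≤-reflexive (sym (ℤₚ.0≤i⇒+∣i∣≡i (sum-nonneg (λ v → 0≤ℤpos _))))) (+<+ ℕₚ.≤-refl))

-- Regions of faces, and the weight conditions summed over them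

𝟙-∨ : ∀ {a b} → (a ≡ true → b ≡ true → ⊥) → 𝟙 (a ∨ b) ≡ 𝟙 a + 𝟙 b
𝟙-∨ {true}  {true}  d = ⊥-elim (d refl refl)
𝟙-∨ {true}  {false} d = refl
𝟙-∨ {false} {true}  d = refl
𝟙-∨ {false} {false} d = refl

∨-elim : ∀ {a b} → a ∨ b ≡ true → (a ≡ true) ⊎ (b ≡ true)
∨-elim {true}  e = inj₁ refl
∨-elim {false} e = inj₂ e

∨-introˡ : ∀ {a b} → a ≡ true → a ∨ b ≡ true
∨-introˡ refl = refl

∨-introʳ : ∀ {a b} → b ≡ true → a ∨ b ≡ true
∨-introʳ {true}  refl = refl
∨-introʳ {false} refl = refl

∨-false : ∀ {a b} → a ≡ false → b ≡ false → a ∨ b ≡ false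
∨-false refl refl = refl

not-false : ∀ {b} → not b ≡ false → b ≡ true
not-false {true} _ = refl

not-true : ∀ {b} → not b ≡ true → b ≡ false
not-true {false} _ = refl

0≤1-𝟙 : ∀ b → 0ℤ ≤ 1ℤ - 𝟙 b
0≤1-𝟙 b = gap (𝟙≤1 b)

if-∧ : ∀ a b c → (if a ∧ b then c else 0ℤ) ≡ 𝟙 a * (if b then c else 0ℤ)
if-∧ true  b c = sym (ℤₚ.*-identityˡ _)
if-∧ false b c = refl

module Regions {n : ℕ} (PM : PlaneMap n) where
  open PlaneMap PM
  open Planar pmap public
  open Cycles pmap public

  touch : (Fin n → Bool) → Fin n → Bool
  touch B h = ⌊ Finₚ.any? (λ g → (h V.~? g) ×-dec (B g Boolₚ.≟ true)) ⌋

  touch-sound : ∀ {B h} → touch B h ≡ true → ∃[ g ] (h V.~ g × B g ≡ true)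
  touch-sound = ⌊⌋-sound (Finₚ.any? _)

  touch-true : ∀ {B h} g → h V.~ g → B g ≡ true → touch B h ≡ true
  touch-true g e t = ⌊⌋-true (Finₚ.any? _) (g , e , t)

  touch-~ : ∀ {B g h} → g V.~ h → touch B g ≡ touch B h
  touch-~ g~h = ⇔⇒≡
    (λ e → touch-true _ (V.~-trans (V.~-sym g~h) (proj₁ (proj₂ (touch-sound e)))) (proj₂ (proj₂ (touch-sound e))))
    (λ e → touch-true _ (V.~-trans g~h (proj₁ (proj₂ (touch-sound e)))) (proj₂ (proj₂ (touch-sound e))))

  touch-σ : ∀ {B} → V.Invariant (touch B)
  touch-σ h = touch-~ (V.~-sym V.~-π)

  module Region (I : Fin n → Bool) (I-φ : F.Invariant I) (I-root : I root ≡ false) where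

    I-~ : ∀ {g h} → g F.~ h → I g ≡ I h
    I-~ = F.~-invariant I-φ

    I-σ : ∀ h → I (σ h) ≡ I (α h)
    I-σ h = sym (I-~ α-face-σ)

    I-inner : ∀ {h} → I h ≡ true → ¬ F._~_ root h
    I-inner Ih e = true≢false Ih (trans (sym (I-~ e)) I-root)

    surrounded : Fin n → Bool
    surrounded h = not (touch (λ g → not (I g)) h)

    surrounded-~ : ∀ {g h} → g V.~ h → surrounded g ≡ surrounded h
    surrounded-~ e = cong not (touch-~ e)

    surrounded-σ : V.Invariant surrounded
    surrounded-σ h = surrounded-~ (V.~-sym V.~-π)

    surrounded-I : ∀ {h} → surrounded h ≡ true → ∀ {g} → h V.~ g → I g ≡ true
    surrounded-I s {g} e = not-false (¬true⇒false (λ t → true≢false (touch-true {λ g → not (I g)} g e t) (not-true s)))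

    not-surrounded : ∀ {h} → surrounded h ≡ false → ∃[ g ] (h V.~ g × I g ≡ false)
    not-surrounded s with touch-sound (not-false s)
    ... | g , e , t = g , e , not-true t

    both : Fin n → ℤ
    both h = 𝟙 (I h) * 𝟙 (I (α h))

    side : Fin n → ℤ
    side h = 𝟙 (I h) * (1ℤ - 𝟙 (I (α h)))

    0≤both : ∀ h → 0ℤ ≤ both h
    0≤both h = 0≤𝟙 (I h) ⊠ 0≤𝟙 (I (α h))

    0≤side : ∀ h → 0ℤ ≤ side h
    0≤side h = 0≤𝟙 (I h) ⊠ 0≤1-𝟙 (I (α h))

    both-α : ∀ h → both (α h) ≡ both h
    both-α h = trans (cong (λ g → 𝟙 (I (α h)) * 𝟙 (I g)) (α-invol h)) (ℤₚ.*-comm (𝟙 (I (α h))) _)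

    side≡1 : ∀ {h} → I h ≡ true → I (α h) ≡ false → side h ≡ 1ℤ
    side≡1 a b = cong₂ (λ x y → 𝟙 x * (1ℤ - 𝟙 y)) a b

    boundary-at : ∀ {h} → I h ≡ true → surrounded h ≡ false → ∃[ g ] (h V.~ g × I g ≡ true × I (α g) ≡ false)
    boundary-at {h} Ih s with not-surrounded s
    ... | e , (k , refl) , Ie = rotate k h Ih Ie
      where
      rotate : ∀ k g → I g ≡ true → I (iter σ k g) ≡ false → ∃[ g' ] (g V.~ g' × I g' ≡ true × I (α g') ≡ false)
      rotate zero g Ig f = ⊥-elim (true≢false Ig f)
      rotate (suc k) g Ig f = case bool (I (α g)) of λ
        { (inj₂ e) → g , V.~-refl , Ig , e
        ; (inj₁ e) → case rotate k (σ g) (trans (I-σ g) e) (trans (cong I (trans (sym (V.iter-+ k 1 g)) (cong (λ j → iter σ j g) (ℕₚ.+-comm k 1)))) f) of λ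
            { (g' , e' , r) → g' , V.~-trans V.~-π e' , r } }

    -- Half-edges are counted: an edge inside the region contributes 2 to `D`, a boundary edge
    -- contributes 1 to `k'`.
    D k' : ℤ
    D  = ∑ both
    k' = ∑ side

    sum-side-α : ∑ (λ h → 𝟙 (I (α h)) * (1ℤ - 𝟙 (I h))) ≡ k'
    sum-side-α = trans (sum-cong (λ h → cong (λ g → 𝟙 (I (α h)) * (1ℤ - 𝟙 (I g))) (sym (α-invol h)))) (sum-α side)

    -- All faces outside `I` are joined to the root face across edges not in `H`, so together they
    -- need one root; this is the summand 1 beside `F.#orb I`.
    euler-region : ∀ {H R} → (∀ h → H (α h) ≡ H h) → V.Invariant R → (∀ h → H h ≡ true → R h ≡ true) →
      (∀ h → I h ≡ false → FF.Connected (F.in? root) (λ g → H g ≡ false) h) → ∃[ r ] (R r ≡ true) →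
      ∑ (λ h → 𝟙 (H h)) + + 4 ≤ + 2 * (1ℤ + F.#orb I) + + 2 * V.#orb R
    euler-region {H} {R} H-α R-σ H⇒R conn r = subst (λ z → ∑ (λ h → 𝟙 (H h)) + + 4 ≤ + 2 * z + + 2 * V.#orb R) count
      (euler-inequality {H} {Rt} {R} Rt-φ H-α R-σ H⇒R reach r)
      where
      Rt : Fin n → Bool
      Rt h = F.in? root h ∨ I h
      Rt-φ : F.Invariant Rt
      Rt-φ h = cong₂ _∨_ (in?-invariant-F root h) (I-φ h)
      weaken : ∀ {ℓ h} → FF.Conn (F.in? root) (λ g → H g ≡ false) ℓ h → FF.Conn Rt (λ g → H g ≡ false) ℓ h
      weaken (FF.at e)        = FF.at (∨-introˡ e)
      weaken (FF.cross c x e) = FF.cross (weaken c) x e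
      reach : ∀ h → FF.Connected Rt (λ g → H g ≡ false) h
      reach h = [ (λ t → 0 , FF.at (∨-introʳ {F.in? root h} t)) , (λ f → proj₁ (conn h f) , weaken (proj₂ (conn h f))) ]′ (bool (I h))
      count : F.#orb Rt ≡ 1ℤ + F.#orb I
      count = trans (sum-cong (λ r → trans (cong (𝟙 (F.min? r) *_) (𝟙-∨ (λ a b → I-inner b (F.in?-sound a))))
          (ℤₚ.*-distribˡ-+ (𝟙 (F.min? r)) _ _)))
        (trans (sum-+ _ _) (cong (_+ F.#orb I) (F.#orb-in? root)))

  module Oriented (b : ℕ) (w : ZBiorientation n) (ori : IsBOrientation PM w b)
    (even : ∀ h → + faceDeg h ≡ + 2 * + (faceDeg h DM./ 2)) where

    B : ℤ
    B = + b

    -- `y` marks the weight -1 and `x` is the positive part of `w`. Both are nonnegative, and the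
    -- weights of vertices and faces become plain orbit sums of them.
    y x : Fin n → ℤ
    y h = 𝟙 ⌊ w h ℤ.≟ -1ℤ ⌋
    x h = w h + y h

    data View (h : Fin n) : Set where
      ingoing  : 0ℤ < w h → y h ≡ 0ℤ → View h
      neutral  : w h ≡ 0ℤ → y h ≡ 0ℤ → View h
      negative : w h ≡ -1ℤ → y h ≡ 1ℤ → View h

    private
      y-of : ∀ {h} → w h ≢ -1ℤ → y h ≡ 0ℤ
      y-of ≢ = cong 𝟙 (⌊⌋-false (_ ℤ.≟ _) ≢)

    view : ∀ h → View h
    view h with 0ℤ ℤ.<? w h
    ... | yes p = ingoing p (y-of (λ e → ℤₚ.<⇒≱ p (subst (_≤ 0ℤ) (sym e) -≤+)))
    ... | no ≮ with proj₁ (proj₂ ori) h (ℤₚ.≮⇒≥ ≮)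
    ... | inj₁ e = neutral e (y-of (λ e' → case trans (sym e) e' of λ ()))
    ... | inj₂ e = negative e (cong 𝟙 (⌊⌋-true (_ ℤ.≟ _) e))

    0≤y : ∀ h → 0ℤ ≤ y h
    0≤y h = 0≤𝟙 _

    0≤x : ∀ h → 0ℤ ≤ x h
    0≤x h with view h
    ... | ingoing p e  = ℤₚ.<⇒≤ p ⊞ 0≤y h
    ... | neutral p e  = subst (λ v → 0ℤ ≤ v + y h) (sym p) (subst (0ℤ ≤_) (sym (ℤₚ.+-identityˡ _)) (0≤y h))
    ... | negative p e = subst (0ℤ ≤_) (sym (cong₂ _+_ p e)) ℤₚ.≤-refl

    x-outgoing : ∀ {h} → ¬ 0ℤ < w h → x h ≡ 0ℤ
    x-outgoing {h} ≮ with view h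
    ... | ingoing p e  = ⊥-elim (≮ p)
    ... | neutral p e  = cong₂ _+_ p e
    ... | negative p e = cong₂ _+_ p e

    x-ingoing : ∀ {h} → 0ℤ < w h → x h ≡ w h
    x-ingoing {h} p with view h
    ... | ingoing _ e  = trans (cong (_+_ (w h)) e) (ℤₚ.+-identityʳ _)
    ... | neutral q e  = ⊥-elim (ℤₚ.<-irrefl (sym q) p)
    ... | negative q e = ⊥-elim (ℤₚ.<⇒≱ p (subst (_≤ 0ℤ) (sym q) -≤+))

    vertexWeight≡ : ∀ h → vertexWeight PM w h ≡ V.osum x h
    vertexWeight≡ h = trans (∑≡sumℤ _) (sum-cong (λ g → trans (if-∧ (vertexOf? h g) (ingoing? PM w g) (w g))
      (cong₂ (λ i z → 𝟙 i * z) (V.in?≡ h g) (value g))))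
      where
      value : ∀ g → (if ingoing? PM w g then w g else 0ℤ) ≡ x g
      value g with 0ℤ ℤ.<? w g
      ... | yes p = sym (x-ingoing p)
      ... | no ≮  = sym (x-outgoing ≮)

    faceWeight≡ : ∀ h → faceWeight PM w h ≡ - F.osum y h
    faceWeight≡ h = trans (∑≡sumℤ _) (trans (sum-cong (λ g → trans (if-∧ (faceOf? h g) (not (ingoing? PM w g)) (w g))
      (cong₂ (λ i z → 𝟙 i * z) (F.in?≡ h g) (value g)))) (F.osum-neg y h))
      where
      value : ∀ g → (if not (ingoing? PM w g) then w g else 0ℤ) ≡ - y g
      value g with 0ℤ ℤ.<? w g | view g
      ... | yes p | ingoing _ e  = sym (cong -_ e)
      ... | yes p | neutral q e  = ⊥-elim (ℤₚ.<-irrefl (sym q) p)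
      ... | yes p | negative q e = ⊥-elim (ℤₚ.<⇒≱ p (subst (_≤ 0ℤ) (sym q) -≤+))
      ... | no ≮ | ingoing p e  = ⊥-elim (≮ p)
      ... | no ≮ | neutral q e  = trans q (sym (cong -_ e))
      ... | no ≮ | negative q e = trans q (sym (cong -_ e))

    vertex-sum : ∀ h → InnerVertex h → V.osum x h ≡ B
    vertex-sum h iv = trans (sym (vertexWeight≡ h)) (proj₁ (proj₂ (proj₂ (proj₂ ori))) h iv)

    edge-sum : ∀ h → InnerEdge h → w h + w (α h) ≡ B - 1ℤ
    edge-sum = proj₁ (proj₂ (proj₂ ori))

    edge-sum-xy : ∀ h → InnerEdge h → x h + x (α h) ≡ B - 1ℤ + (y h + y (α h))
    edge-sum-xy h ie = trans (arrange (w h) (y h) (w (α h)) (y (α h))) (cong (_+ (y h + y (α h))) (edge-sum h ie))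
      where
      arrange : ∀ a b c d → (a + b) + (c + d) ≡ (a + c) + (b + d)
      arrange = solve-∀

    -- Condition (iii) doubled, in order to be rid of the half degree.
    face-sum : ∀ h → InnerFace h → F.osum (λ g → 1ℤ - + 2 * y g) h ≡ + 2 * B
    face-sum h if = trans (F.osum-minus (λ _ → 1ℤ) (λ g → + 2 * y g) h) (trans (cong₂ _-_ (trans (F.osum-1 h) (even h)) double)
      (trans (arrange (+ (faceDeg h DM./ 2)) (F.osum y h))
        (cong (_*_ (+ 2)) (trans (cong (_+_ (+ (faceDeg h DM./ 2))) (sym (faceWeight≡ h))) (proj₂ (proj₂ (proj₂ (proj₂ ori))) h if)))))
      where
      shuffle : ∀ i y → i * (+ 2 * y) ≡ + 2 * (i * y)
      shuffle = solve-∀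
      arrange : ∀ d y → + 2 * d - + 2 * y ≡ + 2 * (d + - y)
      arrange = solve-∀
      double : F.osum (λ g → + 2 * y g) h ≡ + 2 * F.osum y h
      double = trans (sum-cong (λ g → shuffle (𝟙 (F.in? h g)) (y g))) (sum-* (+ 2) (λ g → 𝟙 (F.in? h g) * y g))

    module RegionCount (I : Fin n → Bool) (I-φ : F.Invariant I) (I-root : I root ≡ false) where
      open Region I I-φ I-root

      both-inner : ∀ {h} → I h ≡ true → I (α h) ≡ true → InnerEdge h
      both-inner a b (inj₁ e) = I-inner a e
      both-inner a b (inj₂ e) = I-inner b e

      surrounded-α : ∀ {h} → surrounded h ≡ true → I (α h) ≡ true
      surrounded-α {h} s = trans (sym (I-σ h)) (surrounded-I s V.~-π)

      -- The parts of the sums that do not cancel inside the region: `X` is the weight that inner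
      -- edges give to vertices on its border, `Y` the number of -1 on boundary half-edges whose
      -- right face is in the region.
      X Y : ℤ
      X = ∑ (λ h → both h * (1ℤ - 𝟙 (surrounded h)) * x h)
      Y = ∑ (λ h → side h * y h)

      0≤X : 0ℤ ≤ X
      0≤X = sum-nonneg (λ h → 0≤both h ⊠ 0≤1-𝟙 (surrounded h) ⊠ 0≤x h)

      0≤Y : 0ℤ ≤ Y
      0≤Y = sum-nonneg (λ h → 0≤side h ⊠ 0≤y h)

      private
        IIx IIy : ℤ
        IIx = ∑ (λ h → both h * x h)
        IIy = ∑ (λ h → both h * y h)

        faces : D + k' - + 2 * (IIy + Y) ≡ + 2 * B * F.#orb I
        faces = trans (sym (trans (sum-cong (λ h → arrange (𝟙 (I h)) (𝟙 (I (α h))) (y h)))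
            (trans (sum-minus _ _) (cong₂ _-_ (sum-+ _ _) (trans (sum-* (+ 2) _) (cong (_*_ (+ 2)) (sum-+ _ _)))))))
          (F.#orb-* I-φ (+ 2 * B) (λ g → 1ℤ - + 2 * y g) (λ h Ih → face-sum h (I-inner Ih)))
          where
          arrange : ∀ i j y → i * (1ℤ - + 2 * y) ≡ (i * j + i * (1ℤ - j)) - + 2 * (i * j * y + i * (1ℤ - j) * y)
          arrange = solve-∀

        vertices : IIx ≡ B * V.#orb surrounded + X
        vertices = trans (trans (sum-cong (λ h → split h (bool (surrounded h)))) (sum-+ _ _)) (cong (_+ X)
          (V.#orb-* surrounded-σ B x (λ h s → vertex-sum h (λ { (g , e , r) → I-inner (surrounded-I s e) r }))))
          where
          split : ∀ h → (surrounded h ≡ true) ⊎ (surrounded h ≡ false) →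
            both h * x h ≡ 𝟙 (surrounded h) * x h + both h * (1ℤ - 𝟙 (surrounded h)) * x h
          split h (inj₂ e) = trans (arrange (both h) (x h)) (sym (cong (λ s → 𝟙 s * x h + both h * (1ℤ - 𝟙 s) * x h) e))
            where
            arrange : ∀ b x → b * x ≡ 0ℤ * x + b * (1ℤ - 0ℤ) * x
            arrange = solve-∀
          split h (inj₁ e) = trans (cong (_* x h) (cong₂ (λ i j → 𝟙 i * 𝟙 j) (surrounded-I e V.~-refl) (surrounded-α e)))
            (trans (arrange (both h) (x h)) (sym (cong (λ s → 𝟙 s * x h + both h * (1ℤ - 𝟙 s) * x h) e)))
            where
            arrange : ∀ b x → 1ℤ * x ≡ 1ℤ * x + b * (1ℤ - 1ℤ) * x
            arrange = solve-∀

        edges : + 2 * (IIx - IIy) ≡ (B - 1ℤ) * D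
        edges = begin
          + 2 * (IIx - IIy)
            ≡⟨ cong (_*_ (+ 2)) (trans (sym (sum-minus (λ h → both h * x h) (λ h → both h * y h))) (sum-cong (λ h → drop (both h) (w h) (y h)))) ⟩
          + 2 * ∑ (λ h → both h * w h)
            ≡⟨ double (∑ (λ h → both h * w h)) ⟩
          ∑ (λ h → both h * w h) + ∑ (λ h → both h * w h)
            ≡⟨ cong (_+_ (∑ (λ h → both h * w h))) (sym (trans (sum-cong (λ h → cong (_* w (α h)) (sym (both-α h)))) (sum-α (λ h → both h * w h)))) ⟩
          ∑ (λ h → both h * w h) + ∑ (λ h → both h * w (α h))
            ≡⟨ sym (sum-+ _ _) ⟩
          ∑ (λ h → both h * w h + both h * w (α h))
            ≡⟨ sum-cong (λ h → trans (sym (ℤₚ.*-distribˡ-+ (both h) (w h) (w (α h)))) (trans (weigh h) (ℤₚ.*-comm (both h) (B - 1ℤ)))) ⟩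
          ∑ (λ h → (B - 1ℤ) * both h)
            ≡⟨ sum-* (B - 1ℤ) both ⟩
          (B - 1ℤ) * D ∎
          where
          open ≡-Reasoning
          drop : ∀ b w y → b * (w + y) - b * y ≡ b * w
          drop = solve-∀
          double : ∀ z → + 2 * z ≡ z + z
          double = solve-∀
          weigh : ∀ h → both h * (w h + w (α h)) ≡ both h * (B - 1ℤ)
          weigh h = trans (ℤₚ.*-assoc (𝟙 (I h)) _ _) (trans (𝟙-*-cong (I h) (λ a → 𝟙-*-cong (I (α h)) (λ b → edge-sum h (both-inner a b))))
            (sym (ℤₚ.*-assoc (𝟙 (I h)) _ _)))

      -- Adding up the conditions on the vertices, edges and faces of I.
      region-count : + 2 * B * (F.#orb I + V.#orb surrounded) - B * D ≡ k' - + 2 * X - + 2 * Y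
      region-count = combine (F.#orb I) (V.#orb surrounded) B D k' X Y IIx IIy faces vertices edges
        where
        alg : ∀ r b d k x y g → (((d + k) - + 2 * (g + y)) + + 2 * b * r) - b * d
            ≡ (k - + 2 * x - + 2 * y) + (+ 2 * ((b * r + x) - g) - (b - 1ℤ) * d)
        alg = solve-∀
        distrib : ∀ b f r d → + 2 * b * (f + r) - b * d ≡ (+ 2 * b * f + + 2 * b * r) - b * d
        distrib = solve-∀
        combine : ∀ f r b d k x y p g → d + k - + 2 * (g + y) ≡ + 2 * b * f → p ≡ b * r + x →
          + 2 * (p - g) ≡ (b - 1ℤ) * d → + 2 * b * (f + r) - b * d ≡ k - + 2 * x - + 2 * y
        combine f r b d k x y p g e₁ refl e₃ = trans (distrib b f r d)
          (trans (cong (λ z → (z + + 2 * b * r) - b * d) (sym e₁)) (trans (alg r b d k x y g)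
            (trans (cong (λ z → (k - + 2 * x - + 2 * y) + (z - (b - 1ℤ) * d)) e₃)
              (trans (cong (_+_ (k - + 2 * x - + 2 * y)) (ℤₚ.+-inverseʳ ((b - 1ℤ) * d))) (ℤₚ.+-identityʳ _)))))

-- Orientations force long cycles

module GirthBound {n : ℕ} (PM : PlaneMap n) (b : ℕ) (w : ZBiorientation n) (ori : IsBOrientation PM w b)
  (even : ∀ h → + PlaneMap.faceDeg PM h ≡ + 2 * + (PlaneMap.faceDeg PM h DM./ 2)) where
  open PlaneMap PM
  open Regions PM
  open Oriented b w ori even

  private
    𝟙-∨-split : ∀ a b → 𝟙 (a ∨ b) ≡ 𝟙 a * 𝟙 b + 𝟙 a * (1ℤ - 𝟙 b) + 𝟙 b * (1ℤ - 𝟙 a)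
    𝟙-∨-split true  true  = refl
    𝟙-∨-split true  false = refl
    𝟙-∨-split false true  = refl
    𝟙-∨-split false false = refl

    𝟙-∨-≤ : ∀ a b → 𝟙 (a ∨ b) ≤ 𝟙 a + 𝟙 b
    𝟙-∨-≤ true  true  = +≤+ (s≤s z≤n)
    𝟙-∨-≤ true  false = ℤₚ.≤-refl
    𝟙-∨-≤ false true  = ℤₚ.≤-refl
    𝟙-∨-≤ false false = ℤₚ.≤-refl

  -- I is the region enclosed by the cycle.
  module Enclosed {k : ℕ} {c : Fin k → Fin n} (cyc : IsCycle k c)
    (q : Fin n → ℤ) (q-φ : ∀ h → q (φ h) ≡ q h) (q-off : ∀ g → OffCycle cyc g → q (α g) ≡ q g)
    (q-on : ∀ i → q (α (c i)) ≡ q (c i) + 1ℤ)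
    (O : Fin n → Bool) (dO : Decides (FF.Connected (F.in? root) (OffCycle cyc)) O) where

    open Decides dO

    I bd H R : Fin n → Bool
    I h = not (O h)

    O-~ : ∀ {g h} → g F.~ h → O g ≡ true → O h ≡ true
    O-~ e o = complete (proj₁ (sound o) , FF.Conn-~ (in?-invariant-F root) e (proj₂ (sound o)))

    I-φ : F.Invariant I
    I-φ h = cong not (⇔⇒≡ (O-~ (F.~-sym F.~-π)) (O-~ F.~-π))

    I-root : I root ≡ false
    I-root = cong not (complete (0 , FF.at (F.in?-true F.~-refl)))

    open Region I I-φ I-root
    open RegionCount I I-φ I-root

    bd h = I h ∧ not (I (α h))
    H h = I h ∨ I (α h)
    R h = surrounded h ∨ touch bd h

    q-O : ∀ {ℓ h} → FF.Conn (F.in? root) (OffCycle cyc) ℓ h → q h ≡ q root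
    q-O (FF.at e)        = sym (F.~-invariant q-φ (F.in?-sound e))
    q-O (FF.cross {g = g} c x e) = trans (sym (F.~-invariant q-φ e)) (trans (q-off g x) (q-O c))

    bd-true : ∀ {h} → I h ≡ true → I (α h) ≡ false → bd h ≡ true
    bd-true a b = cong₂ (λ x y → x ∧ not y) a b

    on-cycle : ∀ h → I h ≡ true → I (α h) ≡ false → ∃[ i ] ((h ≡ c i) ⊎ (h ≡ α (c i)))
    on-cycle h Ih Iαh with Finₚ.any? (λ i → (h Finₚ.≟ c i) ⊎-dec (h Finₚ.≟ α (c i)))
    ... | yes found = found
    ... | no none = ⊥-elim (true≢false (subst (λ x → O x ≡ true) (α-invol h)
            (complete (_ , FF.cross (proj₂ (sound (not-false Iαh))) off F.~-refl))) (not-true Ih))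
      where
      off : OffCycle cyc (α h)
      off i = (λ e → none (i , inj₂ (trans (sym (α-invol h)) (cong α e)))) ,
              (λ e → none (i , inj₁ (trans (sym (α-invol h)) (trans (cong α e) (α-invol (c i))))))

    -- By `on-cycle` a boundary edge lies on the cycle, and only one of its two half-edges has `I`
    -- on its right.
    k'≤k : k' ≤ + k
    k'≤k = ℤₚ.≤-trans (sum-≤ hit) (ℤₚ.≤-trans (ℤₚ.≤-reflexive (sum-swap _)) (ℤₚ.≤-trans (sum-≤ column) (ℤₚ.≤-reflexive (sum-1 k))))
      where
      hits : Fin n → Fin k → ℤ
      hits h i = 𝟙 (h ≡ᵇ c i) * side h + 𝟙 (h ≡ᵇ α (c i)) * side h
      0≤hits : ∀ h i → 0ℤ ≤ hits h i
      0≤hits h i = (0≤𝟙 (h ≡ᵇ c i) ⊠ 0≤side h) ⊞ (0≤𝟙 (h ≡ᵇ α (c i)) ⊠ 0≤side h)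
      hit-at : ∀ h i → (h ≡ c i) ⊎ (h ≡ α (c i)) → side h ≤ hits h i
      hit-at h i (inj₁ e) = ≤-by (0≤𝟙 (h ≡ᵇ α (c i)) ⊠ 0≤side h) (trans (arrange (side h) _)
          (cong (λ t → (𝟙 t * side h + 𝟙 (h ≡ᵇ α (c i)) * side h) - side h) (sym (⌊⌋-true (h Finₚ.≟ c i) e))))
        where
        arrange : ∀ s z → z ≡ (1ℤ * s + z) - s
        arrange = solve-∀
      hit-at h i (inj₂ e) = ≤-by (0≤𝟙 (h ≡ᵇ c i) ⊠ 0≤side h) (trans (arrange (side h) _)
          (cong (λ t → (𝟙 (h ≡ᵇ c i) * side h + 𝟙 t * side h) - side h) (sym (⌊⌋-true (h Finₚ.≟ α (c i)) e))))
        where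
        arrange : ∀ s z → z ≡ (z + 1ℤ * s) - s
        arrange = solve-∀
      hit : ∀ h → side h ≤ ∑ (hits h)
      hit h = cases (bool (I h)) (bool (I (α h)))
        where
        vanish : side h ≡ 0ℤ → side h ≤ ∑ (hits h)
        vanish e = subst (_≤ ∑ (hits h)) (sym e) (sum-nonneg (0≤hits h))
        cases : (I h ≡ true) ⊎ (I h ≡ false) → (I (α h) ≡ true) ⊎ (I (α h) ≡ false) → side h ≤ ∑ (hits h)
        cases (inj₂ f) _ = vanish (cong (λ b → 𝟙 b * (1ℤ - 𝟙 (I (α h)))) f)
        cases _ (inj₁ t) = vanish (trans (cong (λ b → 𝟙 (I h) * (1ℤ - 𝟙 b)) t) (ℤₚ.*-zeroʳ (𝟙 (I h))))
        cases (inj₁ t) (inj₂ f) with on-cycle h t f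
        ... | i , e = ℤₚ.≤-trans (hit-at h i e) (term≤sum (0≤hits h) i)
      one-side : ∀ a b → 𝟙 a * (1ℤ - 𝟙 b) + 𝟙 b * (1ℤ - 𝟙 a) ≤ 1ℤ
      one-side true  true  = +≤+ z≤n
      one-side true  false = ℤₚ.≤-refl
      one-side false true  = ℤₚ.≤-refl
      one-side false false = +≤+ z≤n
      column : ∀ i → ∑ (λ h → hits h i) ≤ 1ℤ
      column i = ℤₚ.≤-trans (ℤₚ.≤-reflexive (trans (sum-+ _ _) (cong₂ _+_ (sum-pick side (c i)) (sum-pick side (α (c i))))))
        (subst (λ g → side (c i) + 𝟙 (I (α (c i))) * (1ℤ - 𝟙 (I g)) ≤ 1ℤ) (sym (α-invol (c i))) (one-side (I (c i)) (I (α (c i)))))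

    H-α : ∀ h → H (α h) ≡ H h
    H-α h = trans (cong (λ g → I (α h) ∨ I g) (α-invol h)) (Boolₚ.∨-comm (I (α h)) (I h))

    R-σ : V.Invariant R
    R-σ h = cong₂ _∨_ (surrounded-σ h) (touch-σ h)

    I⇒R : ∀ {h g} → h V.~ g → I g ≡ true → R h ≡ true
    I⇒R {h} {g} e Ig = [ ∨-introˡ , (λ f → case boundary-at Ig (trans (sym (surrounded-~ e)) f) of λ
      { (g' , e' , a , b) → ∨-introʳ {surrounded h} (touch-true g' (V.~-trans e e') (bd-true a b)) }) ]′ (bool (surrounded h))

    H⇒R : ∀ h → H h ≡ true → R h ≡ true
    H⇒R h e = [ I⇒R V.~-refl , (λ t → I⇒R V.~-π (trans (I-σ h) t)) ]′ (∨-elim e)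

    convert : ∀ {ℓ h} → FF.Conn (F.in? root) (OffCycle cyc) ℓ h → FF.Conn (F.in? root) (λ g → H g ≡ false) ℓ h
    convert (FF.at e)        = FF.at e
    convert (FF.cross c x e) = FF.cross (convert c) (∨-false (cong not (complete (_ , c))) (cong not (complete (_ , FF.cross c x F.~-refl)))) e

    -- The potential of the cycle has its root value on all of `O` but jumps across `c i`, so the
    -- two sides of `c i` are not both in `O`. This shows that the subgraph is not empty.
    edge-on-cycle : ∀ i → H (c i) ≡ true
    edge-on-cycle i = [ (λ t → t) , (λ f → ⊥-elim (absurd (trans (sym (q-at (c i) (both-out f))) (q-at-α f)))) ]′ (bool (H (c i)))
      where
      both-out : H (c i) ≡ false → O (c i) ≡ true
      both-out f = [ (λ t → t) , (λ o → ⊥-elim (true≢false (∨-introˡ {b = I (α (c i))} (cong not o)) f)) ]′ (bool (O (c i)))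
      both-out' : H (c i) ≡ false → O (α (c i)) ≡ true
      both-out' f = [ (λ t → t) , (λ o → ⊥-elim (true≢false (∨-introʳ {I (c i)} (cong not o)) f)) ]′ (bool (O (α (c i))))
      q-at : ∀ h → O h ≡ true → q h ≡ q root
      q-at h o = q-O (proj₂ (sound o))
      q-at-α : H (c i) ≡ false → q (c i) ≡ q root - 1ℤ
      q-at-α f = trans (back (q (c i))) (cong (_- 1ℤ) (trans (sym (q-on i)) (q-at (α (c i)) (both-out' f))))
        where
        back : ∀ z → z ≡ (z + 1ℤ) - 1ℤ
        back = solve-∀
      absurd : ∀ {z} → z ≡ z - 1ℤ → ⊥
      absurd {z} e = ℤₚ.<-irrefl {0ℤ} {1ℤ} (trans (sym (ℤₚ.+-inverseʳ z)) (trans (cong (_-_ z) e) (cancel z))) (+<+ (s≤s z≤n))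
        where
        cancel : ∀ z → z - (z - 1ℤ) ≡ 1ℤ
        cancel = solve-∀

    sum-H : ∑ (λ h → 𝟙 (H h)) ≡ D + k' + k'
    sum-H = trans (sum-cong (λ h → 𝟙-∨-split (I h) (I (α h)))) (trans (sum-+ _ _) (cong₂ _+_ (sum-+ _ _) sum-side-α))

    -- A vertex on the border is charged to a boundary half-edge at it.
    count-R : V.#orb R ≤ V.#orb surrounded + k'
    count-R = ℤₚ.≤-trans (ℤₚ.≤-trans (sum-≤ (λ r → 𝟙-*-mono (V.min? r) (λ _ → 𝟙-∨-≤ (surrounded r) (touch bd r))))
        (ℤₚ.≤-reflexive (trans (sum-cong (λ r → ℤₚ.*-distribˡ-+ (𝟙 (V.min? r)) _ _)) (sum-+ _ _))))
      (ℤₚ.+-monoʳ-≤ (V.#orb surrounded) (ℤₚ.≤-trans (sum-≤ (λ r → 𝟙-*-mono (V.min? r) (λ _ → at-least r (bool (touch bd r)))))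
        (ℤₚ.≤-reflexive (trans (sym (V.sum-by-orbits {λ _ → true} (λ _ → refl) side)) (sum-cong (λ h → ℤₚ.*-identityˡ _))))))
      where
      at-least : ∀ r → (touch bd r ≡ true) ⊎ (touch bd r ≡ false) → 𝟙 (touch bd r) ≤ 1ℤ * V.osum side r
      at-least r (inj₂ f) = subst (λ b → 𝟙 b ≤ 1ℤ * V.osum side r) (sym f) (subst (0ℤ ≤_) (sym (ℤₚ.*-identityˡ _)) (V.osum-nonneg r 0≤side))
      at-least r (inj₁ t) with touch-sound t
      ... | g , e , bdg = ℤₚ.≤-trans (𝟙≤1 (touch bd r)) (subst (1ℤ ≤_) (sym (ℤₚ.*-identityˡ _))
            (subst (_≤ V.osum side r) (side≡1 (proj₁ (∧-true bdg)) (not-true (proj₂ (∧-true {I g} bdg)))) (V.term≤osum 0≤side e)))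

    bound : + 2 * B ≤ + k
    bound = ℤₚ.≤-trans (≤-by ((0≤+ {b} ⊠ slack) ⊞ (0≤+ {2} ⊠ 0≤X) ⊞ (0≤+ {2} ⊠ 0≤Y))
        (arrange (F.#orb I) (V.#orb surrounded) B D k' X Y region-count)) k'≤k
      where
      i₀ : Fin k
      i₀ = Fin.fromℕ< (IsCycle.nonempty cyc)
      euler' : (D + k' + k') + + 4 ≤ + 2 * (1ℤ + F.#orb I) + + 2 * V.#orb R
      euler' = subst (λ z → z + + 4 ≤ + 2 * (1ℤ + F.#orb I) + + 2 * V.#orb R) sum-H
        (euler-region {H} {R} H-α R-σ H⇒R (λ h f → _ , convert (proj₂ (sound (not-false f))))
          (c i₀ , H⇒R (c i₀) (edge-on-cycle i₀)))
      -- Euler's relation once the boundary edges have cancelled against the border vertices.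
      slack : 0ℤ ≤ + 2 * F.#orb I + + 2 * V.#orb surrounded - D - + 2
      slack = subst (0ℤ ≤_) (arrange' D k' (F.#orb I) (V.#orb R) (V.#orb surrounded)) (gap euler' ⊞ (0≤+ {2} ⊠ gap count-R))
        where
        arrange' : ∀ d k f r s → (+ 2 * (1ℤ + f) + + 2 * r) - ((d + k + k) + + 4) + + 2 * ((s + k) - r) ≡ + 2 * f + + 2 * s - d - + 2
        arrange' = solve-∀
      arrange : ∀ f s b d k x y → + 2 * b * (f + s) - b * d ≡ k - + 2 * x - + 2 * y →
        b * (+ 2 * f + + 2 * s - d - + 2) + + 2 * x + + 2 * y ≡ k - + 2 * b
      arrange f s b d k x y e = trans (go f s b d x y) (trans (cong (λ z → (z + + 2 * x + + 2 * y) - + 2 * b) e) (go' k x y b))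
        where
        go : ∀ f s b d x y → b * (+ 2 * f + + 2 * s - d - + 2) + + 2 * x + + 2 * y ≡ ((+ 2 * b * (f + s) - b * d) + + 2 * x + + 2 * y) - + 2 * b
        go = solve-∀
        go' : ∀ k x y b → ((k - + 2 * x - + 2 * y) + + 2 * x + + 2 * y) - + 2 * b ≡ k - + 2 * b
        go' = solve-∀

  cycle-bound : ∀ {k c} → IsCycle k c → 2 ℕ.* b ℕ.≤ k
  cycle-bound {k} {c} cyc = ℤₚ.drop‿+≤+ (subst (_≤ + k) (sym (ℤₚ.pos-* 2 b)) (decidable-stable (_ ℤ.≤? _) (do
    (q , q-φ , q-off , q-on) ← jordan cyc root
    (O , dO) ← classify (FF.Connected (F.in? root) (OffCycle cyc))
    return (Enclosed.bound cyc q q-φ q-off q-on O dO))))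

-- Parity of face degrees

module _ {n : ℕ} (M : PlanarMap n) where
  open PlanarMap M
  open Planar M

  -- The colours alternate along a face.
  even-degree : Bipartite → ∀ h → + faceDeg h ≡ + 2 * + (faceDeg h DM./ 2)
  even-degree (col , col-σ , col-α) h = trans deg (cong (λ z → + 2 * + z) (sym half))
    where
    s : Fin n → ℤ
    s g = 𝟙 (col g)
    flip : ∀ a b → a ≢ b → 𝟙 a ≡ 1ℤ - 𝟙 b
    flip true  true  ≢ = ⊥-elim (≢ refl)
    flip true  false ≢ = refl
    flip false true  ≢ = refl
    flip false false ≢ = ⊥-elim (≢ refl)
    s-φ : ∀ g → s (φ g) ≡ 1ℤ - s g
    s-φ g = trans (cong 𝟙 (col-σ (α g))) (flip _ _ (col-α g))
    S = F.osum s h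
    m = ∣ S ∣
    S≡ : + m ≡ S
    S≡ = ℤₚ.0≤i⇒+∣i∣≡i (F.osum-nonneg h (λ g → 0≤𝟙 (col g)))
    alternate : S ≡ + faceDeg h - S
    alternate = trans (sym (F.osum-π s h)) (trans (F.osum-cong (λ g _ → s-φ g)) (trans (F.osum-minus (λ _ → 1ℤ) s h) (cong (_- S) (F.osum-1 h))))
    deg : + faceDeg h ≡ + 2 * + m
    deg = trans (arrange (+ faceDeg h) S) (trans (cong (λ z → z + S) (sym alternate)) (trans (double S) (cong (_*_ (+ 2)) (sym S≡))))
      where
      arrange : ∀ d s → d ≡ (d - s) + s
      arrange = solve-∀
      double : ∀ s → s + s ≡ + 2 * s
      double = solve-∀
    half : faceDeg h DM./ 2 ≡ m
    half = trans (cong (DM._/ 2) (trans (ℤₚ.+-injective (trans deg (sym (ℤₚ.pos-* 2 m)))) (ℕₚ.*-comm 2 m))) (DM.m*n/n≡m m 2)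

-- The outer contour is a simple cycle

module Contour {n : ℕ} (PM : PlaneMap n) (b : ℕ) (deg : PlaneMap.outerDeg PM ≡ 2 ℕ.* b)
  (girth : PlaneMap.HasGirth PM (2 ℕ.* b)) where
  open PlaneMap PM
  open Regions PM

  rt : Fin n → Bool
  rt = F.in? root

  rt-φ : F.Invariant rt
  rt-φ = in?-invariant-F root

  sum-rt : ∑ (λ h → 𝟙 (rt h)) ≡ + 2 * + b
  sum-rt = trans (sum-cong (λ h → sym (ℤₚ.*-identityʳ _))) (trans (F.osum-1 root) (trans (cong +_ deg) (ℤₚ.pos-* 2 b)))

  opaque
    -- If no edge separated the root face from another face, it would be the only face and the
    -- potential of a cycle would be constant; but the girth provides a cycle, across which the
    -- potential jumps.
    exit : ∃[ h ] (rt h ≡ true × rt (α h) ≡ false)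
    exit = decidable-stable (Finₚ.any? (λ h → (rt h Boolₚ.≟ true) ×-dec (rt (α h) Boolₚ.≟ false))) (do
      (q , q-φ , _ , q-on) ← jordan cyc root
      λ none → absurd q q-φ q-on none)
      where
      c : Fin (2 ℕ.* b) → Fin n
      c = proj₁ (proj₁ girth)
      cyc : IsCycle (2 ℕ.* b) c
      cyc = proj₂ (proj₁ girth)
      i₀ : Fin (2 ℕ.* b)
      i₀ = Fin.fromℕ< (IsCycle.nonempty cyc)
      absurd : ∀ (q : Fin n → ℤ) → (∀ h → q (φ h) ≡ q h) → (∀ i → q (α (c i)) ≡ q (c i) + 1ℤ) →
        ¬ (∃[ h ] (rt h ≡ true × rt (α h) ≡ false)) → ⊥
      absurd q q-φ q-on none = ℤₚ.<-irrefl {0ℤ} {1ℤ} (trans (sym (ℤₚ.+-inverseʳ (q (c i₀))))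
          (trans (cong (_- q (c i₀)) (trans (q-const (c i₀)) (trans (sym (q-const (α (c i₀)))) (q-on i₀)))) (cancel (q (c i₀))))) (+<+ (s≤s z≤n))
        where
        cancel : ∀ z → (z + 1ℤ) - z ≡ 1ℤ
        cancel = solve-∀
        up : ∀ h → rt h ≡ true → rt (α h) ≡ true
        up h t = [ (λ e → e) , (λ f → ⊥-elim (none (h , t , f))) ]′ (bool (rt (α h)))
        rt-α : ∀ h → rt (α h) ≡ rt h
        rt-α h = ⇔⇒≡ (λ t → subst (λ x → rt x ≡ true) (α-invol h) (up (α h) t)) (up h)
        rt-σ : ∀ h → rt (σ h) ≡ rt h
        rt-σ h = trans (F.in?-congʳ (F.~-sym α-face-σ)) (rt-α h)
        everything : ∀ h → rt h ≡ true
        everything = all-half-edges rt-σ rt-α (F.in?-true (F.~-refl {root}))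
        q-const : ∀ h → q h ≡ q root
        q-const h = sym (F.~-invariant q-φ (F.in?-sound (everything h)))

  private
    Boundary : Set
    Boundary = ∃[ k ] Σ (Fin k → Fin n) λ c → IsCycle k c × (∀ i → (rt (c i) ≡ true) × (rt (α (c i)) ≡ false))

  opaque
    boundary : Boundary
    boundary = boundary-cycle rt-φ (proj₁ (proj₂ exit)) (proj₂ (proj₂ exit))

  -- The boundary cycle of the root face is no longer than the root face, hence passes through all of it.
  private
    k : ℕ
    k = proj₁ boundary
    c : Fin k → Fin n
    c = proj₁ (proj₂ boundary)
    cyc : IsCycle k c
    cyc = proj₁ (proj₂ (proj₂ boundary))
    c-rt : ∀ i → (rt (c i) ≡ true) × (rt (α (c i)) ≡ false)
    c-rt = proj₂ (proj₂ (proj₂ boundary))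

  hits≤ : ∀ {k c} → IsCycle k c → (A : Fin n → Bool) → (∀ i → A (c i) ≡ true) → ∀ h → ∑ (λ i → 𝟙 (h ≡ᵇ c i)) ≤ 𝟙 (A h)
  hits≤ {k} {c} cyc A Ac h with Finₚ.any? (λ i → h Finₚ.≟ c i)
  ... | no none = ℤₚ.≤-trans (ℤₚ.≤-reflexive (sum-zero (λ i → cong 𝟙 (≡ᵇ-false (λ e → none (i , e)))))) (0≤𝟙 (A h))
  ... | yes (i , refl) = ℤₚ.≤-trans (ℤₚ.≤-reflexive (sum-single i (λ j j≢i → cong 𝟙 (≡ᵇ-false (λ e → j≢i
          (sym (IsCycle.vDistinct cyc i j (V.~-reflexive e)))))))) (ℤₚ.≤-trans (𝟙≤1 _) (ℤₚ.≤-reflexive (cong 𝟙 (sym (Ac i)))))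

  sum-hits : ∀ {k} (c : Fin k → Fin n) → ∑ (λ h → ∑ (λ i → 𝟙 (h ≡ᵇ c i))) ≡ + k
  sum-hits {k} c = trans (sum-swap _) (trans (sum-cong (λ i → trans (sum-cong (λ h → sym (ℤₚ.*-identityʳ _))) (sum-pick (λ _ → 1ℤ) (c i)))) (sum-1 k))

  private
    covered : ∀ h → rt h ≡ true → ∃[ i ] (h ≡ c i)
    covered h t with Finₚ.any? (λ i → h Finₚ.≟ c i)
    ... | yes found = found
    ... | no none = ⊥-elim (ℤₚ.<-irrefl {0ℤ} {1ℤ} (sym (trans (cong 𝟙 (sym t)) (trans (ℤₚ.i-j≡0⇒i≡j _ _ (tight h))
        (sum-zero (λ i → cong 𝟙 (≡ᵇ-false (λ e → none (i , e)))))))) (+<+ (s≤s z≤n)))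
      where
      slack : ∀ h → 0ℤ ≤ 𝟙 (rt h) - ∑ (λ i → 𝟙 (h ≡ᵇ c i))
      slack h = gap (hits≤ cyc rt (λ i → proj₁ (c-rt i)) h)
      tight : ∀ h → 𝟙 (rt h) - ∑ (λ i → 𝟙 (h ≡ᵇ c i)) ≡ 0ℤ
      tight = sum≡0⇒term≡0 slack (ℤₚ.≤-antisym
        (ℤₚ.≤-trans (ℤₚ.≤-reflexive (trans (sum-minus _ _) (cong₂ _-_ (trans sum-rt (sym (ℤₚ.pos-* 2 b))) (sum-hits c))))
          (ℤₚ.i≤j⇒i-j≤0 (+≤+ (proj₂ girth k c cyc))))
        (sum-nonneg slack))

  outer-α : ∀ {h} → rt h ≡ true → rt (α h) ≡ false
  outer-α {h} t with covered h t
  ... | i , refl = proj₂ (c-rt i)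

  outer-unique : ∀ {g h} → rt g ≡ true → rt h ≡ true → g V.~ h → g ≡ h
  outer-unique {g} {h} tg th e with covered g tg | covered h th
  ... | i , refl | j , refl = cong c (IsCycle.vDistinct cyc i j e)

  contour-next : ∀ i → φ (contour i) ≡ contour (next i)
  contour-next i = go outerDeg (sym (F.period≡size root)) i
    where
    -- The number of sides is generalised so that it can be replaced by `F.period root`, a visible
    -- successor on which `next` computes.
    go : ∀ k → k ≡ F.period root → (i : Fin k) → iter φ (suc (toℕ i)) root ≡ iter φ (toℕ (next i)) root
    go .(F.period root) refl i with toℕ i ℕₚ.≟ ℕ.pred (F.period root)
    ... | yes e = trans (cong (λ t → iter φ (suc t) root) e) (trans (F.iter-period root) (cong (λ t → iter φ t root) (sym (next-last i e))))
    ... | no ≢ = cong (λ t → iter φ t root) (sym (next-< i (ℕₚ.≤∧≢⇒< (ℕ.s≤s⁻¹ (Finₚ.toℕ<n i)) ≢)))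

  contour-rt : ∀ i → rt (contour i) ≡ true
  contour-rt i = F.in?-true (toℕ i , refl)

  contour-injective : ∀ i j → contour i ≡ contour j → i ≡ j
  contour-injective i j e = Finₚ.toℕ-injective (F.iter-injective< (bound i) (bound j) e)
    where
    bound : ∀ (i : Fin outerDeg) → toℕ i ℕ.< F.period root
    bound i = subst (toℕ i ℕ.<_) (sym (F.period≡size root)) (Finₚ.toℕ<n i)

  contour-onto : ∀ {h} → rt h ≡ true → ∃[ i ] (h ≡ contour i)
  contour-onto {h} t with F.~-bounded (F.in?-sound t)
  ... | j , j< , refl = Fin.fromℕ< lt , cong (λ t → iter φ t root) (sym (Finₚ.toℕ-fromℕ< lt))
    where lt = subst (j ℕ.<_) (F.period≡size root) j<

  contour-closed : ∀ i → α (contour i) V.~ contour (next i)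
  contour-closed i = V.~-trans α-vertex-φ (V.~-reflexive (contour-next i))

  contour-cycle : IsCycle outerDeg contour
  contour-cycle = record
    { nonempty = subst (1 ℕ.≤_) (F.period≡size root) (s≤s z≤n)
    ; closed = contour-closed
    ; vDistinct = λ i j e → contour-injective i j (outer-unique (contour-rt i) (contour-rt j) e)
    ; eDistinct = λ i j i≢j → (λ e → i≢j (contour-injective i j (sym e))) ,
        λ e → true≢false (contour-rt j) (trans (cong rt e) (outer-α (contour-rt i)))
    }

  outerV : Fin n → Bool
  outerV = touch rt

  outerV-sound : ∀ {h} → outerV h ≡ true → OuterVertex h
  outerV-sound t with touch-sound t
  ... | g , e , r = g , e , F.in?-sound r

  outerV-true : ∀ {h} → OuterVertex h → outerV h ≡ true
  outerV-true (g , e , r) = touch-true g e (F.in?-true r)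

  rt⇒outerV : ∀ {h} → rt h ≡ true → outerV h ≡ true
  rt⇒outerV t = touch-true _ V.~-refl t

  outerV-α : ∀ {h} → rt (α h) ≡ true → outerV h ≡ true
  outerV-α {h} t = touch-true (σ h) V.~-π (trans (F.in?-congʳ (F.~-sym α-face-σ)) t)

  outerV-root-α : ∀ {h} → rt h ≡ true → outerV (α h) ≡ true
  outerV-root-α {h} t = outerV-α (trans (cong rt (α-invol h)) t)

  -- By `outer-unique` each outer vertex has a single half-edge with the root face on its right, and
  -- there are `2b` of these.
  #outerV : V.#orb outerV ≡ + 2 * + b
  #outerV = trans (sym (ℤₚ.*-identityˡ _)) (trans (sym (V.#orb-* touch-σ 1ℤ (λ h → 𝟙 (rt h)) one))
    (trans (sum-cong (λ h → absorb h (bool (rt h)))) sum-rt))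
    where
    absorb : ∀ h → (rt h ≡ true) ⊎ (rt h ≡ false) → 𝟙 (outerV h) * 𝟙 (rt h) ≡ 𝟙 (rt h)
    absorb h (inj₁ t) = trans (cong (λ b → 𝟙 b * 𝟙 (rt h)) (rt⇒outerV t)) (ℤₚ.*-identityˡ _)
    absorb h (inj₂ f) = trans (cong (λ b → 𝟙 (outerV h) * 𝟙 b) f) (trans (ℤₚ.*-zeroʳ (𝟙 (outerV h))) (cong 𝟙 (sym f)))
    one : ∀ h → outerV h ≡ true → V.osum (λ g → 𝟙 (rt g)) h ≡ 1ℤ
    one h t with touch-sound t
    ... | g , e , r = trans (sum-single g (λ g' g'≢g → trans (𝟙-*-cong (V.in? h g') (λ i → cong 𝟙 (¬true⇒false (λ r' →
              g'≢g (outer-unique r' r (V.~-trans (V.~-sym (V.in?-sound i)) e)))))) (ℤₚ.*-zeroʳ (𝟙 (V.in? h g')))))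
            (cong₂ (λ a b → 𝟙 a * 𝟙 b) (V.in?-true e) r)

  innerE : Fin n → Bool
  innerE h = not (rt h ∨ rt (α h))

  innerE-α : ∀ h → innerE (α h) ≡ innerE h
  innerE-α h = cong not (trans (cong (λ g → rt (α h) ∨ rt g) (α-invol h)) (Boolₚ.∨-comm (rt (α h)) (rt h)))

  innerE-sound : ∀ {h} → innerE h ≡ true → InnerHE h
  innerE-sound {h} e (inj₁ r) = true≢false (∨-introˡ {b = rt (α h)} (F.in?-true r)) (not-true e)
  innerE-sound {h} e (inj₂ r) = true≢false (∨-introʳ {rt h} (F.in?-true r)) (not-true e)

  innerE-true : ∀ {h} → InnerHE h → innerE h ≡ true
  innerE-true {h} ih = cong not (∨-false (F.in?-false (ih ∘ inj₁)) (F.in?-false (ih ∘ inj₂)))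

  innerE-false : ∀ {h} → innerE h ≡ false → (rt h ≡ true) ⊎ (rt (α h) ≡ true)
  innerE-false e = ∨-elim (not-false e)

  𝟙-innerE : ∀ h → 𝟙 (innerE h) ≡ 1ℤ - (𝟙 (rt h) + 𝟙 (rt (α h)))
  𝟙-innerE h = trans (𝟙-not (rt h ∨ rt (α h))) (cong (_-_ 1ℤ) (𝟙-∨ (λ a a' → true≢false a' (outer-α a))))

-- Hall's condition for the star map

module Hall {n : ℕ} (PM : PlaneMap n) (b : ℕ) (deg : PlaneMap.outerDeg PM ≡ 2 ℕ.* b)
  (girth : PlaneMap.HasGirth PM (2 ℕ.* b)) where
  open PlaneMap PM
  open Regions PM
  open Contour PM b deg girth

  B : ℤ
  B = + b

  0≤B : 0ℤ ≤ B
  0≤B = 0≤+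

  0≤2B : 0ℤ ≤ + 2 * B
  0≤2B = 0≤+ {2} ⊠ 0≤B

  -- The faces of the subgraph with edge set H are classes of faces; each class
  -- is bounded by a cycle, so it has at least 2b sides in H.
  module Classes (H : Fin n → Bool) (H-α : ∀ h → H (α h) ≡ H h) (H-outer : ∀ {h} → rt h ≡ true → H h ≡ true) where

    OffH : Fin n → Set
    OffH g = H g ≡ false

    Linked : Fin n → Fin n → Set
    Linked g h = FF.Connected (F.in? g) OffH h

    link-~ : ∀ {g h} → g F.~ h → Linked g h
    link-~ e = 0 , FF.at (F.in?-true e)

    link-α : ∀ {g h} → OffH h → Linked g h → Linked g (α h)
    link-α x (ℓ , c) = suc ℓ , FF.cross c x F.~-refl

    link-∘~ : ∀ {g h h'} → h F.~ h' → Linked g h → Linked g h'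
    link-∘~ e (ℓ , c) = ℓ , FF.Conn-~ (in?-invariant-F _) e c

    link-trans : ∀ {f g h} → Linked f g → Linked g h → Linked f h
    link-trans l (_ , FF.at e)        = link-∘~ (F.in?-sound e) l
    link-trans l (_ , FF.cross c x e) = link-∘~ e (link-α x (link-trans l (_ , c)))

    link-sym : ∀ {g h} → Linked g h → Linked h g
    link-sym (_ , FF.at e) = link-~ (F.~-sym (F.in?-sound e))
    link-sym (_ , FF.cross {g = g'} c x e) = link-trans
      (subst (Linked _) (α-invol g') (link-α (trans (H-α g') x) (link-~ (F.~-sym e)))) (link-sym (_ , c))

    -- A class is named by its least half-edge. This is also the least one of its own face, so
    -- `main`, which keeps that face only, has one root per class.
    record Labelling : Set where
      field
        cl      : Fin n → Fin n
        linked  : ∀ h → Linked h (cl h)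
        minimal : ∀ {h g} → Linked h g → toℕ (cl h) ℕ.≤ toℕ g

      cl-cong : ∀ {g h} → Linked g h → cl g ≡ cl h
      cl-cong {g} {h} l = Finₚ.toℕ-injective (ℕₚ.≤-antisym
        (minimal (link-trans l (linked h))) (minimal (link-trans (link-sym l) (linked g))))

      cl-φ : F.Invariant cl
      cl-φ h = cl-cong (link-~ (F.~-sym F.~-π))

      cl-idem : ∀ h → cl (cl h) ≡ cl h
      cl-idem h = sym (cl-cong (linked h))

      cl-min : ∀ h → F.min? (cl h) ≡ true
      cl-min h = F.min?-true (λ e → minimal (link-∘~ e (linked h)))

      main : Fin n → Bool
      main h = F.in? (cl h) h

      main-φ : F.Invariant main
      main-φ h = trans (cong (λ c → F.in? c (φ h)) (cl-φ h)) (F.in?-congʳ (F.~-sym F.~-π))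

      reach : ∀ h → FF.Connected main OffH h
      reach h = weaken (link-sym (linked h))
        where
        weaken : ∀ {h'} → Linked (cl h) h' → FF.Connected main OffH h'
        weaken {h'} (_ , FF.at e) = 0 , FF.at (trans (cong (λ c → F.in? c h')
          (trans (sym (cl-cong (link-~ (F.in?-sound e)))) (cl-idem h))) e)
        weaken (_ , FF.cross c x e) = _ , FF.cross (proj₂ (weaken (_ , c))) x e

      #main : F.#orb main ≡ ∑ (λ c → 𝟙 (cl c ≡ᵇ c))
      #main = sum-cong (λ r → trans (sym (𝟙-∧ (F.min? r) (main r))) (cong 𝟙 (⇔⇒≡ (to r) (from r))))
        where
        to : ∀ r → F.min? r ∧ main r ≡ true → (cl r ≡ᵇ r) ≡ true
        to r e = ⌊⌋-true (_ Finₚ.≟ _) (F.min?-unique (cl-min r) (proj₁ (∧-true e)) (F.in?-sound (proj₂ (∧-true {F.min? r} e))))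
        from : ∀ r → (cl r ≡ᵇ r) ≡ true → F.min? r ∧ main r ≡ true
        from r e = cong₂ _∧_ (subst (λ c → F.min? c ≡ true) (≡ᵇ-sound e) (cl-min r)) (F.in?-true (F.~-reflexive (≡ᵇ-sound e)))

    labelling : ¬ ¬ Labelling
    labelling = do
      s ← ¬¬-∀ {P = λ h → ∃[ t ] ((∃[ g ] (toℕ g ≡ t × Linked h g)) × (∀ j → j ℕ.< t → ¬ (∃[ g ] (toℕ g ≡ j × Linked h g))))}
            (λ h → ¬¬-least (λ t → ∃[ g ] (toℕ g ≡ t × Linked h g)) (toℕ h , h , refl , link-~ F.~-refl))
      return (record
        { cl = λ h → proj₁ (proj₁ (proj₂ (s h)))
        ; linked = λ h → proj₂ (proj₂ (proj₁ (proj₂ (s h))))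
        ; minimal = λ {h} {g} l → ℕₚ.≮⇒≥ (λ lt → proj₂ (proj₂ (s h)) (toℕ g)
            (subst (toℕ g ℕ.<_) (proj₁ (proj₂ (proj₁ (proj₂ (s h))))) lt) (g , refl , l))
        })

    s : Fin n → ℤ
    s h = 𝟙 (H h)

    -- The cap at `2b` serves two estimates at once: the faces of a class still add up to `2b`, and
    -- taking `m r` off the sides of a face costs at most the `2b` that a face in the Hall set pays.
    m : Fin n → ℤ
    m r = F.osum s r ⊓ (+ 2 * B)

    0≤m : ∀ r → 0ℤ ≤ m r
    0≤m r = ℤₚ.⊓-glb (F.osum-nonneg r (λ h → 0≤𝟙 (H h))) 0≤2B

    module _ (L : Labelling) where
      open Labelling L

      class : Fin n → Fin n → Bool
      class c h = c ≡ᵇ cl h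

      class-φ : ∀ c → F.Invariant (class c)
      class-φ c h = cong (c ≡ᵇ_) (cl-φ h)

      -- A class without exit would contain every face. But the edges of the root face are in `H`,
      -- so the class of the root face is that face alone, and the other side of `root` is a
      -- different face.
      class-exit : ∀ c → cl c ≡ c → ∃[ h ] (class c h ≡ true × class c (α h) ≡ false)
      class-exit c e = decidable-stable (Finₚ.any? (λ h → (class c h Boolₚ.≟ true) ×-dec (class c (α h) Boolₚ.≟ false))) absurd
        where
        absurd : ¬ ¬ (∃[ h ] (class c h ≡ true × class c (α h) ≡ false))
        absurd none = true≢false (F.in?-true (root-only (link-sym (subst (Linked (α root))
            (sym (≡ᵇ-sound (everything (α root)))) (linked (α root)))))) (outer-α (F.in?-true F.~-refl))
          where
          up : ∀ h → class c h ≡ true → class c (α h) ≡ true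
          up h t = [ (λ x → x) , (λ f → ⊥-elim (none (h , t , f))) ]′ (bool (class c (α h)))
          class-α : ∀ h → class c (α h) ≡ class c h
          class-α h = ⇔⇒≡ (λ t → subst (λ x → class c x ≡ true) (α-invol h) (up (α h) t)) (up h)
          class-σ : ∀ h → class c (σ h) ≡ class c h
          class-σ h = trans (sym (F.~-invariant (class-φ c) α-face-σ)) (class-α h)
          everything : ∀ h → class c h ≡ true
          everything = all-half-edges class-σ class-α {c} (⌊⌋-true (_ Finₚ.≟ _) (sym e))
          c~root : c F.~ root
          c~root = F.~-sym (stay (subst (Linked root) (sym (≡ᵇ-sound (everything root))) (linked root)))
            where
            stay : ∀ {h} → Linked root h → root F.~ h
            stay (_ , FF.at t) = F.in?-sound t
            stay (_ , FF.cross {g = g} l x t) = ⊥-elim (true≢false (H-outer (F.in?-true (stay (_ , l)))) x)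
          root-only : ∀ {h} → Linked c h → root F.~ h
          root-only (_ , FF.at t) = F.~-trans (F.~-sym c~root) (F.in?-sound t)
          root-only (_ , FF.cross l x t) = ⊥-elim (true≢false (H-outer (F.in?-true (root-only (_ , l)))) x)

      -- The girth bounds the length of a boundary cycle of the class from below. Its edges are in
      -- `H`, since any other edge has both sides in one class.
      class-sides : ∀ c → cl c ≡ c → + 2 * B ≤ ∑ (λ h → 𝟙 (class c h) * s h)
      class-sides c e = ℤₚ.≤-trans (subst (_≤ + k) (ℤₚ.pos-* 2 b) (+≤+ (proj₂ girth k cy cyc)))
        (ℤₚ.≤-trans (ℤₚ.≤-reflexive (sym (sum-hits cy))) (sum-≤ (λ h → ℤₚ.≤-trans
          (hits≤ cyc (λ h → class c h ∧ H h) (λ i → cong₂ _∧_ (proj₁ (sides i)) (in-H i)) h) (ℤₚ.≤-reflexive (𝟙-∧ (class c h) (H h))))))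
        where
        ex = class-exit c e
        bc = boundary-cycle (class-φ c) (proj₁ (proj₂ ex)) (proj₂ (proj₂ ex))
        k = proj₁ bc
        cy = proj₁ (proj₂ bc)
        cyc = proj₁ (proj₂ (proj₂ bc))
        sides = proj₂ (proj₂ (proj₂ bc))
        in-H : ∀ i → H (cy i) ≡ true
        in-H i = [ (λ t → t) , (λ f → ⊥-elim (true≢false (trans (cong (c ≡ᵇ_) (sym (cl-cong (link-α f (link-~ F.~-refl))))) (proj₁ (sides i)))
          (proj₂ (sides i)))) ]′ (bool (H (cy i)))

      private
        part : Fin n → Fin n → ℤ
        part c r = 𝟙 (F.min? r) * (𝟙 (class c r) * m r)

      class-faces : ∀ c → cl c ≡ c → + 2 * B ≤ ∑ (part c)
      class-faces c e = ℤₚ.≤-trans (sum-⊓ {f = λ r → 𝟙 (F.min? r) * (𝟙 (class c r) * F.osum s r)} 0≤2B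
          (λ r → 0≤𝟙 (F.min? r) ⊠ (0≤𝟙 (class c r) ⊠ F.osum-nonneg r (λ h → 0≤𝟙 (H h))))
          (ℤₚ.≤-trans (class-sides c e) (ℤₚ.≤-reflexive (F.sum-by-orbits (class-φ c) s))))
        (ℤₚ.≤-reflexive (sum-cong (λ r → distribute (F.min? r) (class c r) (F.osum s r))))
        where
        distribute : ∀ p q z → (𝟙 p * (𝟙 q * z)) ⊓ (+ 2 * B) ≡ 𝟙 p * (𝟙 q * (z ⊓ (+ 2 * B)))
        distribute true  true  z rewrite ℤₚ.*-identityˡ (1ℤ * z) | ℤₚ.*-identityˡ z
          | ℤₚ.*-identityˡ (1ℤ * (z ⊓ (+ 2 * B))) | ℤₚ.*-identityˡ (z ⊓ (+ 2 * B)) = refl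
        distribute true  false z = ℤₚ.i≤j⇒i⊓j≡i 0≤2B
        distribute false q     z = ℤₚ.i≤j⇒i⊓j≡i 0≤2B

      faces-bound : + 2 * B * F.#orb main ≤ ∑ (λ r → 𝟙 (F.min? r) * m r)
      faces-bound = ℤₚ.≤-trans (ℤₚ.≤-reflexive (trans (cong (_*_ (+ 2 * B)) #main) (sym (sum-* (+ 2 * B) _))))
        (ℤₚ.≤-trans (sum-≤ (λ c → per-class c (bool (cl c ≡ᵇ c)))) (ℤₚ.≤-reflexive (trans (sum-swap part) (sum-cong collect))))
        where
        0≤part : ∀ c r → 0ℤ ≤ part c r
        0≤part c r = 0≤𝟙 (F.min? r) ⊠ (0≤𝟙 (class c r) ⊠ 0≤m r)
        per-class : ∀ c → ((cl c ≡ᵇ c) ≡ true) ⊎ ((cl c ≡ᵇ c) ≡ false) → + 2 * B * 𝟙 (cl c ≡ᵇ c) ≤ ∑ (part c)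
        per-class c (inj₁ t) = ℤₚ.≤-trans (ℤₚ.≤-reflexive (trans (cong (λ z → + 2 * B * 𝟙 z) t) (ℤₚ.*-identityʳ _))) (class-faces c (≡ᵇ-sound t))
        per-class c (inj₂ f) = ℤₚ.≤-trans (ℤₚ.≤-reflexive (trans (cong (λ z → + 2 * B * 𝟙 z) f) (ℤₚ.*-zeroʳ (+ 2 * B)))) (sum-nonneg (0≤part c))
        shuffle : ∀ p q z → p * (q * z) ≡ q * (p * z)
        shuffle = solve-∀
        collect : ∀ r → ∑ (λ c → part c r) ≡ 𝟙 (F.min? r) * m r
        collect r = trans (sum-cong (λ c → shuffle (𝟙 (F.min? r)) (𝟙 (class c r)) (m r))) (sum-pick (λ _ → 𝟙 (F.min? r) * m r) (cl r))

  -- The constant `4b` counts the outer half-edges: `2b` on the root face and their opposites.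
  sum-innerE : (f : Fin n → ℤ) → (∀ {h} → rt h ≡ true → (f h ≡ 1ℤ) × (f (α h) ≡ 1ℤ)) →
    ∑ (λ h → f h * 𝟙 (innerE h)) ≡ ∑ f - + 4 * B
  sum-innerE f one = trans (sum-cong (λ h → trans (cong (f h *_) (𝟙-innerE h)) (trans (distrib (f h) (𝟙 (rt h)) (𝟙 (rt (α h))))
      (cong (_-_ (f h)) (cong₂ _+_ (𝟙-*-cong (rt h) (λ t → proj₁ (one t))) (𝟙-*-cong (rt (α h)) (λ t → trans (cong f (sym (α-invol h))) (proj₂ (one t)))))))))
    (trans (sum-minus f _) (cong (_-_ (∑ f)) (trans (sum-+ _ _) (trans (cong₂ _+_ roots (trans (sum-α (λ h → 𝟙 (rt h) * 1ℤ)) roots)) (four B)))))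
    where
    distrib : ∀ f a b → f * (1ℤ - (a + b)) ≡ f - (a * f + b * f)
    distrib = solve-∀
    four : ∀ b → + 2 * b + + 2 * b ≡ + 4 * b
    four = solve-∀
    roots : ∑ (λ h → 𝟙 (rt h) * 1ℤ) ≡ + 2 * B
    roots = trans (sum-cong (λ h → ℤₚ.*-identityʳ _)) sum-rt

  module _ (1≤b : 1 ℕ.≤ b) (RV RF : Fin n → Bool) (RV-σ : V.Invariant RV) (RF-φ : F.Invariant RF) where

    private
      -- The outer vertices are added to the Hall set. They have demand zero and a known number, and
      -- with them `H` contains the outer cycle, so that every class of faces has a boundary.
      R H : Fin n → Bool
      R h = RV h ∨ outerV h
      H h = R h ∧ R (α h)

      R-σ : V.Invariant R
      R-σ h = cong₂ _∨_ (RV-σ h) (touch-σ h)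

      H-α : ∀ h → H (α h) ≡ H h
      H-α h = trans (cong (λ g → R (α h) ∧ R g) (α-invol h)) (Boolₚ.∧-comm (R (α h)) (R h))

      H-outer : ∀ {h} → rt h ≡ true → H h ≡ true
      H-outer {h} t = cong₂ _∧_ (∨-introʳ {RV h} (rt⇒outerV t)) (∨-introʳ {RV (α h)} (outerV-root-α t))

      open Classes H H-α H-outer

      S inE inF : ℤ
      S = ∑ s
      inE = ∑ (λ h → 𝟙 (RV h) * 𝟙 (RV (α h)) * 𝟙 (innerE h))
      inF = ∑ (λ h → 𝟙 (RF h) * 𝟙 (RV (φ h)))

      edges : inE ≤ S - + 4 * B
      edges = ℤₚ.≤-trans (sum-≤ (λ h → pointwise (RV h) (outerV h) (RV (α h)) (outerV (α h)) (innerE h)))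
        (ℤₚ.≤-reflexive (sum-innerE s (λ {h} t → cong 𝟙 (H-outer t) , cong 𝟙 (trans (H-α h) (H-outer t)))))
        where
        pointwise : ∀ a o a' o' i → 𝟙 a * 𝟙 a' * 𝟙 i ≤ 𝟙 ((a ∨ o) ∧ (a' ∨ o')) * 𝟙 i
        pointwise true  o true  o' i = ℤₚ.≤-refl
        pointwise true  o false o' i = 0≤𝟙 o' ⊠ 0≤𝟙 i
        pointwise false o a' o' i = 0≤𝟙 (o ∧ (a' ∨ o')) ⊠ 0≤𝟙 i

      T : Fin n → ℤ
      T h = + 2 * 𝟙 (RV (φ h)) - 1ℤ

      -- Moving half of the corner terms one step along the face turns the sum over corners into a
      -- sum over sides, where a side counts 1, 0 or -1 according to whether two, one or none of its
      -- ends are in `RV`.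
      T≤s : ∀ r → F.osum T r ≤ F.osum s r
      T≤s r = ℤₚ.≤-trans (ℤₚ.≤-reflexive rewrite-T) (F.osum-mono (λ g _ → pointwise (RV g) (outerV g) (RV (α g)) (outerV (α g))))
        where
        v : Fin n → ℤ
        v h = 𝟙 (RV h)
        pointwise : ∀ a o a' o' → (𝟙 a + 𝟙 a') - 1ℤ ≤ 𝟙 ((a ∨ o) ∧ (a' ∨ o'))
        pointwise true  o true  o' = ℤₚ.≤-refl
        pointwise true  o false o' = 0≤𝟙 o'
        pointwise false o true  o' = 0≤𝟙 (o ∧ true)
        pointwise false o false o' = ℤₚ.≤-trans -≤+ (0≤𝟙 (o ∧ o'))
        double : ∀ z → + 2 * z - 1ℤ ≡ (z + z) - 1ℤ
        double = solve-∀
        rewrite-T : F.osum T r ≡ F.osum (λ h → (v h + v (α h)) - 1ℤ) r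
        rewrite-T = trans (F.osum-cong (λ g _ → double (v (φ g)))) (trans (F.osum-minus (λ g → v (φ g) + v (φ g)) (λ _ → 1ℤ) r)
          (trans (cong (_- F.osum (λ _ → 1ℤ) r) (trans (F.osum-+ (v ∘ φ) (v ∘ φ) r)
              (trans (cong₂ _+_ (F.osum-π v r) (F.osum-cong (λ g _ → cong 𝟙 (RV-σ (α g))))) (sym (F.osum-+ v (v ∘ α) r)))))
            (sym (F.osum-minus (λ h → v h + v (α h)) (λ _ → 1ℤ) r))))

      -- Face by face: in `RF` the gain is at most the number of sides in `H` minus `2b`, elsewhere
      -- it is 0, and both are at most the sides minus their capped value.
      faces : + 2 * inF - (∑ (λ h → 𝟙 (RF h)) + + 2 * B * F.#orb RF) ≤ S - ∑ (λ r → 𝟙 (F.min? r) * m r)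
      faces = ℤₚ.≤-trans (ℤₚ.≤-reflexive left) (ℤₚ.≤-trans (sum-≤ pointwise) (ℤₚ.≤-reflexive right))
        where
        left : + 2 * inF - (∑ (λ h → 𝟙 (RF h)) + + 2 * B * F.#orb RF) ≡ ∑ (λ r → 𝟙 (F.min? r) * (𝟙 (RF r) * F.osum T r) - + 2 * B * (𝟙 (F.min? r) * 𝟙 (RF r)))
        left = trans (cong (λ z → z - (∑ (λ h → 𝟙 (RF h)) + + 2 * B * F.#orb RF)) (sym (sum-* (+ 2) _)))
          (trans (regroup (∑ (λ h → + 2 * (𝟙 (RF h) * 𝟙 (RV (φ h))))) (∑ (λ h → 𝟙 (RF h))) (+ 2 * B * F.#orb RF))
            (trans (cong₂ _-_ (trans (sym (sum-minus _ _)) (trans (sum-cong (λ h → expand (𝟙 (RF h)) (𝟙 (RV (φ h))))) (F.sum-by-orbits RF-φ T)))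
                (sym (sum-* (+ 2 * B) _)))
              (sym (sum-minus _ _))))
          where
          regroup : ∀ x y z → x - (y + z) ≡ (x - y) - z
          regroup = solve-∀
          expand : ∀ f r → + 2 * (f * r) - f ≡ f * (+ 2 * r - 1ℤ)
          expand = solve-∀
        right : ∑ (λ r → 𝟙 (F.min? r) * (F.osum s r - m r)) ≡ S - ∑ (λ r → 𝟙 (F.min? r) * m r)
        right = trans (sum-cong (λ r → distrib (𝟙 (F.min? r)) (F.osum s r) (m r))) (trans (sum-minus _ _)
          (cong (_- ∑ (λ r → 𝟙 (F.min? r) * m r)) (trans (sum-cong (λ r → cong (𝟙 (F.min? r) *_) (sym (ℤₚ.*-identityˡ _))))
            (trans (sym (F.sum-by-orbits {λ _ → true} (λ _ → refl) s)) (sum-cong (λ h → ℤₚ.*-identityˡ _))))))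
          where
          distrib : ∀ p x y → p * (x - y) ≡ p * x - p * y
          distrib = solve-∀
        collect : ∀ p f t b → p * (f * t) - b * (p * f) ≡ p * (f * (t - b))
        collect = solve-∀
        pointwise : ∀ r → 𝟙 (F.min? r) * (𝟙 (RF r) * F.osum T r) - + 2 * B * (𝟙 (F.min? r) * 𝟙 (RF r)) ≤ 𝟙 (F.min? r) * (F.osum s r - m r)
        pointwise r = ℤₚ.≤-trans (ℤₚ.≤-reflexive (collect (𝟙 (F.min? r)) (𝟙 (RF r)) (F.osum T r) (+ 2 * B)))
          (𝟙-*-mono (F.min? r) (λ _ → cases (RF r)))
          where
          cases : ∀ f → 𝟙 f * (F.osum T r - + 2 * B) ≤ F.osum s r - m r
          cases true  = ℤₚ.≤-trans (ℤₚ.≤-reflexive (ℤₚ.*-identityˡ _)) (ℤₚ.+-mono-≤ (T≤s r) (ℤₚ.neg-mono-≤ (ℤₚ.i⊓j≤j (F.osum s r) (+ 2 * B))))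
          cases false = gap (ℤₚ.i⊓j≤i (F.osum s r) (+ 2 * B))

      vertices : V.#orb R ≡ V.#orb (λ h → RV h ∧ not (outerV h)) + + 2 * B
      vertices = trans (sum-cong (λ r → trans (cong (𝟙 (V.min? r) *_) (split (RV r) (outerV r))) (ℤₚ.*-distribˡ-+ (𝟙 (V.min? r)) _ _)))
        (trans (sum-+ _ _) (cong (_+_ (V.#orb (λ h → RV h ∧ not (outerV h)))) #outerV))
        where
        split : ∀ a o → 𝟙 (a ∨ o) ≡ 𝟙 (a ∧ not o) + 𝟙 o
        split true  true  = refl
        split true  false = refl
        split false true  = refl
        split false false = refl

    hall-condition : (B - 1ℤ) * inE + + 2 * inF
      ≤ + 2 * B * V.#orb (λ h → RV h ∧ not (outerV h)) + (∑ (λ h → 𝟙 (RF h)) + + 2 * B * F.#orb RF)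
    hall-condition = decidable-stable (_ ℤ.≤? _) (do
      L ← labelling
      return (conclude L))
      where
      module _ (L : Labelling) where
        open Labelling L
        euler' : S + + 4 ≤ + 2 * F.#orb main + + 2 * V.#orb R
        euler' = euler-inequality {H} {main} {R} main-φ H-α R-σ (λ h e → proj₁ (∧-true e)) reach
          (root , ∨-introʳ {RV root} (rt⇒outerV (F.in?-true F.~-refl)))
        arrange : ∀ b s i f fc mn mm v → (b - 1ℤ) * ((s - + 4 * b) - i) + ((s - mm) - (+ 2 * f - fc)) + (mm - + 2 * b * mn)
          + b * ((+ 2 * mn + + 2 * (v + + 2 * b)) - (s + + 4)) ≡ (+ 2 * b * v + fc) - ((b - 1ℤ) * i + + 2 * f)
        arrange = solve-∀
        conclude : (B - 1ℤ) * inE + + 2 * inF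
          ≤ + 2 * B * V.#orb (λ h → RV h ∧ not (outerV h)) + (∑ (λ h → 𝟙 (RF h)) + + 2 * B * F.#orb RF)
        -- The factors follow from the claim: `b - 1` is the weight of an inner edge, and `b` times
        -- Euler's relation produces the demand `2b` of a vertex in the doubled count.
        conclude = ≤-by ((gap (+≤+ 1≤b) ⊠ gap edges) ⊞ gap faces ⊞ gap (faces-bound L) ⊞
            (0≤B ⊠ gap (subst (λ z → S + + 4 ≤ + 2 * F.#orb main + + 2 * z) vertices euler')))
          (arrange B S inE inF _ (F.#orb main) (∑ (λ r → 𝟙 (F.min? r) * m r)) _)

-- Existence of star orientations

module StarMap {n : ℕ} (PM : PlaneMap n) (b : ℕ) (deg : PlaneMap.outerDeg PM ≡ 2 ℕ.* b)
  (girth : PlaneMap.HasGirth PM (2 ℕ.* b)) (1≤b : 1 ℕ.≤ b)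
  (even : ∀ h → + PlaneMap.faceDeg PM h ≡ + 2 * + (PlaneMap.faceDeg PM h DM./ 2)) where
  open PlaneMap PM
  open Regions PM
  open Contour PM b deg girth
  open Hall PM b deg girth

  -- An orientation of the map with an additional vertex in each face: u splits
  -- the weight of the edges, and z h tells whether the edge from the face on the
  -- right of h to the vertex of α h gives its weight to the latter.
  record StarOrientation (u z : Fin n → ℤ) : Set where
    field
      0≤u    : ∀ h → 0ℤ ≤ u h
      0≤z    : ∀ h → 0ℤ ≤ z h
      z≤1    : ∀ h → z h ≤ 1ℤ
      edge   : ∀ h → u h + u (α h) ≡ (B - 1ℤ) * 𝟙 (innerE h)
      face   : ∀ h → F.osum (λ g → 1ℤ - + 2 * z g) h ≡ + 2 * B
      vertex : ∀ h → V.osum (λ g → u g + z (α g)) h ≡ B * (1ℤ - 𝟙 (outerV h))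

  private
    N : ℕ
    N = n ℕ.+ (n ℕ.+ n)

    -- The darts of the star map: for each half-edge `h` its own end of the old edge, and the two
    -- ends of a new edge from the face of `h` to the vertex of `φ h`.
    Kind : Set
    Kind = Fin n ⊎ (Fin n ⊎ Fin n)

    pattern edge-end h = inj₁ h
    pattern vertex-end h = inj₂ (inj₁ h)
    pattern face-end h = inj₂ (inj₂ h)

    J : Kind → Fin N
    J (edge-end h)   = h Fin.↑ˡ (n ℕ.+ n)
    J (vertex-end h) = n Fin.↑ʳ (h Fin.↑ˡ n)
    J (face-end h)   = n Fin.↑ʳ (n Fin.↑ʳ h)

    K : Fin N → Kind
    K d = [ inj₁ , (λ d' → inj₂ (Fin.splitAt n d')) ]′ (Fin.splitAt n d)

    KJ : ∀ k → K (J k) ≡ k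
    KJ (edge-end h)   = cong [ inj₁ , (λ d' → inj₂ (Fin.splitAt n d')) ]′ (Finₚ.splitAt-↑ˡ n h (n ℕ.+ n))
    KJ (vertex-end h) = trans (cong [ inj₁ , (λ d' → inj₂ (Fin.splitAt n d')) ]′ (Finₚ.splitAt-↑ʳ n (n ℕ.+ n) (h Fin.↑ˡ n)))
      (cong inj₂ (Finₚ.splitAt-↑ˡ n h n))
    KJ (face-end h)   = trans (cong [ inj₁ , (λ d' → inj₂ (Fin.splitAt n d')) ]′ (Finₚ.splitAt-↑ʳ n (n ℕ.+ n) (n Fin.↑ʳ h)))
      (cong inj₂ (Finₚ.splitAt-↑ʳ n n h))

    JK : ∀ d → J (K d) ≡ d
    JK d = trans (outer (Fin.splitAt n d)) (Finₚ.join-splitAt n (n ℕ.+ n) d)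
      where
      inner : ∀ s → J (inj₂ s) ≡ n Fin.↑ʳ Fin.join n n s
      inner (inj₁ h) = refl
      inner (inj₂ h) = refl
      outer : ∀ s → J ([ inj₁ , (λ d' → inj₂ (Fin.splitAt n d')) ]′ s) ≡ Fin.join n (n ℕ.+ n) s
      outer (inj₁ h)  = refl
      outer (inj₂ d') = trans (inner (Fin.splitAt n d')) (cong (n Fin.↑ʳ_) (Finₚ.join-splitAt n n d'))

    flip : Kind → Kind
    flip (edge-end h)   = edge-end (α h)
    flip (vertex-end h) = face-end h
    flip (face-end h)   = vertex-end h

    flip-invol : ∀ k → flip (flip k) ≡ k
    flip-invol (edge-end h)   = cong inj₁ (α-invol h)
    flip-invol (vertex-end h) = refl
    flip-invol (face-end h)   = refl

    flip-nofix : ∀ k → flip k ≢ k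
    flip-nofix (edge-end h) e = α-nofix h (inj₁-injective e)
      where
      inj₁-injective : ∀ {g h : Fin n} → edge-end g ≡ edge-end h → g ≡ h
      inj₁-injective refl = refl
    flip-nofix (vertex-end h) ()
    flip-nofix (face-end h) ()

    nd : Kind → Fin (n ℕ.+ n)
    nd (edge-end h)   = V.rep h Fin.↑ˡ n
    nd (vertex-end h) = V.rep (φ h) Fin.↑ˡ n
    nd (face-end h)   = n Fin.↑ʳ F.rep h

    cp : Kind → ℤ
    cp (edge-end h)   = (B - 1ℤ) * 𝟙 (innerE h)
    cp (vertex-end h) = 1ℤ
    cp (face-end h)   = 1ℤ

    cp-flip : ∀ k → cp (flip k) ≡ cp k
    cp-flip (edge-end h)   = cong (λ i → (B - 1ℤ) * 𝟙 i) (innerE-α h)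
    cp-flip (vertex-end h) = refl
    cp-flip (face-end h)   = refl

    0≤cp : ∀ k → 0ℤ ≤ cp k
    0≤cp (edge-end h)   = gap (+≤+ 1≤b) ⊠ 0≤𝟙 (innerE h)
    0≤cp (vertex-end h) = 0≤+
    0≤cp (face-end h)   = 0≤+

    -- Nodes are indexed by all half-edges, twice over, but only orbit representatives receive a
    -- target. For a face, `deg/2 + b` is the degree minus the number `deg/2 - b` of units that
    -- condition (iii) asks it to give away.
    tv tf : Fin n → ℤ
    tv r = 𝟙 (V.min? r) * (B * (1ℤ - 𝟙 (outerV r)))
    tf r = 𝟙 (F.min? r) * (+ (faceDeg r DM./ 2) + B)

    β : Fin N → Fin N
    β d = J (flip (K d))

    node : Fin N → Fin (n ℕ.+ n)
    node d = nd (K d)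

    t : Fin (n ℕ.+ n) → ℤ
    t v = [ tv , tf ]′ (Fin.splitAt n v)

    module FL = Flow β (λ d → trans (cong (λ k → J (flip k)) (KJ (flip (K d)))) (trans (cong J (flip-invol (K d))) (JK d)))
      (λ d e → flip-nofix (K d) (trans (sym (KJ (flip (K d)))) (cong K e)))
      node (λ d → cp (K d)) (λ d → trans (cong cp (KJ (flip (K d)))) (cp-flip (K d))) (λ d → 0≤cp (K d)) t

    sum-kinds : (f : Fin N → ℤ) (g : Kind → ℤ) → (∀ k → f (J k) ≡ g k) →
      ∑ f ≡ ∑ (λ h → g (edge-end h)) + (∑ (λ h → g (vertex-end h)) + ∑ (λ h → g (face-end h)))
    sum-kinds f g e = trans (sum-↑ n f) (cong₂ _+_ (sum-cong (λ h → e (edge-end h)))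
      (trans (sum-↑ n (λ j → f (n Fin.↑ʳ j))) (cong₂ _+_ (sum-cong (λ h → e (vertex-end h))) (sum-cong (λ h → e (face-end h))))))

    node-J : ∀ k → node (J k) ≡ nd k
    node-J k = cong nd (KJ k)

    node-βJ : ∀ k → node (β (J k)) ≡ nd (flip k)
    node-βJ k = trans (cong nd (KJ (flip (K (J k))))) (cong (λ k → nd (flip k)) (KJ k))

    module Totals (R : Fin (n ℕ.+ n) → Bool) where
      RV RF : Fin n → Bool
      RV h = R (V.rep h Fin.↑ˡ n)
      RF h = R (n Fin.↑ʳ F.rep h)
      RV-σ : V.Invariant RV
      RV-σ h = cong (λ r → R (r Fin.↑ˡ n)) (V.rep-cong (V.~-sym V.~-π))
      RF-φ : F.Invariant RF
      RF-φ h = cong (λ r → R (n Fin.↑ʳ r)) (F.rep-cong (F.~-sym F.~-π))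

      supply : ∑ (λ d → 𝟙 (R (node d)) * 𝟙 (R (node (β d))) * cp (K d)) ≡
        (B - 1ℤ) * ∑ (λ h → 𝟙 (RV h) * 𝟙 (RV (α h)) * 𝟙 (innerE h)) + + 2 * ∑ (λ h → 𝟙 (RF h) * 𝟙 (RV (φ h)))
      supply = trans (sum-kinds _ (λ k → 𝟙 (R (nd k)) * 𝟙 (R (nd (flip k))) * cp k)
          (λ k → cong₂ (λ a c → a * c) (cong₂ (λ x y → 𝟙 (R x) * 𝟙 (R y)) (node-J k) (node-βJ k)) (cong cp (KJ k))))
        (cong₂ _+_ (trans (sum-cong (λ h → shuffle (𝟙 (RV h)) (𝟙 (RV (α h))) (B - 1ℤ) (𝟙 (innerE h)))) (sum-* (B - 1ℤ) _))
          (trans (cong₂ _+_ (sum-cong (λ h → swap (𝟙 (RV (φ h))) (𝟙 (RF h)))) (sum-cong (λ h → ℤₚ.*-identityʳ _))) (double _)))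
        where
        shuffle : ∀ a b c d → a * b * (c * d) ≡ c * (a * b * d)
        shuffle = solve-∀
        swap : ∀ a b → a * b * 1ℤ ≡ b * a
        swap = solve-∀
        double : ∀ z → z + z ≡ + 2 * z
        double = solve-∀

      demand : + 2 * ∑ (λ v → 𝟙 (R v) * t v) ≡
        + 2 * B * V.#orb (λ h → RV h ∧ not (outerV h)) + (∑ (λ h → 𝟙 (RF h)) + + 2 * B * F.#orb RF)
      demand = trans (cong (_*_ (+ 2)) (trans (sum-↑ n _) (cong₂ _+_
          (trans (sum-cong at-vertex-node) (sum-* B (λ r → 𝟙 (V.min? r) * 𝟙 (RV r ∧ not (outerV r)))))
          (sum-cong at-face-node))))
        (trans (ℤₚ.*-distribˡ-+ (+ 2) (B * V.#orb (λ h → RV h ∧ not (outerV h))) _) (cong₂ _+_ (sym (ℤₚ.*-assoc (+ 2) B _))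
          (trans (sym (sum-* (+ 2) _)) (trans (sum-cong halves) (trans (sum-+ _ _) (cong₂ _+_
            (trans (sym (F.sum-by-orbits RF-φ (λ _ → 1ℤ))) (sum-cong (λ h → ℤₚ.*-identityʳ _)))
            (sum-* (+ 2 * B) (λ r → 𝟙 (F.min? r) * 𝟙 (RF r)))))))))
        where
        shuffle : ∀ r m b o → r * (m * (b * o)) ≡ b * (m * (r * o))
        shuffle = solve-∀
        shuffle' : ∀ r m x → r * (m * x) ≡ m * (r * x)
        shuffle' = solve-∀
        at-vertex-node : ∀ r → 𝟙 (R (r Fin.↑ˡ n)) * t (r Fin.↑ˡ n) ≡ B * (𝟙 (V.min? r) * 𝟙 (RV r ∧ not (outerV r)))
        at-vertex-node r = trans (cong (λ k → 𝟙 (R (r Fin.↑ˡ n)) * [ tv , tf ]′ k) (Finₚ.splitAt-↑ˡ n r n))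
          (trans (shuffle (𝟙 (R (r Fin.↑ˡ n))) (𝟙 (V.min? r)) B (1ℤ - 𝟙 (outerV r))) (cong (B *_) (𝟙-*-cong (V.min? r) (λ mr →
            trans (cong₂ (λ x y → 𝟙 (R (x Fin.↑ˡ n)) * y) (V.min?-unique mr (V.min?-rep r) V.~-rep) (sym (𝟙-not (outerV r))))
              (sym (𝟙-∧ (RV r) (not (outerV r))))))))
        at-face-node : ∀ r → 𝟙 (R (n Fin.↑ʳ r)) * t (n Fin.↑ʳ r) ≡ 𝟙 (F.min? r) * (𝟙 (RF r) * (+ (faceDeg r DM./ 2) + B))
        at-face-node r = trans (cong (λ k → 𝟙 (R (n Fin.↑ʳ r)) * [ tv , tf ]′ k) (Finₚ.splitAt-↑ʳ n n r))
          (trans (shuffle' (𝟙 (R (n Fin.↑ʳ r))) (𝟙 (F.min? r)) _) (𝟙-*-cong (F.min? r) (λ mr →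
            cong (λ x → 𝟙 (R (n Fin.↑ʳ x)) * (+ (faceDeg r DM./ 2) + B)) (F.min?-unique mr (F.min?-rep r) F.~-rep))))
        expand : ∀ m f d b → + 2 * (m * (f * (d + b))) ≡ m * (f * (+ 2 * d)) + + 2 * b * (m * f)
        expand = solve-∀
        halves : ∀ r → + 2 * (𝟙 (F.min? r) * (𝟙 (RF r) * (+ (faceDeg r DM./ 2) + B))) ≡
          𝟙 (F.min? r) * (𝟙 (RF r) * F.osum (λ _ → 1ℤ) r) + + 2 * B * (𝟙 (F.min? r) * 𝟙 (RF r))
        halves r = trans (expand (𝟙 (F.min? r)) (𝟙 (RF r)) (+ (faceDeg r DM./ 2)) B)
          (cong (λ d → 𝟙 (F.min? r) * (𝟙 (RF r) * d) + + 2 * B * (𝟙 (F.min? r) * 𝟙 (RF r))) (trans (sym (even r)) (sym (F.osum-1 r))))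

    -- The case of all nodes, where Euler's formula is used as an equality.
    balanced : ∑ (λ d → cp (K d)) ≡ + 2 * ∑ t
    balanced = trans (sum-cong (λ d → sym (ℤₚ.*-identityˡ _))) (trans supply (trans (cong₂ (λ i f → (B - 1ℤ) * i + + 2 * f)
          (sum-innerE (λ _ → 1ℤ * 1ℤ) (λ _ → refl , refl)) refl)
        (trans (cong₂ (λ i f → (B - 1ℤ) * (i - + 4 * B) + + 2 * f) (sum-1 n) (sum-1 n))
          (trans (arrange (+ n) B v# f# euler') (trans (sym (cong₂ (λ x y → + 2 * B * x + y) inner-vertices
              (cong₂ (λ x y → x + + 2 * B * y) (sum-1 n) (sum-cong (λ r → ℤₚ.*-identityʳ _)))))
            (trans (sym demand) (cong (_*_ (+ 2)) (sum-cong (λ v → ℤₚ.*-identityˡ _)))))))))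
      where
      open Totals (λ _ → true)
      f# = ∑ (λ r → 𝟙 (F.min? r))
      v# = ∑ (λ r → 𝟙 (V.min? r))
      euler' : + 2 * v# + + 2 * f# ≡ + n + + 4
      euler' = trans (sym (cong₂ (λ a b → + 2 * a + + 2 * b) V.numOrbits≡ F.numOrbits≡))
        (trans (cong₂ _+_ (sym (ℤₚ.pos-* 2 (numOrbits σ))) (sym (ℤₚ.pos-* 2 (numOrbits φ)))) (cong +_ euler))
      inner-vertices : V.#orb (λ h → not (outerV h)) ≡ v# - + 2 * B
      inner-vertices = trans (V.#orb-not outerV) (cong (_-_ v#) #outerV)
      arrange : ∀ n b v f → + 2 * v + + 2 * f ≡ n + + 4 →
        (b - 1ℤ) * (n - + 4 * b) + + 2 * n ≡ + 2 * b * (v - + 2 * b) + (n + + 2 * b * f)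
      arrange n b v f e = trans (go n b) (trans (cong (λ z → b * z - + 4 * b * b + n) (sym e)) (go' n b v f))
        where
        go : ∀ n b → (b - 1ℤ) * (n - + 4 * b) + + 2 * n ≡ b * (n + + 4) - + 4 * b * b + n
        go = solve-∀
        go' : ∀ n b v f → b * (+ 2 * v + + 2 * f) - + 4 * b * b + n ≡ + 2 * b * (v - + 2 * b) + (n + + 2 * b * f)
        go' = solve-∀

    hall : ∀ R → ∑ (λ d → 𝟙 (R (node d)) * 𝟙 (R (node (β d))) * cp (K d)) ≤ + 2 * ∑ (λ v → 𝟙 (R v) * t v)
    hall R = ℤₚ.≤-trans (ℤₚ.≤-reflexive supply) (ℤₚ.≤-trans (hall-condition 1≤b RV RF RV-σ RF-φ) (ℤₚ.≤-reflexive (sym demand)))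
      where open Totals R

    ↑ˡ≢↑ʳ : ∀ {i j : Fin n} → i Fin.↑ˡ n ≢ n Fin.↑ʳ j
    ↑ˡ≢↑ʳ {i} {j} e = case trans (sym (Finₚ.splitAt-↑ˡ n i n)) (trans (cong (Fin.splitAt n) e) (Finₚ.splitAt-↑ʳ n n j)) of λ ()

  star-exists : ¬ ¬ (Σ (Fin n → ℤ) λ u → Σ (Fin n → ℤ) λ z → StarOrientation u z)
  star-exists = do
    (a , loads) ← FL.perfect balanced hall
    return (extract a loads)
    where
    extract : (a : FL.Assignment) → (∀ v → FL.load (FL.Assignment.x a) v ≡ t v) →
      Σ (Fin n → ℤ) λ u → Σ (Fin n → ℤ) λ z → StarOrientation u z
    extract a loads = u , z , record
      { 0≤u = λ h → nonneg (J (edge-end h))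
      ; 0≤z = λ h → nonneg (J (vertex-end h))
      ; z≤1 = λ h → ≤-by (nonneg (J (face-end h))) (trans (cong x (sym (cong J (cong flip (KJ (vertex-end h))))))
          (trans (back (z h) _) (cong (_- z h) (trans (total (J (vertex-end h))) (cong cp (KJ (vertex-end h)))))))
      ; edge = λ h → trans (cong (λ k → u h + x (J (flip k))) (sym (KJ (edge-end h))))
          (trans (total (J (edge-end h))) (cong cp (KJ (edge-end h))))
      ; face = face
      ; vertex = vertex
      }
      where
      open FL.Assignment a
      u z : Fin n → ℤ
      u h = x (J (edge-end h))
      z h = x (J (vertex-end h))
      back : ∀ a b → b ≡ (a + b) - a
      back = solve-∀
      other : ∀ h → x (J (face-end h)) ≡ 1ℤ - z h
      other h = trans (back (z h) _) (cong (_- z h) (trans (cong (λ k → z h + x (J (flip k))) (sym (KJ (vertex-end h))))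
        (trans (total (J (vertex-end h))) (cong cp (KJ (vertex-end h))))))
      load-kinds : ∀ v → FL.load x v ≡ ∑ (λ h → 𝟙 (nd (edge-end h) ≡ᵇ v) * u h)
        + (∑ (λ h → 𝟙 (nd (vertex-end h) ≡ᵇ v) * z h) + ∑ (λ h → 𝟙 (nd (face-end h) ≡ᵇ v) * x (J (face-end h))))
      load-kinds v = sum-kinds _ (λ k → 𝟙 (nd k ≡ᵇ v) * x (J k)) (λ k → cong (λ y → 𝟙 (y ≡ᵇ v) * x (J k)) (node-J k))
      apart : ∀ i j → ((i Fin.↑ˡ n) ≡ᵇ (n Fin.↑ʳ j)) ≡ false
      apart i j = ≡ᵇ-false (↑ˡ≢↑ʳ {i} {j})
      apart' : ∀ j i → ((n Fin.↑ʳ j) ≡ᵇ (i Fin.↑ˡ n)) ≡ false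
      apart' j i = ≡ᵇ-false (λ e → ↑ˡ≢↑ʳ {i} {j} (sym e))
      rep-V : ∀ g h → ((V.rep g Fin.↑ˡ n) ≡ᵇ (V.rep h Fin.↑ˡ n)) ≡ V.in? h g
      rep-V g h = ⇔⇒≡ (λ e → V.in?-true (V.~-sym (V.~-trans V.~-rep (V.~-trans (V.~-reflexive (Finₚ.↑ˡ-injective n _ _ (≡ᵇ-sound e))) (V.~-sym V.~-rep)))))
        (λ e → ⌊⌋-true (_ Finₚ.≟ _) (cong (Fin._↑ˡ n) (V.rep-cong (V.~-sym (V.in?-sound e)))))
      rep-F : ∀ g h → ((n Fin.↑ʳ F.rep g) ≡ᵇ (n Fin.↑ʳ F.rep h)) ≡ F.in? h g
      rep-F g h = ⇔⇒≡ (λ e → F.in?-true (F.~-sym (F.~-trans F.~-rep (F.~-trans (F.~-reflexive (Finₚ.↑ʳ-injective n _ _ (≡ᵇ-sound e))) (F.~-sym F.~-rep)))))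
        (λ e → ⌊⌋-true (_ Finₚ.≟ _) (cong (n Fin.↑ʳ_) (F.rep-cong (F.~-sym (F.in?-sound e)))))
      vertex : ∀ h → V.osum (λ g → u g + z (α g)) h ≡ B * (1ℤ - 𝟙 (outerV h))
      vertex h = trans (trans (V.osum-+ u (z ∘ α) h) (sym load-V)) (trans (loads (V.rep h Fin.↑ˡ n))
        (trans (cong [ tv , tf ]′ (Finₚ.splitAt-↑ˡ n (V.rep h) n)) (trans (cong (λ m → 𝟙 m * (B * (1ℤ - 𝟙 (outerV (V.rep h))))) (V.min?-rep h))
          (trans (ℤₚ.*-identityˡ _) (cong (λ o → B * (1ℤ - 𝟙 o)) (touch-~ (V.~-sym V.~-rep)))))))
        where
        load-V : FL.load x (V.rep h Fin.↑ˡ n) ≡ V.osum u h + V.osum (z ∘ α) h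
        load-V = trans (load-kinds _) (cong₂ _+_ (sum-cong (λ g → cong (λ i → 𝟙 i * u g) (rep-V g h)))
          (trans (cong₂ _+_ (trans (sum-cong (λ g → cong (λ i → 𝟙 i * z g) (trans (rep-V (φ g) h) (V.in?-congʳ (V.~-sym α-vertex-φ)))))
              (trans (sym (sum-α (λ g → 𝟙 (V.in? h (α g)) * z g))) (sum-cong (λ g → cong (λ y → 𝟙 (V.in? h y) * z (α g)) (α-invol g)))))
            (sum-zero (λ g → cong (λ i → 𝟙 i * x (J (face-end g))) (apart' (F.rep g) (V.rep h))))) (ℤₚ.+-identityʳ _)))
      face : ∀ h → F.osum (λ g → 1ℤ - + 2 * z g) h ≡ + 2 * B
      face h = trans (F.osum-cong (λ g _ → expand (z g))) (trans (F.osum-minus (λ g → (1ℤ - z g) + (1ℤ - z g)) (λ _ → 1ℤ) h)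
        (trans (cong₂ _-_ (trans (F.osum-+ (λ g → 1ℤ - z g) (λ g → 1ℤ - z g) h) (cong₂ _+_ load-F load-F)) (trans (F.osum-1 h) (even h)))
          (arrange (+ (faceDeg h DM./ 2)) B)))
        where
        expand : ∀ z → 1ℤ - + 2 * z ≡ ((1ℤ - z) + (1ℤ - z)) - 1ℤ
        expand = solve-∀
        arrange : ∀ d b → ((d + b) + (d + b)) - + 2 * d ≡ + 2 * b
        arrange = solve-∀
        size-rep : faceDeg (F.rep h) ≡ faceDeg h
        size-rep = ℤₚ.+-injective (trans (sym (F.osum-1 (F.rep h))) (trans (F.osum-~ (λ _ → 1ℤ) (F.~-sym F.~-rep)) (F.osum-1 h)))
        load-F : F.osum (λ g → 1ℤ - z g) h ≡ + (faceDeg h DM./ 2) + B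
        load-F = trans (sym (trans (load-kinds (n Fin.↑ʳ F.rep h)) (trans (cong₂ _+_
            (sum-zero (λ g → cong (λ i → 𝟙 i * u g) (apart (V.rep g) (F.rep h))))
            (cong₂ _+_ (sum-zero (λ g → cong (λ i → 𝟙 i * z g) (apart (V.rep (φ g)) (F.rep h)))) (sum-cong (λ g → cong₂ (λ i y → 𝟙 i * y) (rep-F g h) (other g)))))
            (trans (ℤₚ.+-identityˡ _) (ℤₚ.+-identityˡ _)))))
          (trans (loads (n Fin.↑ʳ F.rep h)) (trans (cong [ tv , tf ]′ (Finₚ.splitAt-↑ʳ n n (F.rep h)))
            (trans (cong (λ m → 𝟙 m * (+ (faceDeg (F.rep h) DM./ 2) + B)) (F.min?-rep h))
              (trans (ℤₚ.*-identityˡ _) (cong (λ d → + (d DM./ 2) + B) size-rep)))))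

-- Minimal star orientations

search : ∀ {K} n {P : Vec (Fin K) n → Set} → (∀ v → Dec (P v)) → Dec (∃ P)
search zero    P? = map′ (λ p → [] , p) (λ { ([] , p) → p }) (P? [])
search (suc n) P? = map′ (λ { (x , v , p) → x ∷ v , p }) (λ { (x ∷ v , p) → x , v , p })
  (Finₚ.any? (λ x → search n (λ v → P? (x ∷ v))))

two-terms≤sum : ∀ {n} {f : Fin n → ℤ} → (∀ i → 0ℤ ≤ f i) → ∀ {i j} → i ≢ j → f i + f j ≤ ∑ f
two-terms≤sum {n} {f} 0≤f {i} {j} i≢j = subst (_≤ ∑ f) (trans (sum-+ _ _) (cong₂ _+_ (sum-pick f i) (sum-pick f j)))
  (sum-≤ (λ k → pointwise k (k Finₚ.≟ i) (k Finₚ.≟ j)))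
  where
  arr₁ : ∀ x → 1ℤ * x + 0ℤ * x ≡ x
  arr₁ = solve-∀
  arr₂ : ∀ x → 0ℤ * x + 1ℤ * x ≡ x
  arr₂ = solve-∀
  arr₃ : ∀ x → 0ℤ * x + 0ℤ * x ≡ 0ℤ
  arr₃ = solve-∀
  pointwise : ∀ k (d : Dec (k ≡ i)) (e : Dec (k ≡ j)) → 𝟙 ⌊ d ⌋ * f k + 𝟙 ⌊ e ⌋ * f k ≤ f k
  pointwise k (yes refl) (yes refl) = ⊥-elim (i≢j refl)
  pointwise k (yes _) (no _) = ℤₚ.≤-reflexive (arr₁ (f k))
  pointwise k (no _) (yes _) = ℤₚ.≤-reflexive (arr₂ (f k))
  pointwise k (no _) (no _)  = subst (_≤ f k) (sym (arr₃ (f k))) (0≤f k)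

0≤-cases : ∀ {a} → 0ℤ ≤ a → (a ≡ 0ℤ) ⊎ (1ℤ ≤ a)
0≤-cases {+ zero}  _ = inj₁ refl
0≤-cases {+ suc k} _ = inj₂ (+≤+ (s≤s z≤n))

unit-cases : ∀ {a} → 0ℤ ≤ a → a ≤ 1ℤ → (a ≡ 0ℤ) ⊎ (a ≡ 1ℤ)
unit-cases l u = [ inj₁ , (λ g → inj₂ (ℤₚ.≤-antisym u g)) ]′ (0≤-cases l)

1≰0 : ¬ 1ℤ ≤ 0ℤ
1≰0 (+≤+ ())

1≢0 : 1ℤ ≢ 0ℤ
1≢0 ()

module StarMinimal {n : ℕ} (PM : PlaneMap n) (b : ℕ) (deg : PlaneMap.outerDeg PM ≡ 2 ℕ.* b)
  (girth : PlaneMap.HasGirth PM (2 ℕ.* b)) (1≤b : 1 ℕ.≤ b)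
  (even : ∀ h → + PlaneMap.faceDeg PM h ≡ + 2 * + (PlaneMap.faceDeg PM h DM./ 2)) where
  open PlaneMap PM
  open Regions PM
  open Contour PM b deg girth
  open Hall PM b deg girth using (B; 0≤B)
  open StarMap PM b deg girth 1≤b even

  -- The set A of triangles of the star map can be pushed: every edge of its
  -- boundary carries weight that can be moved counterclockwise around A.
  record Flippable (u z : Fin n → ℤ) (A : Fin n → Bool) : Set where
    field
      across   : ∀ h → A h ≡ true → A (α h) ≡ false → 1ℤ ≤ u h
      leave    : ∀ h → A h ≡ true → A (φ h) ≡ false → z h ≡ 1ℤ
      enter    : ∀ h → A h ≡ false → A (φ h) ≡ true → z h ≡ 0ℤ
      avoids   : A root ≡ false
      nonempty : ∃[ h ] (A h ≡ true)

  -- The change is a coboundary of a function on triangles, so it cancels over the two ends of an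
  -- edge, around a face and around a vertex; only the bounds on `u` and `z` have to be asked for.
  shift : ∀ {u z} → StarOrientation u z → (p : Fin n → ℤ) →
    (∀ h → 0ℤ ≤ u h + (p (α h) - p h)) → (∀ h → 0ℤ ≤ z h + (p (φ h) - p h)) → (∀ h → z h + (p (φ h) - p h) ≤ 1ℤ) →
    StarOrientation (λ h → u h + (p (α h) - p h)) (λ h → z h + (p (φ h) - p h))
  shift {u} {z} S p 0≤u' 0≤z' z'≤1 = record
    { 0≤u = 0≤u' ; 0≤z = 0≤z' ; z≤1 = z'≤1
    ; edge = λ h → trans (cong (λ x → (u h + (p (α h) - p h)) + (u (α h) + (p x - p (α h)))) (α-invol h))
        (trans (cancel (u h) (u (α h)) (p h) (p (α h))) (S.edge h))
    ; face = λ h → trans (F.osum-cong (λ g _ → arrange (z g) (p (φ g)) (p g))) (trans (F.osum-minus _ _ h)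
        (trans (cong₂ _-_ (S.face h) (telescope h)) (ℤₚ.+-identityʳ _)))
    ; vertex = λ h → trans (V.osum-cong (λ g _ → trans (arrange' (u g) (z (α g)) (p (α g)) (p g) (p (φ (α g))))
          (cong (λ x → (u g + z (α g)) + (p x - p g)) (φα≡σ g))))
        (trans (V.osum-+ _ _ h) (trans (cong₂ _+_ (S.vertex h) (trans (V.osum-minus (p ∘ σ) p h)
          (trans (cong (_- V.osum p h) (V.osum-π p h)) (ℤₚ.+-inverseʳ (V.osum p h))))) (ℤₚ.+-identityʳ _)))
    }
    where
    module S = StarOrientation S
    cancel : ∀ u u' a b → (u + (b - a)) + (u' + (a - b)) ≡ u + u'
    cancel = solve-∀
    arrange : ∀ z a b → 1ℤ - + 2 * (z + (a - b)) ≡ (1ℤ - + 2 * z) - ((a + a) - (b + b))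
    arrange = solve-∀
    arrange' : ∀ u z a b c → (u + (a - b)) + (z + (c - a)) ≡ (u + z) + (c - b)
    arrange' = solve-∀
    telescope : ∀ h → F.osum (λ g → (p (φ g) + p (φ g)) - (p g + p g)) h ≡ 0ℤ
    telescope h = trans (F.osum-minus (λ g → p (φ g) + p (φ g)) (λ g → p g + p g) h)
      (trans (cong (_- F.osum (λ g → p g + p g) h) (F.osum-π (λ g → p g + p g) h)) (ℤₚ.+-inverseʳ (F.osum (λ g → p g + p g) h)))

  private
    diff-cases : ∀ {x a a'} → 0ℤ ≤ x → (a ≡ true → a' ≡ false → 1ℤ ≤ x) → 0ℤ ≤ x + (𝟙 a' - 𝟙 a)
    diff-cases {x} {true}  {true}  l _ = subst (0ℤ ≤_) (sym (ℤₚ.+-identityʳ x)) l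
    diff-cases {x} {true}  {false} l k = gap (k refl refl)
    diff-cases {x} {false} {true}  l _ = l ⊞ 0≤+
    diff-cases {x} {false} {false} l _ = subst (0ℤ ≤_) (sym (ℤₚ.+-identityʳ x)) l

    diff-cases' : ∀ {x a a'} → x ≤ 1ℤ → (a ≡ false → a' ≡ true → x ≡ 0ℤ) → x + (𝟙 a' - 𝟙 a) ≤ 1ℤ
    diff-cases' {x} {true}  {true}  l _ = subst (_≤ 1ℤ) (sym (ℤₚ.+-identityʳ x)) l
    diff-cases' {x} {true}  {false} l _ = ℤₚ.≤-trans (ℤₚ.+-monoʳ-≤ x (-≤+ {0} {0})) (subst (_≤ 1ℤ) (sym (ℤₚ.+-identityʳ x)) l)
    diff-cases' {x} {false} {true}  l k = subst (λ y → y + (1ℤ - 0ℤ) ≤ 1ℤ) (sym (k refl refl)) ℤₚ.≤-refl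
    diff-cases' {x} {false} {false} l _ = subst (_≤ 1ℤ) (sym (ℤₚ.+-identityʳ x)) l

  push : ∀ {u z A} → StarOrientation u z → Flippable u z A →
    StarOrientation (λ h → u h + (𝟙 (A (α h)) - 𝟙 (A h))) (λ h → z h + (𝟙 (A (φ h)) - 𝟙 (A h)))
  push {u} {z} {A} S fl = shift S (λ h → 𝟙 (A h)) (λ h → diff-cases (0≤u h) (across h))
    (λ h → diff-cases (0≤z h) (λ a f → ℤₚ.≤-reflexive (sym (leave h a f)))) (λ h → diff-cases' (z≤1 h) (enter h))
    where
    open StarOrientation S
    open Flippable fl

  Good : (u z : Fin n → ℤ) → Set
  Good u z = StarOrientation u z × (∀ A → ¬ Flippable u z A)

  module _ {u z : Fin n → ℤ} (S : StarOrientation u z) where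
    open StarOrientation S

    u≤B : ∀ h → u h ≤ B
    u≤B h = ℤₚ.≤-trans (≤-by (0≤u (α h)) (trans (back (u h) (u (α h))) (cong (_- u h) (edge h)))) (cases (innerE h))
      where
      back : ∀ a b → b ≡ (a + b) - a
      back = solve-∀
      cases : ∀ i → (B - 1ℤ) * 𝟙 i ≤ B
      cases true  = ≤-by (0≤+ {1}) (sym (arrange B))
        where
        arrange : ∀ b → b - ((b - 1ℤ) * 1ℤ) ≡ 1ℤ
        arrange = solve-∀
      cases false = subst (_≤ B) (sym (ℤₚ.*-zeroʳ (B - 1ℤ))) 0≤B

  private
    steps : ∀ {g h} → Reach σ α g h → ℕ
    steps here     = 0
    steps (viaσ r) = suc (steps r)
    steps (viaα r) = suc (steps r)

  -- Each push increases the potential of the orientation, which is bounded.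
  good-exists : ¬ ¬ (Σ (Fin n → ℤ) λ u → Σ (Fin n → ℤ) λ z → Good u z)
  good-exists = do
    (u , z , S) ← star-exists
    From.climb u z S (suc ∣ C ∣) u z S (λ _ → 0ℤ) refl (λ h → sym (ℤₚ.+-identityʳ _)) (λ h → sym (ℤₚ.+-identityʳ _))
      (ℤₚ.≤-<-trans (ℤₚ.≤-reflexive (trans (cong (_-_ C) (sum-zero {n} {λ _ → 0ℤ} (λ _ → refl))) (trans (ℤₚ.+-identityʳ C) (sym (ℤₚ.0≤i⇒+∣i∣≡i 0≤C))))) (+<+ ℕₚ.≤-refl))
    where
    C : ℤ
    C = ∑ (λ h → + steps (connected root h) * (B + 1ℤ))
    0≤C : 0ℤ ≤ C
    0≤C = sum-nonneg (λ h → 0≤+ {steps (connected root h)} ⊠ (0≤B ⊞ 0≤+ {1}))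
    module From (u₀ z₀ : Fin n → ℤ) (S₀ : StarOrientation u₀ z₀) where
      module S₀ = StarOrientation S₀
      module Bound (u z : Fin n → ℤ) (S : StarOrientation u z) (p : Fin n → ℤ) (p₀ : p root ≡ 0ℤ)
        (ru : ∀ h → u h ≡ u₀ h + (p (α h) - p h)) (rz : ∀ h → z h ≡ z₀ h + (p (φ h) - p h)) where
        next-multiple : ∀ s c → s * c + c ≡ (1ℤ + s) * c
        next-multiple = solve-∀
        arr-α : ∀ b u a c → ((b - (u + (a - c))) + u) + 1ℤ ≡ (c + (b + 1ℤ)) - a
        arr-α = solve-∀
        arr-σ : ∀ b u a c z s → (((b - (u + (a - c))) + u) + (1ℤ - (z + (s - a)))) + z ≡ (c + (b + 1ℤ)) - s
        arr-σ = solve-∀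
        -- Crossing an old edge raises `p` by at most `B` and crossing a new one by at most 1,
        -- because the values on both stay bounded. With `p` pinned to 0 at the root, each step of a
        -- path allows `B + 1`.
        up-α : ∀ g → p (α g) ≤ p g + (B + 1ℤ)
        up-α g = ≤-by (gap (u≤B S g) ⊞ S₀.0≤u g ⊞ 0≤+ {1})
          (trans (cong (λ x → ((B - x) + u₀ g) + 1ℤ) (ru g)) (arr-α B (u₀ g) (p (α g)) (p g)))
        up-σ : ∀ g → p (σ g) ≤ p g + (B + 1ℤ)
        up-σ g = ≤-by (gap (u≤B S g) ⊞ S₀.0≤u g ⊞ gap (StarOrientation.z≤1 S (α g)) ⊞ S₀.0≤z (α g))
          (trans (cong₂ (λ x y → (((B - x) + u₀ g) + (1ℤ - y)) + z₀ (α g)) (ru g)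
              (trans (rz (α g)) (cong (λ x → z₀ (α g) + (p x - p (α g))) (φα≡σ g))))
            (arr-σ B (u₀ g) (p (α g)) (p g) (z₀ (α g)) (p (σ g))))
        bound : ∀ {h} (r : Reach σ α root h) → p h ≤ + steps r * (B + 1ℤ)
        extend : ∀ {g h} (r : Reach σ α root g) → p h ≤ p g + (B + 1ℤ) → p h ≤ + suc (steps r) * (B + 1ℤ)
        extend r up = ℤₚ.≤-trans up (ℤₚ.≤-trans (ℤₚ.+-monoˡ-≤ (B + 1ℤ) (bound r)) (ℤₚ.≤-reflexive (next-multiple (+ steps r) (B + 1ℤ))))
        bound here         = ℤₚ.≤-reflexive p₀
        bound (viaα {g} r) = extend {g} {α g} r (up-α g)
        bound (viaσ {g} r) = extend {g} {σ g} r (up-σ g)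
      -- `p` counts how often each triangle has been pushed, and `k` bounds the distance of its
      -- total from the upper bound `C`.
      climb : ∀ k u z → StarOrientation u z → ∀ p → p root ≡ 0ℤ → (∀ h → u h ≡ u₀ h + (p (α h) - p h)) → (∀ h → z h ≡ z₀ h + (p (φ h) - p h)) →
        C - ∑ p < + k → ¬ ¬ (Σ (Fin n → ℤ) λ u → Σ (Fin n → ℤ) λ z → Good u z)
      climb zero u z S p p₀ ru rz lt = ⊥-elim (ℤₚ.<⇒≱ lt (gap (sum-≤ (λ h → Bound.bound u z S p p₀ ru rz (connected root h)))))
      climb (suc k) u z S p p₀ ru rz lt ¬good = ¬good (u , z , S , λ A fl →
        climb k _ _ (push S fl) (λ h → p h + 𝟙 (A h)) (cong₂ _+_ p₀ (cong 𝟙 (Flippable.avoids fl)))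
          (λ h → trans (cong (_+ (𝟙 (A (α h)) - 𝟙 (A h))) (ru h)) (merge (u₀ h) (p (α h)) (p h) (𝟙 (A (α h))) (𝟙 (A h))))
          (λ h → trans (cong (_+ (𝟙 (A (φ h)) - 𝟙 (A h))) (rz h)) (merge (z₀ h) (p (φ h)) (p h) (𝟙 (A (φ h))) (𝟙 (A h))))
          (smaller A (Flippable.nonempty fl)) ¬good)
        where
        merge : ∀ u a b c d → (u + (a - b)) + (c - d) ≡ u + ((a + c) - (b + d))
        merge = solve-∀
        smaller : ∀ A → ∃[ h ] (A h ≡ true) → C - ∑ (λ h → p h + 𝟙 (A h)) < + k
        smaller A (h , Ah) = ℤₚ.suc[i]≤j⇒i<j (≤-by (gap (<⇒1≤- lt) ⊞ gap (ℤₚ.≤-trans (ℤₚ.≤-reflexive (cong 𝟙 (sym Ah))) (term≤sum (λ h → 0≤𝟙 (A h)) h)))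
          (trans (arrange C (∑ p) (+ k) (∑ (λ h → 𝟙 (A h)))) (cong (λ s → + k - (1ℤ + (C - s))) (sym (sum-+ p (λ h → 𝟙 (A h)))))))
          where
          arrange : ∀ c p k a → (((1ℤ + k) - (c - p)) - 1ℤ) + (a - 1ℤ) ≡ k - (1ℤ + (c - (p + a)))
          arrange = solve-∀

-- A minimal star orientation by finite search, and its local structure

module GoodOrientation {n : ℕ} (PM : PlaneMap n) (b : ℕ) (deg : PlaneMap.outerDeg PM ≡ 2 ℕ.* b)
  (girth : PlaneMap.HasGirth PM (2 ℕ.* b)) (1≤b : 1 ℕ.≤ b)
  (even : ∀ h → + PlaneMap.faceDeg PM h ≡ + 2 * + (PlaneMap.faceDeg PM h DM./ 2)) where
  open PlaneMap PM
  open Regions PM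
  open Contour PM b deg girth
  open Hall PM b deg girth using (B; 0≤B)
  open StarMap PM b deg girth 1≤b even
  open StarMinimal PM b deg girth 1≤b even

  private
    bit : Fin 2 → Bool
    bit Fin.zero    = false
    bit (Fin.suc _) = true

    unbit : Bool → Fin 2
    unbit false = Fin.zero
    unbit true  = Fin.suc Fin.zero

    bit-unbit : ∀ c → bit (unbit c) ≡ c
    bit-unbit true  = refl
    bit-unbit false = refl

    star-cong : ∀ {u u' z z'} → (∀ h → u h ≡ u' h) → (∀ h → z h ≡ z' h) → StarOrientation u z → StarOrientation u' z'
    star-cong {u} {u'} {z} {z'} eu ez S = record
      { 0≤u = λ h → subst (0ℤ ≤_) (eu h) (0≤u h)
      ; 0≤z = λ h → subst (0ℤ ≤_) (ez h) (0≤z h)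
      ; z≤1 = λ h → subst (_≤ 1ℤ) (ez h) (z≤1 h)
      ; edge = λ h → trans (sym (cong₂ _+_ (eu h) (eu (α h)))) (edge h)
      ; face = λ h → trans (F.osum-cong (λ g _ → cong (λ y → 1ℤ - + 2 * y) (sym (ez g)))) (face h)
      ; vertex = λ h → trans (V.osum-cong (λ g _ → sym (cong₂ _+_ (eu g) (ez (α g))))) (vertex h)
      }
      where open StarOrientation S

    flip-cong : ∀ {u u' z z' A A'} → (∀ h → u h ≡ u' h) → (∀ h → z h ≡ z' h) → (∀ h → A h ≡ A' h) → Flippable u z A → Flippable u' z' A'
    flip-cong eu ez eA fl = record
      { across = λ h a f → subst (1ℤ ≤_) (eu h) (across h (trans (eA h) a) (trans (eA (α h)) f))
      ; leave = λ h a f → trans (sym (ez h)) (leave h (trans (eA h) a) (trans (eA (φ h)) f))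
      ; enter = λ h a f → trans (sym (ez h)) (enter h (trans (eA h) a) (trans (eA (φ h)) f))
      ; avoids = trans (sym (eA root)) avoids
      ; nonempty = proj₁ nonempty , trans (sym (eA _)) (proj₂ nonempty)
      }
      where open Flippable fl

    star? : ∀ u z → Dec (StarOrientation u z)
    star? u z = map′
      (λ { (a , c , d , e , f , g) → record { 0≤u = a ; 0≤z = c ; z≤1 = d ; edge = e ; face = f ; vertex = g } })
      (λ S → let open StarOrientation S in 0≤u , 0≤z , z≤1 , edge , face , vertex)
      (Finₚ.all? (λ h → 0ℤ ℤ.≤? u h) ×-dec Finₚ.all? (λ h → 0ℤ ℤ.≤? z h) ×-dec Finₚ.all? (λ h → z h ℤ.≤? 1ℤ)
        ×-dec Finₚ.all? (λ h → _ ℤ.≟ _) ×-dec Finₚ.all? (λ h → _ ℤ.≟ _) ×-dec Finₚ.all? (λ h → _ ℤ.≟ _))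

    flippable? : ∀ u z A → Dec (Flippable u z A)
    flippable? u z A = map′
      (λ { (a , c , d , e , f) → record { across = a ; leave = c ; enter = d ; avoids = e ; nonempty = f } })
      (λ fl → let open Flippable fl in across , leave , enter , avoids , nonempty)
      (Finₚ.all? (λ h → (A h Boolₚ.≟ true) →-dec ((A (α h) Boolₚ.≟ false) →-dec (1ℤ ℤ.≤? u h)))
        ×-dec Finₚ.all? (λ h → (A h Boolₚ.≟ true) →-dec ((A (φ h) Boolₚ.≟ false) →-dec (z h ℤ.≟ 1ℤ)))
        ×-dec Finₚ.all? (λ h → (A h Boolₚ.≟ false) →-dec ((A (φ h) Boolₚ.≟ true) →-dec (z h ℤ.≟ 0ℤ)))
        ×-dec (A root Boolₚ.≟ false) ×-dec Finₚ.any? (λ h → A h Boolₚ.≟ true))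

    value : ∀ {K} → Vec (Fin K) n → Fin n → ℤ
    value v h = + toℕ (lookup v h)

    set : Vec (Fin 2) n → Fin n → Bool
    set a h = bit (lookup a h)

    encode : ∀ K (f : Fin n → ℤ) → (∀ h → 0ℤ ≤ f h) → (∀ h → f h ≤ + K) → Σ (Vec (Fin (suc K)) n) λ v → ∀ h → f h ≡ value v h
    encode K f 0≤f f≤K = tabulate code , λ h → trans (sym (ℤₚ.0≤i⇒+∣i∣≡i (0≤f h)))
        (cong +_ (trans (sym (Finₚ.toℕ-fromℕ< (bound h))) (cong toℕ (sym (lookup∘tabulate code h)))))
      where
      bound : ∀ h → ∣ f h ∣ ℕ.< suc K
      bound h = s≤s (ℤₚ.drop‿+≤+ (subst (_≤ + K) (sym (ℤₚ.0≤i⇒+∣i∣≡i (0≤f h))) (f≤K h)))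
      code : Fin n → Fin (suc K)
      code h = Fin.fromℕ< (bound h)

    Code : Vec (Fin (suc b)) n → Vec (Fin 2) n → Set
    Code v v' = StarOrientation (value v) (value v') × ¬ (∃[ a ] Flippable (value v) (value v') (set a))

    code? : Dec (∃[ v ] ∃[ v' ] Code v v')
    code? = search n (λ v → search n (λ v' → star? (value v) (value v') ×-dec
      ¬? (search n (λ a → flippable? (value v) (value v') (set a)))))

  opaque
    -- The values of `u` and `z` are bounded, so there are finitely many candidates, and the absence
    -- of a flippable set is decidable by a further search. The double negation can thus be removed.
    good : Σ (Fin n → ℤ) λ u → Σ (Fin n → ℤ) λ z → Good u z
    good = decode (decidable-stable code? (do
      (u , z , S , nofl) ← good-exists
      let open StarOrientation S
          (v , ev) = encode b u 0≤u (u≤B S)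
          (v' , ev') = encode 1 z 0≤z z≤1
      return (v , v' , star-cong ev ev' S , λ { (a , fl) → nofl (set a) (flip-cong (λ h → sym (ev h)) (λ h → sym (ev' h)) (λ _ → refl) fl) })))
      where
      decode : ∃[ v ] ∃[ v' ] Code v v' → Σ (Fin n → ℤ) λ u → Σ (Fin n → ℤ) λ z → Good u z
      decode (v , v' , S , none) = value v , value v' , S , λ A fl → none (tabulate (λ h → unbit (A h)) ,
        flip-cong (λ _ → refl) (λ _ → refl) (λ h → sym (trans (cong bit (lookup∘tabulate (λ h → unbit (A h)) h)) (bit-unbit (A h)))) fl)

  module Weights (u z : Fin n → ℤ) (G : Good u z) where
    open StarOrientation (proj₁ G) public

    z-cases : ∀ h → (z h ≡ 0ℤ) ⊎ (z h ≡ 1ℤ)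
    z-cases h = unit-cases (0≤z h) (z≤1 h)

    -- The root face has degree `2b`, so its face condition leaves no unit to give away.
    z-root : ∀ {h} → rt h ≡ true → z h ≡ 0ℤ
    z-root t = F.osum≡0⇒term≡0 0≤z total (F.in?-sound t)
      where
      double : ∀ x → 1ℤ - + 2 * x ≡ 1ℤ - (x + x)
      double = solve-∀
      solve-z : ∀ {d x} → d - (x + x) ≡ d → x ≡ 0ℤ
      solve-z {d} {x} e = ℤₚ.*-cancelˡ-≡ (+ 2) x 0ℤ (trans (arrange d x) (trans (cong (λ y → d - y) e) (ℤₚ.+-inverseʳ d)))
        where
        arrange : ∀ d x → + 2 * x ≡ d - (d - (x + x))
        arrange = solve-∀
      total : F.osum z root ≡ 0ℤ
      total = solve-z {+ 2 * B} (trans (cong (_- (F.osum z root + F.osum z root)) (sym (trans (F.osum-1 root) (trans (cong +_ deg) (ℤₚ.pos-* 2 b)))))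
        (trans (cong (_-_ (F.osum (λ _ → 1ℤ) root)) (sym (F.osum-+ z z root))) (trans (sym (F.osum-minus (λ _ → 1ℤ) (λ g → z g + z g) root))
          (trans (F.osum-cong (λ g _ → sym (double (z g)))) (face root)))))

    private
      terms : Fin n → ℤ
      terms g = u g + z (α g)
      0≤terms : ∀ g → 0ℤ ≤ terms g
      0≤terms g = 0≤u g ⊞ 0≤z (α g)
      vanish : ∀ {g} → terms g ≡ 0ℤ → (u g ≡ 0ℤ) × (z (α g) ≡ 0ℤ)
      vanish {g} e = ℤₚ.≤-antisym (subst (u g ≤_) e (≤-by (0≤z (α g)) (sym (left (u g) (z (α g)))))) (0≤u g) ,
                     ℤₚ.≤-antisym (subst (z (α g) ≤_) e (≤-by (0≤u g) (sym (right (u g) (z (α g)))))) (0≤z (α g))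
        where
        left : ∀ a b → (a + b) - a ≡ b
        left = solve-∀
        right : ∀ a b → (a + b) - b ≡ a
        right = solve-∀

    at-outer : ∀ {h} → outerV h ≡ true → (u h ≡ 0ℤ) × (z (α h) ≡ 0ℤ)
    at-outer {h} o = vanish (V.osum≡0⇒term≡0 0≤terms (trans (vertex h) (trans (cong (λ c → B * (1ℤ - 𝟙 c)) o) (ℤₚ.*-zeroʳ B))) V.~-refl)

    z-inner : ∀ {h} → z h ≡ 1ℤ → (rt h ≡ false) × (rt (α h) ≡ false)
    z-inner {h} e = ¬true⇒false (λ t → 1≢0 (trans (sym e) (z-root t))) ,
      ¬true⇒false (λ t → 1≢0 (trans (sym e) (trans (cong z (sym (α-invol h))) (proj₂ (at-outer (rt⇒outerV t))))))

    z-innerE : ∀ {h} → z h ≡ 1ℤ → innerE h ≡ true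
    z-innerE e = cong not (∨-false (proj₁ (z-inner e)) (proj₂ (z-inner e)))

    -- The old edge gives all of its `b - 1` to the vertex of `α h` and the new edge gives 1: this
    -- is already the whole weight `b` of a vertex, so nothing remains for the others.
    saturated : ∀ {h} → z h ≡ 1ℤ → u h ≡ 0ℤ → ∀ {g} → α h V.~ g → g ≢ α h → (u g ≡ 0ℤ) × (z (α g) ≡ 0ℤ)
    saturated {h} ez eu {g} e g≢ = vanish (ℤₚ.≤-antisym (ℤₚ.≤-trans (≤-by (gap bound)
        (trans (cong (λ y → B * (1ℤ - 𝟙 o) - (y + terms g)) full) (arrange B (𝟙 o) (terms g)))) slack) (0≤terms g))
      where
      o = outerV (α h)
      arrange : ∀ b o t → b * (1ℤ - o) - (b + t) ≡ (0ℤ - b * o) - t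
      arrange = solve-∀
      slack : 0ℤ - B * 𝟙 o ≤ 0ℤ
      slack = ≤-by (0≤B ⊠ 0≤𝟙 o) (sym (arr (B * 𝟙 o)))
        where
        arr : ∀ x → 0ℤ - (0ℤ - x) ≡ x
        arr = solve-∀
      full : terms (α h) ≡ B
      full = trans (cong₂ _+_ uα (trans (cong z (α-invol h)) ez)) (arr B)
        where
        arr : ∀ b → (b - 1ℤ) + 1ℤ ≡ b
        arr = solve-∀
        uα : u (α h) ≡ B - 1ℤ
        uα = trans (sym (ℤₚ.+-identityˡ _)) (trans (cong (_+ u (α h)) (sym eu)) (trans (edge h) (trans (cong (λ i → (B - 1ℤ) * 𝟙 i) (z-innerE ez)) (ℤₚ.*-identityʳ _))))
      bound : terms (α h) + terms g ≤ B * (1ℤ - 𝟙 o)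
      bound = subst₂ _≤_ (cong₂ _+_ (one V.~-refl) (one e)) (vertex (α h))
        (two-terms≤sum {f = λ x → 𝟙 (V.in? (α h) x) * terms x} (λ x → 0≤𝟙 (V.in? (α h) x) ⊠ 0≤terms x) (λ q → g≢ (sym q)))
        where
        one : ∀ {x} → α h V.~ x → 𝟙 (V.in? (α h) x) * terms x ≡ terms x
        one {x} t = trans (cong (λ i → 𝟙 i * terms x) (V.in?-true t)) (ℤₚ.*-identityˡ _)

    private
      -- The triangles leading to `h` around its face through full units, and the same beyond the
      -- edge when a unit also crosses it in the opposite direction.
      data Run (h : Fin n) : Fin n → Set where
        first  : Run h h
        second : z (α h) ≡ 1ℤ → Run h (α h)
        back   : ∀ {g} → Run h (φ g) → z g ≡ 1ℤ → Run h g

    -- Otherwise the `Run` of `h` could be pushed. Its front edge can be crossed by assumption.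
    -- Farther back, an edge with nothing to give would saturate its far vertex, where the next
    -- triangle of the run already finds weight.
    transfer : ∀ {h} → z h ≡ 1ℤ → (u h ≡ 0ℤ) × (z (α h) ≡ 0ℤ)
    transfer {h} ez = [ (λ eu → [ (λ e → eu , e) , (λ e → ⊥-elim (push-run (inj₂ e))) ]′ (z-cases (α h))) ,
                        (λ 1≤u → ⊥-elim (push-run (inj₁ 1≤u))) ]′ (0≤-cases (0≤u h))
      where
      full : ∀ {g} → Run h g → z g ≡ 1ℤ
      full first      = ez
      full (second e) = e
      full (back _ e) = e
      push-run : (1ℤ ≤ u h) ⊎ (z (α h) ≡ 1ℤ) → ⊥
      push-run excess = classify (Run h) (λ { (A , dA) → proj₂ G A (flippable A dA) })
        where
        crossing : ∀ {g} → Run h g → (1ℤ ≤ u g) ⊎ Run h (α g)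
        crossing first = [ inj₁ , (λ e → inj₂ (second e)) ]′ excess
        crossing (second e) = inj₂ (subst (Run h) (sym (α-invol h)) first)
        crossing {g} (back r e) = cases (0≤-cases (0≤u g)) (φ g Finₚ.≟ α g) (crossing r)
          where
          cases : (u g ≡ 0ℤ) ⊎ (1ℤ ≤ u g) → Dec (φ g ≡ α g) → (1ℤ ≤ u (φ g)) ⊎ Run h (α (φ g)) → (1ℤ ≤ u g) ⊎ Run h (α g)
          cases (inj₂ 1≤) _ _ = inj₁ 1≤
          -- A far vertex of degree one: the next triangle of the run is the other side of the same
          -- edge, so the edge is not on the border of the run.
          cases (inj₁ _) (yes q) _ = inj₂ (subst (Run h) q r)
          cases (inj₁ eu) (no q) (inj₁ 1≤) = ⊥-elim (1≰0 (subst (1ℤ ≤_) (proj₁ (saturated e eu α-vertex-φ q)) 1≤))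
          cases (inj₁ eu) (no q) (inj₂ r') = ⊥-elim (1≢0 (trans (sym (full r')) (proj₂ (saturated e eu α-vertex-φ q))))
        flippable : ∀ A → Decides (Run h) A → Flippable u z A
        flippable A dA = record
          { across = across'
          ; leave = λ g a _ → full (sound a)
          ; enter = enter'
          ; avoids = reject avoid'
          ; nonempty = h , complete first
          }
          where
          open Decides dA
          across' : ∀ g → A g ≡ true → A (α g) ≡ false → 1ℤ ≤ u g
          across' g a f = [ (λ l → l) , (λ r → ⊥-elim (refute f r)) ]′ (crossing (sound a))
          enter' : ∀ g → A g ≡ false → A (φ g) ≡ true → z g ≡ 0ℤ
          enter' g f a = [ (λ e → e) , (λ e → ⊥-elim (refute f (back (sound a) e))) ]′ (z-cases g)
          avoid' : ¬ Run h root
          avoid' r = 1≢0 (trans (sym (full r)) (z-root {root} (F.in?-true {root} {root} F.~-refl)))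

-- From star orientations to weights on half-edges

module Transfer {n : ℕ} (PM : PlaneMap n) (b : ℕ) (deg : PlaneMap.outerDeg PM ≡ 2 ℕ.* b)
  (girth : PlaneMap.HasGirth PM (2 ℕ.* b)) (1≤b : 1 ℕ.≤ b)
  (even : ∀ h → + PlaneMap.faceDeg PM h ≡ + 2 * + (PlaneMap.faceDeg PM h DM./ 2))
  (u z : Fin n → ℤ) (G : StarMinimal.Good PM b deg girth 1≤b even u z) where
  open PlaneMap PM
  open Regions PM
  open Contour PM b deg girth
  open Hall PM b deg girth using (B; 0≤B)
  open StarMinimal PM b deg girth 1≤b even using (Flippable)
  open GoodOrientation PM b deg girth 1≤b even
  open Weights u z G

  -- A unit that crosses the edge of `h` is subtracted at `h` and added at `α h`, whose vertex
  -- receives it. The last term directs the outer cycle clockwise.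
  w : ZBiorientation n
  w h = u h + z (α h) - z h + 𝟙 (rt h)

  w-negative : ∀ {h} → z h ≡ 1ℤ → w h ≡ -1ℤ
  w-negative {h} e = cong₂ _+_ (cong₂ _-_ (cong₂ _+_ (proj₁ (transfer e)) (proj₂ (transfer e))) e) (cong 𝟙 (proj₁ (z-inner e)))

  w-nonneg : ∀ {h} → z h ≡ 0ℤ → rt h ≡ false → w h ≡ u h + z (α h)
  w-nonneg {h} e f = trans (cong₂ (λ x y → u h + z (α h) - x + 𝟙 y) e f) (arrange (u h + z (α h)))
    where
    arrange : ∀ a → a - 0ℤ + 0ℤ ≡ a
    arrange = solve-∀

  w-root : ∀ {h} → rt h ≡ true → w h ≡ 1ℤ
  w-root {h} t = cong₂ _+_ (cong₂ _-_ (cong₂ _+_ (proj₁ (at-outer (rt⇒outerV t))) (proj₂ (at-outer (rt⇒outerV t)))) (z-root t)) (cong 𝟙 t)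

  w-root-α : ∀ {h} → rt h ≡ true → w (α h) ≡ 0ℤ
  w-root-α {h} t = cong₂ _+_ (cong₂ _-_ (cong₂ _+_ (proj₁ (at-outer (outerV-root-α t))) (proj₂ (at-outer (outerV-root-α t))))
    (proj₂ (at-outer (rt⇒outerV t)))) (cong 𝟙 (outer-α t))

  private
    0≰-1 : ¬ 0ℤ ≤ -1ℤ
    0≰-1 ()

    0<1 : 0ℤ < 1ℤ
    0<1 = +<+ (s≤s z≤n)

  outgoing-cases : ∀ h → Outgoing PM w h → (w h ≡ 0ℤ) ⊎ (w h ≡ -1ℤ)
  outgoing-cases h out = cases (z-cases h) (bool (rt h))
    where
    cases : (z h ≡ 0ℤ) ⊎ (z h ≡ 1ℤ) → (rt h ≡ true) ⊎ (rt h ≡ false) → (w h ≡ 0ℤ) ⊎ (w h ≡ -1ℤ)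
    cases (inj₂ e) _ = inj₂ (w-negative e)
    cases (inj₁ e) (inj₁ t) = ⊥-elim (ℤₚ.<⇒≱ 0<1 (subst (_≤ 0ℤ) (w-root t) out))
    cases (inj₁ e) (inj₂ f) = inj₁ (ℤₚ.≤-antisym out (subst (0ℤ ≤_) (sym (w-nonneg e f)) (0≤u h ⊞ 0≤z (α h))))

  ingoing-part : ∀ h → rt h ≡ false → (if ingoing? PM w h then w h else 0ℤ) ≡ u h + z (α h)
  ingoing-part h f = cases (z-cases h) (0ℤ ℤ.<? w h)
    where
    cases : (z h ≡ 0ℤ) ⊎ (z h ≡ 1ℤ) → (d : Dec (0ℤ < w h)) → (if ⌊ d ⌋ then w h else 0ℤ) ≡ u h + z (α h)
    cases (inj₁ e) (yes p) = w-nonneg e f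
    cases (inj₁ e) (no ≮)  = trans (ℤₚ.≤-antisym (subst (0ℤ ≤_) (sym (w-nonneg e f)) (0≤u h ⊞ 0≤z (α h))) (ℤₚ.≮⇒≥ ≮)) (w-nonneg e f)
    cases (inj₂ e) (yes p) = ⊥-elim (0≰-1 (ℤₚ.<⇒≤ (subst (0ℤ <_) (w-negative e) p)))
    cases (inj₂ e) (no ≮)  = sym (cong₂ _+_ (proj₁ (transfer e)) (proj₂ (transfer e)))

  outgoing-part : ∀ h → rt h ≡ false → (if not (ingoing? PM w h) then w h else 0ℤ) ≡ - z h
  outgoing-part h f = cases (z-cases h) (0ℤ ℤ.<? w h)
    where
    cases : (z h ≡ 0ℤ) ⊎ (z h ≡ 1ℤ) → (d : Dec (0ℤ < w h)) → (if not ⌊ d ⌋ then w h else 0ℤ) ≡ - z h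
    cases (inj₁ e) (yes p) = sym (cong -_ e)
    cases (inj₁ e) (no ≮)  = trans (sym (ℤₚ.≤-antisym (subst (0ℤ ≤_) (sym (w-nonneg e f)) (0≤u h ⊞ 0≤z (α h))) (ℤₚ.≮⇒≥ ≮))) (sym (cong -_ e))
    cases (inj₂ e) (yes p) = ⊥-elim (0≰-1 (ℤₚ.<⇒≤ (subst (0ℤ <_) (w-negative e) p)))
    cases (inj₂ e) (no ≮)  = trans (w-negative e) (sym (cong -_ e))

  admissible : Admissible PM w
  admissible = contour-cycle ,
    (λ h r → inj₂ (w-root (F.in?-true r) , w-root-α (F.in?-true r))) ,
    λ h ih ov → subst (_≤ 0ℤ) (sym (value h ih ov)) (ℤₚ.neg-mono-≤ (0≤z h))
    where
    arrange : ∀ x → 0ℤ + 0ℤ - x + 0ℤ ≡ - x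
    arrange = solve-∀
    value : ∀ h → InnerHE h → OuterVertex h → w h ≡ - z h
    value h ih ov = trans (cong₂ (λ x y → x - z h + 𝟙 y) (cong₂ _+_ (proj₁ (at-outer (outerV-true ov))) (proj₂ (at-outer (outerV-true ov))))
      (F.in?-false (ih ∘ inj₁))) (arrange (z h))

  isBOrientation : IsBOrientation PM w b
  isBOrientation = admissible , outgoing-cases , edge-weight , vertex-weight , face-weight
    where
    edge-weight : ∀ h → InnerEdge h → w h + w (α h) ≡ + b - 1ℤ
    edge-weight h ih = trans (cong₂ (λ x y → (u h + z (α h) - z h + 𝟙 x) + (u (α h) + z (α (α h)) - z (α h) + 𝟙 y))
        (F.in?-false (ih ∘ inj₁)) (F.in?-false (ih ∘ inj₂)))
      (trans (cong (λ g → (u h + z (α h) - z h + 0ℤ) + (u (α h) + z g - z (α h) + 0ℤ)) (α-invol h))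
        (trans (arrange (u h) (u (α h)) (z h) (z (α h))) (trans (edge h) (trans (cong (λ i → (B - 1ℤ) * 𝟙 i) (innerE-true ih)) (ℤₚ.*-identityʳ _)))))
      where
      arrange : ∀ u u' z z' → (u + z' - z + 0ℤ) + (u' + z - z' + 0ℤ) ≡ u + u'
      arrange = solve-∀
    vertex-weight : ∀ h → InnerVertex h → vertexWeight PM w h ≡ + b
    vertex-weight h iv = trans (∑≡sumℤ _) (trans (sum-cong (λ g → trans (if-∧ (vertexOf? h g) (ingoing? PM w g) (w g))
        (trans (cong (λ i → 𝟙 i * (if ingoing? PM w g then w g else 0ℤ)) (V.in?≡ h g))
          (𝟙-*-cong (V.in? h g) (λ i → ingoing-part g (F.in?-false (λ r → iv (g , V.in?-sound i , r))))))))
      (trans (vertex h) (trans (cong (λ o → B * (1ℤ - 𝟙 o)) (¬true⇒false (iv ∘ outerV-sound))) (ℤₚ.*-identityʳ _))))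
    face-weight : ∀ h → InnerFace h → + (faceDeg h DM./ 2) + faceWeight PM w h ≡ + b
    face-weight h if = trans (cong (_+_ (+ (faceDeg h DM./ 2))) weight) (ℤₚ.*-cancelˡ-≡ (+ 2) _ B
      (trans (arrange (+ (faceDeg h DM./ 2)) (F.osum z h)) (trans (cong₂ _-_ (trans (sym (even h)) (sym (F.osum-1 h))) (sym (F.osum-+ z z h)))
        (trans (sym (F.osum-minus (λ _ → 1ℤ) (λ g → z g + z g) h)) (trans (F.osum-cong (λ g _ → sym (double (z g)))) (face h))))))
      where
      arrange : ∀ d s → + 2 * (d + - s) ≡ + 2 * d - (s + s)
      arrange = solve-∀
      double : ∀ x → 1ℤ - + 2 * x ≡ 1ℤ - (x + x)
      double = solve-∀
      weight : faceWeight PM w h ≡ - F.osum z h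
      weight = trans (∑≡sumℤ _) (trans (sum-cong (λ g → trans (if-∧ (faceOf? h g) (not (ingoing? PM w g)) (w g))
          (trans (cong (λ i → 𝟙 i * (if not (ingoing? PM w g) then w g else 0ℤ)) (F.in?≡ h g))
            (𝟙-*-cong (F.in? h g) (λ i → outgoing-part g (F.in?-false (λ r → if (F.~-trans r (F.~-sym (F.in?-sound i)))))))))) (F.osum-neg z h))

  -- A counterclockwise circuit would let us push the region on its left,
  -- extended beyond the circuit by the full runs of units that it crosses.
  module NoCircuit {k : ℕ} {c : Fin k → Fin n} (cyc : IsCycle k c) (trav : ∀ i → Traversable PM w (c i))
    (i₀ : Fin k) (¬left : ¬ LeftOf PM w c i₀ root) where
    open IsCycle cyc

    L : Fin n → Set
    L = LeftOf PM w c i₀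

    L-~ : ∀ {g h} → g F.~ h → L g → L h
    L-~ e (base e')        = base (F.~-trans e' e)
    L-~ e (cross l off e') = cross l off (F.~-trans e' e)

    position : ∀ g → (∃[ i ] (g ≡ c i)) ⊎ ((∃[ i ] (g ≡ α (c i))) ⊎ OffCycle cyc g)
    position g = decide (Finₚ.any? (λ i → g Finₚ.≟ c i)) (Finₚ.any? (λ i → g Finₚ.≟ α (c i)))
      where
      decide : Dec (∃[ i ] (g ≡ c i)) → Dec (∃[ i ] (g ≡ α (c i))) → (∃[ i ] (g ≡ c i)) ⊎ ((∃[ i ] (g ≡ α (c i))) ⊎ OffCycle cyc g)
      decide (yes p) _       = inj₁ p
      decide (no _)  (yes p) = inj₂ (inj₁ p)
      decide (no ¬p) (no ¬q) = inj₂ (inj₂ (λ i → (λ e → ¬p (i , e)) , (λ e → ¬q (i , e))))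

    off-α : ∀ {g} → OffCycle cyc g → OffCycle cyc (α g)
    off-α {g} off i = (λ e → proj₂ (off i) (trans (sym (α-invol g)) (cong α e))) ,
                      (λ e → proj₁ (off i) (trans (sym (α-invol g)) (trans (cong α e) (α-invol (c i)))))

    -- The turn about the vertex from the left of `c (next i)` to the arriving half-edge meets no
    -- other edge of the circuit, so the left side is carried backwards.
    left-back : ∀ i → L (α (c (next i))) → L (α (c i))
    left-back i l = from (V.~-sym (closed i))
      where
      L-σ : L (σ (c (next i)))
      L-σ = L-~ α-face-σ l
      shift-iter : ∀ j g {e} → iter σ (suc j) g ≡ e → iter σ j (σ g) ≡ e
      shift-iter j g q = trans (sym (V.iter-+ j 1 g)) (trans (cong (λ t → iter σ t g) (ℕₚ.+-comm j 1)) q)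
      rotate : ∀ j g → L g → g V.~ c (next i) → iter σ j g ≡ α (c i) → L (α (c i))
      rotate zero g lg _ e = subst L e lg
      rotate (suc j) g lg g~ e = turn (position g)
        where
        continue : L (σ g) → L (α (c i))
        continue lσ = rotate j (σ g) lσ (V.~-trans (V.~-sym V.~-π) g~) (shift-iter j g e)
        turn : (∃[ i ] (g ≡ c i)) ⊎ ((∃[ i ] (g ≡ α (c i))) ⊎ OffCycle cyc g) → L (α (c i))
        turn (inj₁ (i' , q)) = continue (subst (λ x → L (σ x)) (sym (proj₁ (at-vertex cyc i g~) i' q)) L-σ)
        turn (inj₂ (inj₁ (i' , q))) = subst L (proj₂ (at-vertex cyc i g~) i' q) lg
        turn (inj₂ (inj₂ off)) = continue (L-~ α-face-σ (cross lg off F.~-refl))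
      from : c (next i) V.~ α (c i) → L (α (c i))
      from (zero , e)  = ⊥-elim (degenerate (next i Finₚ.≟ i))
        where
        degenerate : Dec (next i ≡ i) → ⊥
        degenerate (yes q) = α-nofix (c i) (trans (sym e) (cong c q))
        degenerate (no q)  = proj₂ (eDistinct i (next i) (λ q' → q (sym q'))) e
      from (suc j , e) = rotate j (σ (c (next i))) L-σ (V.~-sym V.~-π) (shift-iter j (c (next i)) e)

    all-left : ∀ i → L (α (c i))
    all-left = prev-induction (λ i → L (α (c i))) left-back i₀ (base F.~-refl)

    L-not-root : ∀ {g} → L g → rt g ≡ false
    L-not-root l = F.in?-false (λ r → ¬left (L-~ (F.~-sym r) l))

    z-back : ∀ i → z (α (c i)) ≡ 0ℤ
    z-back i = [ (λ e → e) , (λ e → ⊥-elim (0≰-1 (ℤₚ.<⇒≤ (subst (0ℤ <_) (w-negative e) (trav i))))) ]′ (z-cases (α (c i)))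

    -- Weight at the far end of `c i` comes from the edge itself or from a unit that crosses it. In
    -- the second case the triangle beyond the circuit has to be pushed as well; this is the origin
    -- of `Run`.
    carries : ∀ i → 1ℤ ≤ u (α (c i)) + z (c i)
    carries i = 0<⇒1≤ (subst (λ x → 0ℤ < u (α (c i)) + z x) (α-invol (c i)) (subst (0ℤ <_) (w-nonneg (z-back i) (L-not-root (all-left i))) (trav i)))

    data Run : Fin n → Set where
      on-circuit : ∀ i → z (c i) ≡ 1ℤ → Run (c i)
      back       : ∀ {g} → Run (φ g) → z g ≡ 1ℤ → Run g

    full : ∀ {g} → Run g → z g ≡ 1ℤ
    full (on-circuit i e) = e
    full (back _ e)       = e

    Pushed : Fin n → Set
    Pushed g = L g ⊎ Run g

    -- The full unit at `g` saturates the vertex that `g` points to. If the circuit leaves it along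
    -- `φ g`, it must have arrived by the saturating weight, hence along `g`. If `φ g` is off the
    -- circuit, the pushed triangle across it can only be on the left, and then the face of `g` is
    -- on the left too. If `φ g` is `α g`, the run itself contains the triangle across.
    run-α : ∀ {g} → Run g → Pushed (α g)
    run-α (on-circuit i e) = inj₁ (all-left i)
    run-α {g} (back r e) = decide (φ g Finₚ.≟ α g) (position (φ g)) (run-α r)
      where
      empty : φ g ≢ α g → (u (φ g) ≡ 0ℤ) × (z (α (φ g)) ≡ 0ℤ)
      empty q = saturated e (proj₁ (transfer e)) α-vertex-φ q
      previous : ∀ j → φ g ≡ c (next j) → Pushed (α g)
      previous j q = same (α (c j) Finₚ.≟ α g)
        where
        same : Dec (α (c j) ≡ α g) → Pushed (α g)
        same (yes s) = inj₁ (subst L s (all-left j))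
        same (no s)  = ⊥-elim (1≰0 (subst (1ℤ ≤_) (cong₂ _+_ (proj₁ nothing) (trans (cong z (sym (α-invol (c j)))) (proj₂ nothing))) (carries j)))
          where
          nothing : (u (α (c j)) ≡ 0ℤ) × (z (α (α (c j))) ≡ 0ℤ)
          nothing = saturated e (proj₁ (transfer e)) (V.~-trans α-vertex-φ (V.~-trans (V.~-reflexive q) (V.~-sym (closed j)))) s
      outside : (∃[ i ] (g ≡ c i)) ⊎ ((∃[ i ] (g ≡ α (c i))) ⊎ OffCycle cyc g) → L g → Pushed (α g)
      outside (inj₁ (i , q)) l = inj₁ (subst (λ x → L (α x)) (sym q) (all-left i))
      outside (inj₂ (inj₁ (i , q))) l = ⊥-elim (1≢0 (trans (sym e) (trans (cong z q) (z-back i))))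
      outside (inj₂ (inj₂ off)) l = inj₁ (cross l off F.~-refl)
      decide : Dec (φ g ≡ α g) → (∃[ i ] (φ g ≡ c i)) ⊎ ((∃[ i ] (φ g ≡ α (c i))) ⊎ OffCycle cyc (φ g)) → Pushed (α (φ g)) → Pushed (α g)
      decide (yes q) _ _ = inj₂ (subst Run q r)
      decide (no q) (inj₁ (i , s)) _ = previous (prev i) (trans s (cong c (sym (next-prev i))))
      decide (no q) (inj₂ (inj₁ (i , s))) _ = ⊥-elim (1≢0 (trans (sym (full r)) (trans (cong z s) (z-back i))))
      decide (no q) (inj₂ (inj₂ off)) (inj₂ r') = ⊥-elim (1≢0 (trans (sym (full r')) (proj₂ (empty q))))
      decide (no q) (inj₂ (inj₂ off)) (inj₁ l) = outside (position g) (L-~ (F.~-sym F.~-π)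
        (subst L (α-invol (φ g)) (cross l (off-α off) F.~-refl)))

    contradiction : ⊥
    contradiction = classify Pushed (λ { (A , dA) → proj₂ G A (flippable A dA) })
      where
      flippable : ∀ A → Decides Pushed A → Flippable u z A
      flippable A dA = record
        { across = λ g a f → crossing g (sound a) (refute f)
        ; leave = λ g a f → leaving g (sound a) (refute f)
        ; enter = λ g f a → entering g (refute f) (sound a) (z-cases g)
        ; avoids = reject [ ¬left , (λ r → 1≢0 (trans (sym (full r)) (z-root (F.in?-true (F.~-refl {root}))))) ]′
        ; nonempty = α (c i₀) , complete (inj₁ (all-left i₀))
        }
        where
        open Decides dA
        crossing : ∀ g → Pushed g → ¬ Pushed (α g) → 1ℤ ≤ u g
        crossing g (inj₂ r) out = ⊥-elim (out (run-α r))
        crossing g (inj₁ l) out = decide (position g)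
          where
          decide : (∃[ i ] (g ≡ c i)) ⊎ ((∃[ i ] (g ≡ α (c i))) ⊎ OffCycle cyc g) → 1ℤ ≤ u g
          decide (inj₁ (i , q)) = ⊥-elim (out (inj₁ (subst (λ x → L (α x)) (sym q) (all-left i))))
          decide (inj₂ (inj₂ off)) = ⊥-elim (out (inj₁ (cross l off F.~-refl)))
          decide (inj₂ (inj₁ (i , q))) = [ (λ e → subst (λ x → 1ℤ ≤ u x) (sym q) (subst (1ℤ ≤_) (trans (cong (_+_ (u (α (c i)))) e) (ℤₚ.+-identityʳ _)) (carries i))) ,
            (λ e → ⊥-elim (out (inj₂ (subst Run (trans (sym (α-invol (c i))) (cong α (sym q))) (on-circuit i e))))) ]′ (z-cases (c i))
        leaving : ∀ g → Pushed g → ¬ Pushed (φ g) → z g ≡ 1ℤ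
        leaving g (inj₁ l) out = ⊥-elim (out (inj₁ (L-~ F.~-π l)))
        leaving g (inj₂ r) out = full r
        entering : ∀ g → ¬ Pushed g → Pushed (φ g) → (z g ≡ 0ℤ) ⊎ (z g ≡ 1ℤ) → z g ≡ 0ℤ
        entering g out (inj₁ l) _ = ⊥-elim (out (inj₁ (L-~ (F.~-sym F.~-π) l)))
        entering g out (inj₂ r) (inj₁ e) = e
        entering g out (inj₂ r) (inj₂ e) = ⊥-elim (out (inj₂ (back r e)))

  minimal : Minimal PM w
  minimal (k , c , cyc , trav , k≥1 , ¬left) = NoCircuit.contradiction cyc trav (Fin.fromℕ< k≥1) ¬left

-- Reachability and source components

module _ {n : ℕ} (I : Fin n → Bool) (E : Fin n → Fin n → Bool) where

  data Generated : Fin n → Set where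
    initial   : ∀ {h} → I h ≡ true → Generated h
    successor : ∀ {g h} → Generated g → E g h ≡ true → Generated h

  -- Saturation: each round adds an element. The decision lets accessibility be proved under a
  -- double negation.
  generated? : ∀ h → Dec (Generated h)
  generated? h = decide (saturate (suc n) I initial (λ e → e)
      (ℤₚ.≤-<-trans (ℤₚ.≤-trans (sum-≤ (λ i → 𝟙≤1 (not (I i)))) (ℤₚ.≤-reflexive (sum-1 n))) (+<+ ℕₚ.≤-refl)))
    where
    Closed : Set
    Closed = Σ (Fin n → Bool) λ A → (∀ {x} → A x ≡ true → Generated x) × (∀ {x} → I x ≡ true → A x ≡ true) ×
      (∀ {x y} → A x ≡ true → E x y ≡ true → A y ≡ true)
    saturate : ∀ k (A : Fin n → Bool) → (∀ {x} → A x ≡ true → Generated x) → (∀ {x} → I x ≡ true → A x ≡ true) →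
      ∑ (λ i → 𝟙 (not (A i))) < + k → Closed
    saturate zero A sound I⊆A lt = ⊥-elim (ℤₚ.<⇒≱ lt (sum-nonneg (λ i → 0≤𝟙 (not (A i)))))
    saturate (suc k) A sound I⊆A lt with Finₚ.any? (λ y → (A y Boolₚ.≟ false) ×-dec Finₚ.any? (λ x → (A x Boolₚ.≟ true) ×-dec (E x y Boolₚ.≟ true)))
    ... | no none = A , sound , I⊆A , λ {x} {y} a e → [ (λ t → t) , (λ f → ⊥-elim (none (y , f , x , a , e))) ]′ (bool (A y))
    ... | yes (y , f , x , a , e) = saturate k (λ i → A i ∨ (i ≡ᵇ y))
          (λ {i} t → [ sound , (λ q → subst Generated (sym (≡ᵇ-sound q)) (successor (sound a) e)) ]′ (∨-elim {A i} t)) (λ t → ∨-introˡ (I⊆A t)) smaller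
      where
      drop : ∀ i → 𝟙 (not (A i ∨ (i ≡ᵇ y))) ≡ 𝟙 (not (A i)) - 𝟙 (i ≡ᵇ y) * 1ℤ
      drop i = go (i Finₚ.≟ y) (A i) refl
        where
        go : (d : Dec (i ≡ y)) (a : Bool) → A i ≡ a → 𝟙 (not (a ∨ ⌊ d ⌋)) ≡ 𝟙 (not a) - 𝟙 ⌊ d ⌋ * 1ℤ
        go (yes refl) true  q = ⊥-elim (true≢false q f)
        go (yes _)    false _ = refl
        go (no _)     true  _ = refl
        go (no _)     false _ = refl
      smaller : ∑ (λ i → 𝟙 (not (A i ∨ (i ≡ᵇ y)))) < + k
      smaller = ℤₚ.≤-<-trans (ℤₚ.≤-reflexive (trans (sum-cong drop) (trans (sum-minus _ _) (cong (_-_ (∑ (λ i → 𝟙 (not (A i))))) (sum-pick (λ _ → 1ℤ) y)))))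
        (ℤₚ.suc[i]≤j⇒i<j (≤-by (gap (<⇒1≤- lt)) (arrange (∑ (λ i → 𝟙 (not (A i)))) (+ k))))
        where
        arrange : ∀ s k → ((1ℤ + k) - s) - 1ℤ ≡ k - (1ℤ + (s - 1ℤ))
        arrange = solve-∀
    decide : Closed → Dec (Generated h)
    decide (A , sound , I⊆A , closed) = map′ sound complete (A h Boolₚ.≟ true)
      where
      complete : ∀ {x} → Generated x → A x ≡ true
      complete (initial i)     = I⊆A i
      complete (successor g e) = closed (complete g) e

module Walks {n : ℕ} (M : PlanarMap n) (Stp : Fin n → Set) where
  open PlanarMap M
  open Planar M
  open Cycles M

  Walk : Fin n → Fin n → Set
  Walk x y = ∃[ ℓ ] To Stp y ℓ x

  walk-~ : ∀ {x y} → x V.~ y → Walk x y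
  walk-~ e = 0 , there e

  walk-step : ∀ {g} → Stp g → Walk g (α g)
  walk-step s = 1 , step V.~-refl s (there V.~-refl)

  walk-trans : ∀ {x y z} → Walk x y → Walk y z → Walk x z
  walk-trans (_ , t) w = go t
    where
    go : ∀ {ℓ x} → To Stp _ ℓ x → Walk x _
    go (there e)    = proj₁ w , To-~ Stp e (proj₂ w)
    go (step e s t) = suc (proj₁ (go t)) , step e s (proj₂ (go t))

  -- Move to a vertex with fewer predecessors as long as possible.
  source : ∀ u → ¬ ¬ (∃[ v ] (Walk v u × (∀ x → Walk x v → Walk v x)))
  source u = do
    D ← ¬¬-∀ {P = λ x → ∀ y → Dec (Walk x y)} (λ x → ¬¬-∀ (λ y → excluded-middle (Walk x y)))
    return (descend D (suc n) u (walk-~ V.~-refl) (ℤₚ.≤-<-trans (ℤₚ.≤-trans (sum-≤ (λ i → 𝟙≤1 ⌊ D i u ⌋)) (ℤₚ.≤-reflexive (sum-1 n))) (+<+ ℕₚ.≤-refl)))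
    where
    descend : (D : ∀ x y → Dec (Walk x y)) → ∀ k v → Walk v u → ∑ (λ x → 𝟙 ⌊ D x v ⌋) < + k →
      ∃[ v ] (Walk v u × (∀ x → Walk x v → Walk v x))
    descend D zero v vu lt = ⊥-elim (ℤₚ.<⇒≱ lt (sum-nonneg (λ x → 0≤𝟙 ⌊ D x v ⌋)))
    descend D (suc k) v vu lt = cases (Finₚ.any? (λ x → D x v ×-dec ¬? (D v x)))
      where
      cases : Dec (∃[ x ] (Walk x v × ¬ Walk v x)) → ∃[ v ] (Walk v u × (∀ x → Walk x v → Walk v x))
      cases (no none) = v , vu , λ x xv → decidable-stable (D v x) (λ ¬vx → none (x , xv , ¬vx))
      cases (yes (x , xv , ¬vx)) = descend D k x (walk-trans xv vu) smaller
        where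
        -- Every predecessor of `x` is one of `v`, and `v` itself is no longer counted.
        pointwise : ∀ i → 𝟙 ⌊ D i x ⌋ + 𝟙 (i ≡ᵇ v) * 1ℤ ≤ 𝟙 ⌊ D i v ⌋
        pointwise i = go (D i x) (i Finₚ.≟ v) (D i v)
          where
          go : (d : Dec (Walk i x)) (e : Dec (i ≡ v)) (f : Dec (Walk i v)) → 𝟙 ⌊ d ⌋ + 𝟙 ⌊ e ⌋ * 1ℤ ≤ 𝟙 ⌊ f ⌋
          go (yes ix) (yes refl) _ = ⊥-elim (¬vx ix)
          go (yes ix) (no _) (yes _) = ℤₚ.≤-refl
          go (yes ix) (no _) (no ¬iv) = ⊥-elim (¬iv (walk-trans ix xv))
          go (no _) (yes refl) (yes _) = ℤₚ.≤-refl
          go (no _) (yes refl) (no ¬iv) = ⊥-elim (¬iv (walk-~ V.~-refl))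
          go (no _) (no _) f = 0≤𝟙 ⌊ f ⌋
        fewer : ∑ (λ i → 𝟙 ⌊ D i x ⌋) + 1ℤ ≤ ∑ (λ i → 𝟙 ⌊ D i v ⌋)
        fewer = subst (_≤ ∑ (λ i → 𝟙 ⌊ D i v ⌋)) (trans (sum-+ (λ i → 𝟙 ⌊ D i x ⌋) (λ i → 𝟙 (i ≡ᵇ v) * 1ℤ)) (cong (_+_ (∑ (λ i → 𝟙 ⌊ D i x ⌋))) (sum-pick (λ _ → 1ℤ) v))) (sum-≤ pointwise)
        arrange : ∀ s s' k → (((1ℤ + k) - s') - 1ℤ) + (s' - (s + 1ℤ)) ≡ k - (1ℤ + s)
        arrange = solve-∀
        smaller : ∑ (λ i → 𝟙 ⌊ D i x ⌋) < + k
        smaller = ℤₚ.suc[i]≤j⇒i<j (≤-by (gap (<⇒1≤- lt) ⊞ gap fewer) (arrange (∑ (λ i → 𝟙 ⌊ D i x ⌋)) (∑ (λ i → 𝟙 ⌊ D i v ⌋)) (+ k)))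

-- Counterclockwise circuits from closed walks

module Circuits {n : ℕ} (PM : PlaneMap n) (w : ZBiorientation n) where
  open PlaneMap PM
  open Planar pmap
  open Cycles pmap

  -- The right side of `h` is joined to the root face through edges that no step uses in either
  -- direction. The potential of the circuit is constant on this connection and jumps across `h`, so
  -- the root face is not on the left.
  ccw-circuit : (Stp X : Fin n → Set) → (∀ {g} → Stp g → Traversable PM w g) → (∀ {g} → X g → ¬ Stp g × ¬ Stp (α g)) →
    ∀ {h} → Stp h → ¬ Stp (α h) → Walks.Walk pmap Stp (α h) h → FF.Connected (F.in? root) X h → ¬ ¬ CCWCircuit PM w
  ccw-circuit Stp X trav off {h} sh ¬sαh walk (_ , conn) = do
    (m , c , cyc , c₀ , stp) ← circuit Stp sh ¬sαh walk
    (q , q-φ , q-off , q-on) ← jordan cyc root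
    return (suc m , c , cyc , (λ i → trav (stp i)) , s≤s z≤n , λ l → absurd cyc q q-φ q-off q-on stp c₀ l)
    where
    absurd : ∀ {m} {c : Fin (suc m) → Fin n} (cyc : IsCycle (suc m) c) (q : Fin n → ℤ) → (∀ h → q (φ h) ≡ q h) →
      (∀ g → OffCycle cyc g → q (α g) ≡ q g) → (∀ i → q (α (c i)) ≡ q (c i) + 1ℤ) → (∀ i → Stp (c i)) → c Fin.zero ≡ h →
      ¬ LeftOf PM w c Fin.zero root
    absurd {m} {c} cyc q q-φ q-off q-on stp c₀ l = ℤₚ.<-irrefl {0ℤ} {1ℤ} (trans (sym (ℤₚ.+-inverseʳ (q h)))
        (trans (cong (_- q h) (trans (outside conn) (trans (left l) (trans (q-on Fin.zero) (cong (λ x → q x + 1ℤ) c₀))))) (cancel (q h)))) (+<+ (s≤s z≤n))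
      where
      cancel : ∀ a → (a + 1ℤ) - a ≡ 1ℤ
      cancel = solve-∀
      left : ∀ {g} → LeftOf PM w c Fin.zero g → q g ≡ q (α (c Fin.zero))
      left (base e)          = sym (F.~-invariant q-φ e)
      left (cross {g} l o e) = trans (sym (F.~-invariant q-φ e)) (trans (q-off g o) (left l))
      outside : ∀ {ℓ g} → FF.Conn (F.in? root) X ℓ g → q g ≡ q root
      outside (FF.at e) = sym (F.~-invariant q-φ (F.in?-sound e))
      outside (FF.cross {g = g} c' x e) = trans (sym (F.~-invariant q-φ e)) (trans (q-off g
        (λ i → (λ q → proj₁ (off x) (subst Stp (sym q) (stp i))) ,
               (λ q → proj₂ (off x) (subst Stp (sym (trans (cong α q) (α-invol (c i)))) (stp i))))) (outside c'))

-- Accessibility from the outer vertices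

module Access {n : ℕ} (PM : PlaneMap n) (b : ℕ) (deg : PlaneMap.outerDeg PM ≡ 2 ℕ.* b)
  (girth : PlaneMap.HasGirth PM (2 ℕ.* b)) (1≤b : 1 ℕ.≤ b)
  (even : ∀ h → + PlaneMap.faceDeg PM h ≡ + 2 * + (PlaneMap.faceDeg PM h DM./ 2))
  (w : ZBiorientation n) (ori : IsBOrientation PM w b)
  (outer-cw : ∀ h → PlaneMap.InRoot PM h → (w h ≡ 1ℤ) × (w (PlaneMap.α PM h) ≡ 0ℤ))
  (min : Minimal PM w) where
  open PlaneMap PM
  open Regions PM
  open Contour PM b deg girth
  open Oriented b w ori even

  Trav : Fin n → Set
  Trav = Traversable PM w

  open Walks pmap Trav
  open Circuits PM w

  module From (h₀ : Fin n) (outer₀ : OuterVertex h₀) where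

    Reached : Fin n → Set
    Reached = OReach PM w h₀

    reached-~ : ∀ {g h} → g V.~ h → Reached g → Reached h
    reached-~ e (start e')    = start (V.~-trans e' e)
    reached-~ e (step r t e') = step r t (V.~-trans e' e)

    reached-walk : ∀ {g h} → Reached g → Walk g h → Reached h
    reached-walk r (_ , t) = go r t
      where
      go : ∀ {ℓ g h} → Reached g → To Trav h ℓ g → Reached h
      go r (there e)    = reached-~ e r
      go r (step e s t) = go (step (reached-~ e r) s V.~-refl) t

    reached? : ∀ h → Dec (Reached h)
    reached? h = map′ to from (generated? (V.in? h₀) E h)
      where
      edge? : ∀ g h → Dec (Trav g × α g V.~ h)
      edge? g h = (0ℤ ℤ.<? w (α g)) ×-dec (α g V.~? h)
      E : Fin n → Fin n → Bool
      E g h = ⌊ edge? g h ⌋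
      to : ∀ {h} → Generated (V.in? h₀) E h → Reached h
      to (initial i)                 = start (V.in?-sound i)
      to (successor {g} {h} r e) = step (to r) (proj₁ (⌊⌋-sound (edge? g h) e)) (proj₂ (⌊⌋-sound (edge? g h) e))
      from : ∀ {h} → Reached h → Generated (V.in? h₀) E h
      from (start e) = initial (V.in?-true e)
      from (step {g} {h} r t e) = successor (from r) (⌊⌋-true (edge? g h) (t , e))

    -- The outer cycle is directed, so it is reached entirely.
    reached-outer : ∀ {g} → rt g ≡ true → Reached g
    reached-outer {g} t = around outer₀
      where
      around : OuterVertex h₀ → Reached g
      around (g₀ , e , r) = start-from (F.~-trans (F.~-sym (F.in?-sound t)) r)
        where
        go : ∀ k g → rt g ≡ true → iter φ k g ≡ g₀ → Reached g
        go zero g t q = start (V.~-trans e (V.~-reflexive (sym q)))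
        go (suc k) g t q = step {h = α g} (reached-~ (V.~-sym α-vertex-φ)
            (go k (φ g) (trans (rt-φ g) t) (trans (sym (F.iter-+ k 1 g)) (trans (cong (λ j → iter φ j g) (ℕₚ.+-comm k 1)) q))))
          (subst (0ℤ <_) (sym (trans (cong w (α-invol g)) (proj₁ (outer-cw g (F.in?-sound t))))) (+<+ (s≤s z≤n)))
          (V.~-reflexive (α-invol g))
        start-from : g F.~ g₀ → Reached g
        start-from (k , q) = go k g t q

    reached-outerV : ∀ {g} → outerV g ≡ true → Reached g
    reached-outerV o = reached-~ (V.~-sym (proj₁ (proj₂ (touch-sound o)))) (reached-outer (proj₂ (proj₂ (touch-sound o))))

    -- K is a strong component without entrance that is not reached; comparing the
    -- weights inside its outer boundary with Euler's relation is absurd.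
    module Component (v : Fin n) (v-unreached : ¬ Reached v) (v-source : ∀ g → Walk g v → Walk v g)
      (K : Fin n → Bool) (dK : Decides (λ g → Walk g v) K)
      (O : Fin n → Bool) (dO : Decides (FF.Connected (F.in? root) (λ g → K g ∧ K (α g) ≡ false)) O) where

      private
        module K = Decides dK
        module O = Decides dO

      -- `GK` are the edges of the component and `I` the faces it encloses. Euler's relation is
      -- applied to the component with its enclosed part filled in; `RO` are the vertices of the
      -- component on the outside of it.
      I GK H R RO : Fin n → Bool
      I h = not (O h)
      GK h = K h ∧ K (α h)

      O-~ : ∀ {g h} → g F.~ h → O g ≡ true → O h ≡ true
      O-~ e o = O.complete (proj₁ (O.sound o) , FF.Conn-~ (in?-invariant-F root) e (proj₂ (O.sound o)))

      O-cross : ∀ {g} → O g ≡ true → GK g ≡ false → O (α g) ≡ true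
      O-cross o x = O.complete (_ , FF.cross (proj₂ (O.sound o)) x F.~-refl)

      I-φ : F.Invariant I
      I-φ h = cong not (⇔⇒≡ (O-~ (F.~-sym F.~-π)) (O-~ F.~-π))

      I-root : I root ≡ false
      I-root = cong not (O.complete (0 , FF.at (F.in?-true F.~-refl)))

      open Region I I-φ I-root
      open RegionCount I I-φ I-root

      H h = GK h ∨ (I h ∨ I (α h))
      RO h = K h ∧ not (surrounded h)
      R h = surrounded h ∨ K h

      K-~ : ∀ {g h} → g V.~ h → K g ≡ true → K h ≡ true
      K-~ e k = K.complete (walk-trans (walk-~ (V.~-sym e)) (K.sound k))

      K-σ : V.Invariant K
      K-σ h = ⇔⇒≡ (K-~ (V.~-sym V.~-π)) (K-~ V.~-π)

      K-pred : ∀ {g} → Trav g → K (α g) ≡ true → K g ≡ true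
      K-pred t k = K.complete (walk-trans (walk-step t) (K.sound k))

      K-inner : ∀ {g} → K g ≡ true → outerV g ≡ false
      K-inner k = ¬true⇒false (λ o → v-unreached (reached-walk (reached-outerV o) (K.sound k)))

      GK-α : ∀ h → GK (α h) ≡ GK h
      GK-α h = trans (cong (λ g → K (α h) ∧ K g) (α-invol h)) (Boolₚ.∧-comm (K (α h)) (K h))

      K-innerE : ∀ {h} → K h ≡ true → InnerEdge h
      K-innerE k (inj₁ r) = true≢false (rt⇒outerV (F.in?-true r)) (K-inner k)
      K-innerE k (inj₂ r) = true≢false (outerV-α (F.in?-true r)) (K-inner k)

      inside : ∀ {ℓ g h} → K h ≡ true → To Trav h ℓ g → To (λ g → Trav g × (GK g ≡ true)) h ℓ g
      inside k (there e) = there e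
      inside {h = h} k (step {g' = g'} e s t) = step e (s , cong₂ _∧_ (K-pred s kα) kα) (inside k t)
        where
        kα : K (α g') ≡ true
        kα = K.complete (walk-trans (_ , t) (K.sound k))

      -- With the outside on its right, a half-edge of weight -1 can only be traversed away from its
      -- vertex. The component is strongly connected, so the edge closes up to a counterclockwise
      -- circuit.
      no-unit : ∀ {h} → O h ≡ true → GK h ≡ true → y h ≡ 0ℤ
      no-unit {h} o gk = cases (view h)
        where
        k  = proj₁ (∧-true {K h} gk)
        kα = proj₂ (∧-true {K h} gk)
        cases : View h → y h ≡ 0ℤ
        cases (ingoing _ e)  = e
        cases (neutral _ e)  = e
        cases (negative e _) = ⊥-elim (ccw-circuit (λ g → Trav g × (GK g ≡ true)) (λ g → GK g ≡ false) proj₁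
            (λ {g} f → (λ s → true≢false (proj₂ s) f) , (λ s → true≢false (trans (sym (GK-α g)) (proj₂ s)) f))
            {h} (traversable , gk) (λ s → ℤₚ.<⇒≱ (subst (0ℤ <_) (trans (cong w (α-invol h)) e) (proj₁ s)) -≤+)
            (_ , inside k (proj₂ (walk-trans (K.sound kα) (v-source h (K.sound k))))) (O.sound o) min)
          where
          traversable : Trav h
          traversable = 1≤⇒0< (≤-by (gap (+≤+ 1≤b)) (sym (trans (cong (_- 1ℤ) (trans (back (w h) (w (α h))) (cong₂ _-_ (edge-sum h (K-innerE k)) e))) (arrange B))))
            where
            back : ∀ a b → b ≡ (a + b) - a
            back = solve-∀
            arrange : ∀ b → ((b - 1ℤ) - -1ℤ) - 1ℤ ≡ b - 1ℤ
            arrange = solve-∀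

      H-α : ∀ h → H (α h) ≡ H h
      H-α h = cong₂ _∨_ (GK-α h) (trans (cong (λ g → I (α h) ∨ I g) (α-invol h)) (Boolₚ.∨-comm (I (α h)) (I h)))

      R-σ : V.Invariant R
      R-σ h = cong₂ _∨_ (surrounded-σ h) (K-σ h)

      side-GK : ∀ {g} → I g ≡ true → I (α g) ≡ false → GK g ≡ true
      side-GK {g} a f = [ (λ t → t) , (λ x → ⊥-elim (true≢false (subst (λ g → O g ≡ true) (α-invol g)
        (O-cross (not-false f) (trans (GK-α g) x))) (not-true a))) ]′ (bool (GK g))

      I⇒R : ∀ {h g} → h V.~ g → I g ≡ true → R h ≡ true
      I⇒R {h} {g} e Ig = [ ∨-introˡ , (λ f → ∨-introʳ {surrounded h} (from (boundary-at Ig (trans (sym (surrounded-~ e)) f)))) ]′ (bool (surrounded h))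
        where
        from : ∃[ g' ] (g V.~ g' × I g' ≡ true × I (α g') ≡ false) → K h ≡ true
        from (g' , e' , a , f) = K-~ (V.~-sym (V.~-trans e e')) (proj₁ (∧-true {K g'} (side-GK a f)))

      H⇒R : ∀ h → H h ≡ true → R h ≡ true
      H⇒R h t = [ (λ gk → ∨-introʳ {surrounded h} (proj₁ (∧-true {K h} gk))) ,
        (λ i → [ I⇒R V.~-refl , (λ iα → I⇒R V.~-π (trans (I-σ h) iα)) ]′ (∨-elim {I h} i)) ]′ (∨-elim {GK h} t)

      convert : ∀ {ℓ h} → FF.Conn (F.in? root) (λ g → GK g ≡ false) ℓ h → FF.Conn (F.in? root) (λ g → H g ≡ false) ℓ h
      convert (FF.at e)        = FF.at e
      convert (FF.cross c f e) = FF.cross (convert c) (∨-false f (∨-false (cong not (O.complete (_ , c)))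
        (cong not (O.complete (_ , FF.cross c f F.~-refl))))) e

      out : Fin n → ℤ
      out h = (1ℤ - 𝟙 (I h)) * (1ℤ - 𝟙 (I (α h))) * 𝟙 (GK h)

      m₂ : ℤ
      m₂ = ∑ out

      0≤out : ∀ h → 0ℤ ≤ out h
      0≤out h = 0≤1-𝟙 (I h) ⊠ 0≤1-𝟙 (I (α h)) ⊠ 0≤𝟙 (GK h)

      out-α : ∀ h → out (α h) ≡ out h
      out-α h = trans (cong₂ (λ g k → (1ℤ - 𝟙 (I (α h))) * (1ℤ - 𝟙 (I g)) * 𝟙 k) (α-invol h) (GK-α h))
        (cong (_* 𝟙 (GK h)) (ℤₚ.*-comm (1ℤ - 𝟙 (I (α h))) (1ℤ - 𝟙 (I h))))

      sum-H : ∑ (λ h → 𝟙 (H h)) ≡ D + k' + k' + m₂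
      sum-H = trans (sum-cong (λ h → split (GK h) (I h) (I (α h)))) (trans (sum-+ _ _) (cong (_+ m₂)
        (trans (sum-+ _ _) (cong₂ _+_ (sum-+ _ _) sum-side-α))))
        where
        split : ∀ g i j → 𝟙 (g ∨ (i ∨ j)) ≡ 𝟙 i * 𝟙 j + 𝟙 i * (1ℤ - 𝟙 j) + 𝟙 j * (1ℤ - 𝟙 i) + (1ℤ - 𝟙 i) * (1ℤ - 𝟙 j) * 𝟙 g
        split true  true  true  = refl
        split true  true  false = refl
        split true  false true  = refl
        split true  false false = refl
        split false true  true  = refl
        split false true  false = refl
        split false false true  = refl
        split false false false = refl

      count-R : V.#orb R ≡ V.#orb surrounded + V.#orb RO
      count-R = trans (sum-cong (λ r → trans (cong (𝟙 (V.min? r) *_) (split (surrounded r) (K r))) (ℤₚ.*-distribˡ-+ (𝟙 (V.min? r)) _ _))) (sum-+ _ _)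
        where
        split : ∀ s k → 𝟙 (s ∨ k) ≡ 𝟙 s + 𝟙 (k ∧ not s)
        split true  true  = refl
        split true  false = refl
        split false true  = refl
        split false false = refl

      RO-σ : V.Invariant RO
      RO-σ h = cong₂ (λ k s → k ∧ not s) (K-σ h) (surrounded-σ h)

      weight-RO : ∑ (λ h → 𝟙 (RO h) * x h) ≡ B * V.#orb RO
      weight-RO = V.#orb-* RO-σ B x (λ h e → vertex-sum h (λ ov → true≢false (outerV-true ov) (K-inner (proj₁ (∧-true {K h} e)))))

      sides outs : ℤ
      sides = ∑ (λ h → side h * (x h + x (α h)))
      outs  = ∑ (λ h → out h * x h)

      -- The component has no entrance: the weight at its outer vertices comes from its own edges,
      -- or from edges inside the enclosed region.
      bound-RO : B * V.#orb RO ≤ X + sides + outs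
      bound-RO = ℤₚ.≤-trans (ℤₚ.≤-reflexive (trans (sym weight-RO) (trans (sum-cong (λ h → four (𝟙 (I h)) (𝟙 (I (α h))) (𝟙 (RO h) * x h)))
          (trans (sum-+ _ _) (cong (_+ ∑ outer) (trans (sum-+ _ _) (cong₂ _+_ (sum-+ _ _) refl)))))))
        (ℤₚ.+-mono-≤ (ℤₚ.≤-trans (ℤₚ.≤-reflexive (ℤₚ.+-assoc (∑ inner) (∑ right) (∑ left))) (ℤₚ.+-mono-≤ (sum-≤ inner≤) sides≤)) (sum-≤ outer≤))
        where
        inner right left outer : Fin n → ℤ
        inner h = both h * (𝟙 (RO h) * x h)
        right h = side h * (𝟙 (RO h) * x h)
        left h  = 𝟙 (I (α h)) * (1ℤ - 𝟙 (I h)) * (𝟙 (RO h) * x h)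
        outer h = (1ℤ - 𝟙 (I h)) * (1ℤ - 𝟙 (I (α h))) * (𝟙 (RO h) * x h)
        four : ∀ i j r → r ≡ i * j * r + i * (1ℤ - j) * r + j * (1ℤ - i) * r + (1ℤ - i) * (1ℤ - j) * r
        four = solve-∀
        nonneg-* : ∀ {a b c} → 0ℤ ≤ a → b ≤ c → a * b ≤ a * c
        nonneg-* {a} {b} {c} 0≤a l = ≤-by (0≤a ⊠ gap l) (arr a b c)
          where
          arr : ∀ a b c → a * (c - b) ≡ a * c - a * b
          arr = solve-∀
        𝟙x≤x : ∀ c h → 𝟙 c * x h ≤ x h
        𝟙x≤x true  h = ℤₚ.≤-reflexive (ℤₚ.*-identityˡ _)
        𝟙x≤x false h = 0≤x h
        inner≤ : ∀ h → inner h ≤ both h * (1ℤ - 𝟙 (surrounded h)) * x h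
        inner≤ h = subst (inner h ≤_) (sym (ℤₚ.*-assoc (both h) _ _)) (nonneg-* (0≤both h) (cases (K h) (surrounded h)))
          where
          cases : ∀ k s → 𝟙 (k ∧ not s) * x h ≤ (1ℤ - 𝟙 s) * x h
          cases true  true  = ℤₚ.≤-refl
          cases true  false = ℤₚ.≤-refl
          cases false s     = 0≤1-𝟙 s ⊠ 0≤x h
        left-α : ∀ h → left (α h) ≡ side h * (𝟙 (RO (α h)) * x (α h))
        left-α h = cong (λ g → 𝟙 (I g) * (1ℤ - 𝟙 (I (α h))) * (𝟙 (RO (α h)) * x (α h))) (α-invol h)
        sides≤ : ∑ right + ∑ left ≤ sides
        sides≤ = ℤₚ.≤-trans (ℤₚ.≤-reflexive (trans (cong (_+_ (∑ right)) (trans (sym (sum-α left)) (sum-cong left-α))) (sym (sum-+ _ _))))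
          (sum-≤ (λ h → ℤₚ.≤-trans (ℤₚ.≤-reflexive (sym (ℤₚ.*-distribˡ-+ (side h) _ _)))
            (nonneg-* (0≤side h) (ℤₚ.+-mono-≤ (𝟙x≤x (RO h) h) (𝟙x≤x (RO (α h)) (α h))))))
        outer≤ : ∀ h → outer h ≤ out h * x h
        outer≤ h = subst (outer h ≤_) (sym (ℤₚ.*-assoc ((1ℤ - 𝟙 (I h)) * (1ℤ - 𝟙 (I (α h)))) _ _))
          (nonneg-* (0≤1-𝟙 (I h) ⊠ 0≤1-𝟙 (I (α h))) (cases (0ℤ ℤ.<? w h) (bool (K h))))
          where
          cases : Dec (0ℤ < w h) → (K h ≡ true) ⊎ (K h ≡ false) → 𝟙 (RO h) * x h ≤ 𝟙 (GK h) * x h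
          cases (no ≮) _ = ℤₚ.≤-reflexive (trans (trans (cong (𝟙 (RO h) *_) (x-outgoing ≮)) (ℤₚ.*-zeroʳ (𝟙 (RO h))))
            (sym (trans (cong (𝟙 (GK h) *_) (x-outgoing ≮)) (ℤₚ.*-zeroʳ (𝟙 (GK h))))))
          cases _ (inj₂ f) = ℤₚ.≤-trans (ℤₚ.≤-reflexive (cong (λ c → 𝟙 (c ∧ not (surrounded h)) * x h) f)) (0≤𝟙 (GK h) ⊠ 0≤x h)
          cases (yes p) (inj₁ k) = ℤₚ.≤-trans (𝟙x≤x (RO h) h) (ℤₚ.≤-reflexive (sym (trans (cong (λ c → 𝟙 c * x h)
            (cong₂ _∧_ k (K-pred (subst (λ g → 0ℤ < w g) (sym (α-invol h)) p) (subst (λ g → K g ≡ true) (sym (α-invol h)) k)))) (ℤₚ.*-identityˡ _))))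

      -- By `no-unit` a boundary edge can carry a -1 only on the half-edge facing the region, which
      -- is what `Y` counts.
      sides≡ : sides ≡ (B - 1ℤ) * k' + Y
      sides≡ = trans (sum-cong (λ h → pointwise h (bool (I h)) (bool (I (α h))))) (trans (sum-+ _ _) (cong (_+ Y) (sum-* (B - 1ℤ) side)))
        where
        zero-side : ∀ h → side h ≡ 0ℤ → side h * (x h + x (α h)) ≡ (B - 1ℤ) * side h + side h * y h
        zero-side h e = trans (cong (_* (x h + x (α h))) e) (sym (trans (cong (λ s → (B - 1ℤ) * s + s * y h) e) (trans (ℤₚ.+-identityʳ _) (ℤₚ.*-zeroʳ (B - 1ℤ)))))
        arrange : ∀ s b y → s * (b + (y + 0ℤ)) ≡ b * s + s * y
        arrange = solve-∀
        pointwise : ∀ h → (I h ≡ true) ⊎ (I h ≡ false) → (I (α h) ≡ true) ⊎ (I (α h) ≡ false) →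
          side h * (x h + x (α h)) ≡ (B - 1ℤ) * side h + side h * y h
        pointwise h (inj₂ f) _ = zero-side h (cong (λ c → 𝟙 c * (1ℤ - 𝟙 (I (α h)))) f)
        pointwise h _ (inj₁ t) = zero-side h (trans (cong (λ c → 𝟙 (I h) * (1ℤ - 𝟙 c)) t) (ℤₚ.*-zeroʳ (𝟙 (I h))))
        pointwise h (inj₁ t) (inj₂ f) = trans (cong (side h *_) (trans (edge-sum-xy h (K-innerE (proj₁ (∧-true {K h} gk))))
            (cong (λ v → B - 1ℤ + (y h + v)) (no-unit (not-false f) (trans (GK-α h) gk))))) (arrange (side h) (B - 1ℤ) (y h))
          where gk = side-GK t f

      outs≡ : + 2 * outs ≡ (B - 1ℤ) * m₂
      outs≡ = trans (double outs) (trans (cong (_+_ outs) (sym (trans (sum-cong (λ h → cong (_* x (α h)) (sym (out-α h)))) (sum-α (λ h → out h * x h)))))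
        (trans (sym (sum-+ _ _)) (trans (sum-cong (λ h → trans (sym (ℤₚ.*-distribˡ-+ (out h) (x h) (x (α h))))
          (pointwise h (bool (I h)) (bool (I (α h))) (bool (GK h))))) (sum-* (B - 1ℤ) out))))
        where
        double : ∀ z → + 2 * z ≡ z + z
        double = solve-∀
        zero-out : ∀ h → out h ≡ 0ℤ → out h * (x h + x (α h)) ≡ (B - 1ℤ) * out h
        zero-out h e = trans (cong (_* (x h + x (α h))) e) (sym (trans (cong (_*_ (B - 1ℤ)) e) (ℤₚ.*-zeroʳ (B - 1ℤ))))
        pointwise : ∀ h → (I h ≡ true) ⊎ (I h ≡ false) → (I (α h) ≡ true) ⊎ (I (α h) ≡ false) → (GK h ≡ true) ⊎ (GK h ≡ false) →
          out h * (x h + x (α h)) ≡ (B - 1ℤ) * out h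
        pointwise h (inj₁ t) _ _ = zero-out h (cong (λ c → (1ℤ - 𝟙 c) * (1ℤ - 𝟙 (I (α h))) * 𝟙 (GK h)) t)
        pointwise h _ (inj₁ t) _ = zero-out h (trans (cong (λ c → (1ℤ - 𝟙 (I h)) * (1ℤ - 𝟙 c) * 𝟙 (GK h)) t)
          (cong (_* 𝟙 (GK h)) (ℤₚ.*-zeroʳ (1ℤ - 𝟙 (I h)))))
        pointwise h _ _ (inj₂ f) = zero-out h (trans (cong (λ c → (1ℤ - 𝟙 (I h)) * (1ℤ - 𝟙 (I (α h))) * 𝟙 c) f)
          (ℤₚ.*-zeroʳ ((1ℤ - 𝟙 (I h)) * (1ℤ - 𝟙 (I (α h))))))
        pointwise h (inj₂ a) (inj₂ c) (inj₁ gk) = trans (cong (out h *_) (trans (edge-sum-xy h (K-innerE (proj₁ (∧-true {K h} gk))))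
            (trans (cong₂ (λ v v' → B - 1ℤ + (v + v')) (no-unit (not-false a) gk) (no-unit (not-false c) (trans (GK-α h) gk))) (ℤₚ.+-identityʳ _))))
          (ℤₚ.*-comm (out h) (B - 1ℤ))

      absurd : ⊥
      -- The two scaled slacks alone add up to `- k' - m₂ - 2b`. The further summands `k'`, `m₂`,
      -- `b - 1` and `b` bring this to exactly -1, although every term is nonnegative.
      absurd = ℤₚ.<⇒≱ {0ℤ} {1ℤ} (+<+ (s≤s z≤n)) (≤-by
          ((0≤+ {b} ⊠ gap euler') ⊞ (0≤+ {2} ⊠ gap bound-RO) ⊞ sum-nonneg 0≤side ⊞ sum-nonneg 0≤out ⊞ gap (+≤+ 1≤b) ⊞ 0≤+ {b})
          (arrange (F.#orb I) (V.#orb surrounded) (V.#orb RO) B D k' m₂ X Y outs region-count outs≡ sides sides≡))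
        where
        euler' : (D + k' + k' + m₂) + + 4 ≤ + 2 * (1ℤ + F.#orb I) + + 2 * (V.#orb surrounded + V.#orb RO)
        euler' = subst₂ (λ p q → p + + 4 ≤ + 2 * (1ℤ + F.#orb I) + + 2 * q) sum-H count-R
          (euler-region {H} {R} H-α R-σ H⇒R (λ h f → _ , convert (proj₂ (O.sound (not-false f))))
            (v , ∨-introʳ {surrounded v} (K.complete (walk-~ V.~-refl))))
        go : ∀ f s r b d k m x y o si →
          b * ((+ 2 * (1ℤ + f) + + 2 * (s + r)) - ((d + k + k + m) + + 4)) + + 2 * ((x + si + o) - b * r) + k + m + (b - 1ℤ) + b
          ≡ ((+ 2 * b * (f + s) - b * d) - (k - + 2 * x - + 2 * y)) + (+ 2 * o - (b - 1ℤ) * m) + + 2 * (si - ((b - 1ℤ) * k + y)) + (0ℤ - 1ℤ)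
        go = solve-∀
        arrange : ∀ f s r b d k m x y o → + 2 * b * (f + s) - b * d ≡ k - + 2 * x - + 2 * y → + 2 * o ≡ (b - 1ℤ) * m →
          ∀ si → si ≡ (b - 1ℤ) * k + y →
          b * ((+ 2 * (1ℤ + f) + + 2 * (s + r)) - ((d + k + k + m) + + 4)) + + 2 * ((x + si + o) - b * r) + k + m + (b - 1ℤ) + b ≡ 0ℤ - 1ℤ
        arrange f s r b d k m x y o e₁ e₂ si e₃ = trans (go f s r b d k m x y o si)
          (cong₂ (λ p q → p + q + (0ℤ - 1ℤ)) (cong₂ _+_ (vanish e₁) (vanish e₂)) (cong (_*_ (+ 2)) (vanish e₃)))
          where
          vanish : ∀ {p q} → p ≡ q → p - q ≡ 0ℤ
          vanish {p} refl = ℤₚ.+-inverseʳ p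

    accessible : AccessibleFrom PM w h₀
    accessible h = decidable-stable (reached? h) (λ unreached → (do
      (v , vh , src) ← source h
      (K , dK) ← classify (λ g → Walk g v)
      (O , dO) ← classify (FF.Connected (F.in? root) (λ g → K g ∧ K (α g) ≡ false))
      return (Component.absurd v (λ r → unreached (reached-walk r vh)) src K dK O dO)) (λ e → e))

-- The outer cycle of a suitable orientation runs clockwise

next-fix : ∀ {k} (i : Fin k) → next i ≡ i → k ≡ 1
next-fix {suc m} i e with toℕ i ℕₚ.≟ m
... | yes q = cong suc (trans (sym q) (trans (cong toℕ (sym e)) (next-last i q)))
... | no q  = ⊥-elim (ℕₚ.<-irrefl (trans (cong toℕ (sym e)) (next-< i (ℕₚ.≤∧≢⇒< (ℕ.s≤s⁻¹ (Finₚ.toℕ<n i)) q))) ℕₚ.≤-refl)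

module OuterCycle {n : ℕ} (PM : PlaneMap n) (b : ℕ) (deg : PlaneMap.outerDeg PM ≡ 2 ℕ.* b)
  (girth : PlaneMap.HasGirth PM (2 ℕ.* b)) (1≤b : 1 ℕ.≤ b)
  (w : ZBiorientation n) (suit : Suitable PM w) where
  open PlaneMap PM
  open Regions PM
  open Contour PM b deg girth

  private
    min = proj₁ suit
    adm = proj₁ (proj₂ suit)
    acc-outer = proj₂ (proj₂ suit)

    0<0 : ¬ 0ℤ < 0ℤ
    0<0 (+<+ ())

  -- The vertex of `contour (next i)` must be accessible from its predecessor. Inner half-edges
  -- there are outgoing and its contour half-edge has weight 0, so the last step can only use
  -- `contour i`.
  backwards : ∀ i → Traversable PM w (contour (next i)) → Traversable PM w (contour i)
  backwards i t = arrive (acc-outer (contour i) (contour i , V.~-refl , F.in?-sound (contour-rt i)) g)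
    where
    g = contour (next i)
    wg≡0 : w g ≡ 0ℤ
    wg≡0 = [ proj₁ , (λ e → ⊥-elim (0<0 (subst (0ℤ <_) (proj₂ e) t))) ]′ (proj₁ (proj₂ adm) g (F.in?-sound (contour-rt (next i))))
    apart : ¬ contour i V.~ g
    apart e = ℕₚ.<⇒≢ (ℕₚ.≤-trans (s≤s 1≤b) (ℕₚ.≤-trans (ℕₚ.≤-reflexive (ℕₚ.+-comm 1 b)) (ℕₚ.+-monoʳ-≤ b (ℕₚ.≤-trans 1≤b (ℕₚ.≤-reflexive (sym (ℕₚ.+-identityʳ b)))))))
      (sym (trans (sym deg) (next-fix i (sym (IsCycle.vDistinct contour-cycle i (next i) e)))))
    arrive : OReach PM w (contour i) g → Traversable PM w (contour i)
    arrive (start e) = ⊥-elim (apart e)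
    arrive (step {h} _ 0<w e) = cases (bool (rt (α h))) (bool (rt h))
      where
      cases : (rt (α h) ≡ true) ⊎ (rt (α h) ≡ false) → (rt h ≡ true) ⊎ (rt h ≡ false) → Traversable PM w (contour i)
      cases (inj₁ r) _ = ⊥-elim (0<0 (subst (0ℤ <_) (trans (cong w (outer-unique r (contour-rt (next i)) e)) wg≡0) 0<w))
      cases _ (inj₁ r) = subst (Traversable PM w) (F.π-injective (trans
        (outer-unique (trans (rt-φ h) r) (contour-rt (next i)) (V.~-trans (V.~-sym α-vertex-φ) e)) (sym (contour-next i)))) 0<w
      cases (inj₂ f) (inj₂ f') = ⊥-elim (ℤₚ.<⇒≱ 0<w (proj₂ (proj₂ adm) (α h)
        (λ { (inj₁ r) → true≢false (F.in?-true r) f ; (inj₂ r) → true≢false (F.in?-true (F.~-trans r (F.~-reflexive (α-invol h)))) f' })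
        (contour (next i) , e , F.in?-sound (contour-rt (next i)))))

  -- By `backwards` one counterclockwise outer edge forces all of them, and the contour becomes a
  -- forbidden circuit.
  outer-cw : ∀ h → InRoot h → (w h ≡ 1ℤ) × (w (α h) ≡ 0ℤ)
  outer-cw h r = cases (proj₁ (proj₂ adm) h r)
    where
    cases : ((w h ≡ 0ℤ) × (w (α h) ≡ 1ℤ)) ⊎ ((w h ≡ 1ℤ) × (w (α h) ≡ 0ℤ)) → (w h ≡ 1ℤ) × (w (α h) ≡ 0ℤ)
    cases (inj₂ e) = e
    cases (inj₁ e) = ⊥-elim (jordan contour-cycle root (λ { (q , q-φ , q-off , q-on) →
        min (outerDeg , contour , contour-cycle , all-ccw , nonempty , absurd q q-φ q-off q-on) }))
      where
      open IsCycle contour-cycle using (nonempty)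
      all-ccw : ∀ i → Traversable PM w (contour i)
      all-ccw = prev-induction (λ i → Traversable PM w (contour i)) backwards (proj₁ (contour-onto (F.in?-true r)))
        (subst (λ g → 0ℤ < w (α g)) (proj₂ (contour-onto (F.in?-true r))) (subst (0ℤ <_) (sym (proj₂ e)) (+<+ (s≤s z≤n))))
      i₀ : Fin outerDeg
      i₀ = Fin.fromℕ< nonempty
      absurd : ∀ (q : Fin n → ℤ) → (∀ h → q (φ h) ≡ q h) → (∀ g → OffCycle contour-cycle g → q (α g) ≡ q g) →
        (∀ i → q (α (contour i)) ≡ q (contour i) + 1ℤ) → ¬ LeftOf PM w contour i₀ root
      absurd q q-φ q-off q-on l = ℤₚ.<-irrefl {0ℤ} {1ℤ} (trans (sym (ℤₚ.+-inverseʳ (q root)))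
          (trans (cong (_- q root) (trans (left l) (trans (q-on i₀) (cong (_+ 1ℤ) (sym (F.~-invariant q-φ (F.in?-sound (contour-rt i₀)))))))) (cancel (q root)))) (+<+ (s≤s z≤n))
        where
        cancel : ∀ a → (a + 1ℤ) - a ≡ 1ℤ
        cancel = solve-∀
        left : ∀ {g} → LeftOf PM w contour i₀ g → q g ≡ q (α (contour i₀))
        left (base e)          = sym (F.~-invariant q-φ e)
        left (cross {g} l o e) = trans (sym (F.~-invariant q-φ e)) (trans (q-off g o) (left l))

-- Suitable orientations on the star map

module StarOf {n : ℕ} (PM : PlaneMap n) (b : ℕ) (deg : PlaneMap.outerDeg PM ≡ 2 ℕ.* b)
  (girth : PlaneMap.HasGirth PM (2 ℕ.* b)) (1≤b : 1 ℕ.≤ b)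
  (even : ∀ h → + PlaneMap.faceDeg PM h ≡ + 2 * + (PlaneMap.faceDeg PM h DM./ 2))
  (w : ZBiorientation n) (ori : IsBOrientation PM w b) (suit : Suitable PM w) where
  open PlaneMap PM
  open Regions PM
  open Contour PM b deg girth
  open Oriented b w ori even public
  open OuterCycle PM b deg girth 1≤b w suit public

  -- This undoes the passage from star orientations to weights, except that outer edges keep their
  -- weight 1; the discrepancy cancels when two orientations are compared.
  u : Fin n → ℤ
  u h = w h + y h - y (α h)

  y-value : ∀ h → (y h ≡ 0ℤ) ⊎ ((w h ≡ -1ℤ) × (y h ≡ 1ℤ))
  y-value h = cases (view h)
    where
    cases : View h → (y h ≡ 0ℤ) ⊎ ((w h ≡ -1ℤ) × (y h ≡ 1ℤ))
    cases (ingoing _ e)  = inj₁ e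
    cases (neutral _ e)  = inj₁ e
    cases (negative p e) = inj₂ (p , e)

  private
    y≢1 : ∀ {h c} → w h ≡ c → c ≢ -1ℤ → y h ≡ 0ℤ
    y≢1 {h} e ≢ = [ (λ z → z) , (λ p → ⊥-elim (≢ (trans (sym e) (proj₁ p)))) ]′ (y-value h)

  y-root : ∀ {h} → rt h ≡ true → y h ≡ 0ℤ
  y-root {h} t = y≢1 (proj₁ (outer-cw h (F.in?-sound t))) (λ ())

  y-root-α : ∀ {h} → rt (α h) ≡ true → y h ≡ 0ℤ
  y-root-α {h} t = y≢1 (trans (cong w (sym (α-invol h))) (proj₂ (outer-cw (α h) (F.in?-sound t)))) (λ ())

  unit-inner : ∀ {h} → y h ≡ 1ℤ → InnerEdge h
  unit-inner e (inj₁ r) = 1≢0 (trans (sym e) (y-root (F.in?-true r)))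
  unit-inner e (inj₂ r) = 1≢0 (trans (sym e) (y-root-α (F.in?-true r)))

  unit-negative : ∀ {h} → y h ≡ 1ℤ → w h ≡ -1ℤ
  unit-negative {h} e = [ (λ z → ⊥-elim (1≢0 (trans (sym e) z))) , proj₁ ]′ (y-value h)

  unit-opposite : ∀ {h} → y h ≡ 1ℤ → w (α h) ≡ B
  unit-opposite {h} e = trans (back (w h) (w (α h))) (trans (cong₂ _-_ (edge-sum h (unit-inner e)) (unit-negative e)) (arrange B))
    where
    back : ∀ a b → b ≡ (a + b) - a
    back = solve-∀
    arrange : ∀ b → (b - 1ℤ) - -1ℤ ≡ b
    arrange = solve-∀

  1≤B : 1ℤ ≤ B
  1≤B = +≤+ 1≤b

  unit-opposite-y : ∀ {h} → y h ≡ 1ℤ → y (α h) ≡ 0ℤ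
  unit-opposite-y e = y≢1 (unit-opposite e) (λ ())

  unit-u : ∀ {h} → y h ≡ 1ℤ → u h ≡ 0ℤ
  unit-u e = cong₂ _-_ (cong₂ _+_ (unit-negative e) e) (unit-opposite-y e)

  0≤u : ∀ h → 0ℤ ≤ u h
  0≤u h = cases (y-value (α h))
    where
    cases : (y (α h) ≡ 0ℤ) ⊎ ((w (α h) ≡ -1ℤ) × (y (α h) ≡ 1ℤ)) → 0ℤ ≤ u h
    cases (inj₁ e) = subst (λ v → 0ℤ ≤ x h - v) (sym e) (subst (0ℤ ≤_) (sym (ℤₚ.+-identityʳ _)) (0≤x h))
    cases (inj₂ (_ , e)) = subst (0ℤ ≤_) (sym (cong₂ _-_ (cong₂ _+_ opposite (trans (cong y (sym (α-invol h))) (unit-opposite-y e))) e))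
        (subst (λ v → 0ℤ ≤ v - 1ℤ) (sym (ℤₚ.+-identityʳ B)) (gap 1≤B))
      where
      opposite : w h ≡ B
      opposite = trans (cong w (sym (α-invol h))) (unit-opposite e)

  u-ingoing : ∀ {h} → 1ℤ ≤ u h → 0ℤ < w h
  u-ingoing {h} l = cases (y-value h)
    where
    arrange : ∀ w y → ((w + 0ℤ - y) - 1ℤ) + y ≡ w - 1ℤ
    arrange = solve-∀
    cases : (y h ≡ 0ℤ) ⊎ ((w h ≡ -1ℤ) × (y h ≡ 1ℤ)) → 0ℤ < w h
    cases (inj₁ e)       = 1≤⇒0< (≤-by (gap (subst (λ v → 1ℤ ≤ w h + v - y (α h)) e l) ⊞ 0≤y (α h)) (arrange (w h) (y (α h))))
    cases (inj₂ (_ , e)) = ⊥-elim (1≰0 (subst (1ℤ ≤_) (unit-u e) l))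

  x-outer : ∀ {h} → outerV h ≡ true → x h ≡ 𝟙 (rt h)
  x-outer {h} o = cases (bool (rt h)) (bool (rt (α h)))
    where
    cases : (rt h ≡ true) ⊎ (rt h ≡ false) → (rt (α h) ≡ true) ⊎ (rt (α h) ≡ false) → x h ≡ 𝟙 (rt h)
    cases (inj₁ t) _ = trans (cong₂ _+_ (proj₁ (outer-cw h (F.in?-sound t))) (y-root t)) (cong 𝟙 (sym t))
    cases (inj₂ f) (inj₁ t) = trans (cong₂ _+_ (trans (cong w (sym (α-invol h))) (proj₂ (outer-cw (α h) (F.in?-sound t)))) (y-root-α t)) (cong 𝟙 (sym f))
    cases (inj₂ f) (inj₂ f') = trans (x-outgoing (ℤₚ.≤⇒≯ (proj₂ (proj₂ (proj₁ ori)) h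
      (λ { (inj₁ r) → true≢false (F.in?-true r) f ; (inj₂ r) → true≢false (F.in?-true r) f' }) (outerV-sound o)))) (cong 𝟙 (sym f))

  edge-total : ∀ h → u h + u (α h) ≡ w h + w (α h)
  edge-total h = trans (cong (λ g → (w h + y h - y (α h)) + (w (α h) + y (α h) - y g)) (α-invol h)) (arrange (w h) (w (α h)) (y h) (y (α h)))
    where
    arrange : ∀ a b c d → (a + c - d) + (b + d - c) ≡ a + b
    arrange = solve-∀

  edge-weights : ∀ h → w h + w (α h) ≡ (B - 1ℤ) * 𝟙 (innerE h) + (1ℤ - 𝟙 (innerE h))
  edge-weights h = cases (bool (innerE h))
    where
    arrange : ∀ b → b ≡ b * 1ℤ + (1ℤ - 1ℤ)
    arrange = solve-∀
    outer-total : (rt h ≡ true) ⊎ (rt (α h) ≡ true) → w h + w (α h) ≡ 1ℤ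
    outer-total (inj₁ t) = cong₂ _+_ (proj₁ (outer-cw h (F.in?-sound t))) (proj₂ (outer-cw h (F.in?-sound t)))
    outer-total (inj₂ t) = cong₂ _+_ (trans (cong w (sym (α-invol h))) (proj₂ (outer-cw (α h) (F.in?-sound t)))) (proj₁ (outer-cw (α h) (F.in?-sound t)))
    cases : (innerE h ≡ true) ⊎ (innerE h ≡ false) → w h + w (α h) ≡ (B - 1ℤ) * 𝟙 (innerE h) + (1ℤ - 𝟙 (innerE h))
    cases (inj₁ e) = trans (edge-sum h (innerE-sound e)) (trans (arrange (B - 1ℤ)) (cong (λ i → (B - 1ℤ) * 𝟙 i + (1ℤ - 𝟙 i)) (sym e)))
    cases (inj₂ e) = trans (outer-total (innerE-false e)) (trans (cong (_+ 1ℤ) (sym (ℤₚ.*-zeroʳ (B - 1ℤ)))) (cong (λ i → (B - 1ℤ) * 𝟙 i + (1ℤ - 𝟙 i)) (sym e)))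

  face-total : ∀ h → F.osum (λ g → 1ℤ - + 2 * y g) h ≡ + 2 * B
  face-total h = cases (bool (rt h))
    where
    cases : (rt h ≡ true) ⊎ (rt h ≡ false) → F.osum (λ g → 1ℤ - + 2 * y g) h ≡ + 2 * B
    cases (inj₂ f) = face-sum h (λ r → true≢false (F.in?-true r) f)
    cases (inj₁ t) = trans (F.osum-cong (λ g e → cong (λ v → 1ℤ - + 2 * v) (y-root (F.in?-true (F.~-trans (F.in?-sound t) e)))))
      (trans (F.osum-~ (λ _ → 1ℤ) (F.~-sym (F.in?-sound t))) (trans (F.osum-1 root) (trans (cong +_ deg) (ℤₚ.pos-* 2 b))))

  vertex-total : ∀ h → V.osum x h ≡ (if outerV h then V.osum (λ g → 𝟙 (rt g)) h else B)
  vertex-total h = cases (outerV h) refl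
    where
    cases : ∀ o → outerV h ≡ o → V.osum x h ≡ (if o then V.osum (λ g → 𝟙 (rt g)) h else B)
    cases true  e = V.osum-cong (λ g q → x-outer (trans (sym (touch-~ q)) e))
    cases false e = vertex-sum h (λ ov → true≢false (outerV-true ov) e)

  -- Otherwise the region cut off from the root by {p ≤ 0} would contain a
  -- counterclockwise circuit.
  module Nonpositive (p : Fin n → ℤ) (p-root : p root ≡ 0ℤ)
    (p-α : ∀ h → p (α h) < p h → 1ℤ ≤ u h) (p-φ : ∀ h → p (φ h) < p h → y h ≡ 1ℤ) where

    -- The condition `p ≤ 0` alone would allow islands. Being joined to the root is built in, since
    -- a circuit found next to `Low` must have the root face on its right.
    data Low : Fin n → Set where
      at-root : Low root
      via-α   : ∀ {g} → Low g → p (α g) ≤ 0ℤ → Low (α g)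
      via-φ   : ∀ {g} → Low g → p (φ g) ≤ 0ℤ → Low (φ g)
      via-φ⁻¹ : ∀ {g} → Low (φ g) → p g ≤ 0ℤ → Low g

    low≤0 : ∀ {g} → Low g → p g ≤ 0ℤ
    low≤0 at-root        = ℤₚ.≤-reflexive p-root
    low≤0 (via-α _ l)    = l
    low≤0 (via-φ _ l)    = l
    low≤0 (via-φ⁻¹ _ l)  = l

    module _ (Q : Fin n → Bool) (dQ : Decides Low Q) where
      open Decides dQ

      A : Fin n → Bool
      A h = not (Q h)

      high-α : ∀ {h} → A h ≡ true → Q (α h) ≡ true → 1ℤ ≤ u h
      high-α {h} a q = p-α h (ℤₚ.≤-<-trans (low≤0 (sound q)) (ℤₚ.≰⇒> (λ l → refute (not-true a)
        (subst Low (α-invol h) (via-α (sound q) (subst (λ g → p g ≤ 0ℤ) (sym (α-invol h)) l))))))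

      high-φ : ∀ {h} → A h ≡ true → Q (φ h) ≡ true → y h ≡ 1ℤ
      high-φ {h} a q = p-φ h (ℤₚ.≤-<-trans (low≤0 (sound q)) (ℤₚ.≰⇒> (λ l → refute (not-true a) (via-φ⁻¹ (sound q) l))))

      -- Requiring `A` on the left keeps these steps off every edge with both triangles in `Low`, so
      -- a circuit of such steps cannot cut `Low` from the root face.
      Stp : Fin n → Set
      Stp g = Traversable PM w g × (A (α g) ≡ true)

      Off : Fin n → Set
      Off g = ¬ Stp g × ¬ Stp (α g)

      open Walks pmap Stp
      open Circuits PM w

      low-outside : ∀ {g} → Low g → FF.Connected (F.in? root) Off g
      low-outside at-root = 0 , FF.at (F.in?-true F.~-refl)
      low-outside (via-α {g} l le) = _ , FF.cross (proj₂ (low-outside l))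
        ((λ s → true≢false (complete (via-α l le)) (not-true (proj₂ s))) ,
         (λ s → true≢false (complete l) (trans (cong Q (sym (α-invol g))) (not-true (proj₂ s))))) F.~-refl
      low-outside (via-φ l _)   = _ , FF.Conn-~ (in?-invariant-F root) F.~-π (proj₂ (low-outside l))
      low-outside (via-φ⁻¹ l _) = _ , FF.Conn-~ (in?-invariant-F root) (F.~-sym F.~-π) (proj₂ (low-outside l))

      Touches : Fin n → Set
      Touches h = ∃[ g ] (h V.~ g × ((A g ≡ true) ⊎ (A (α g) ≡ true)))

      walk-touches : ∀ {g h} → Walk g h → Touches h → Touches g
      walk-touches (_ , there e) (g , e' , a) = g , V.~-trans e e' , a
      walk-touches (_ , step {g' = g'} e s _) _ = g' , e , inj₂ (proj₂ s)

      module Source (v : Fin n) (v-touches : Touches v) (v-source : ∀ g → Walk g v → Walk v g) where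

        Entry : Fin n → Set
        Entry g = ((A g ≡ true) × (Q (α g) ≡ true)) ⊎ ((A (α g) ≡ true) × (Q (σ g) ≡ true))

        circuit-at : ∀ {g} → Walk g v → Stp (α g) → ¬ Stp g → FF.Connected (F.in? root) Off (α g) → ⊥
        circuit-at {g} gv s ¬s conn = ccw-circuit Stp Off proj₁ (λ o → o) {α g} s (λ s' → ¬s (subst Stp (α-invol g) s'))
          (walk-trans (walk-~ (V.~-reflexive (α-invol g))) (walk-trans gv (v-source (α g)
            (walk-trans (walk-step s) (walk-trans (walk-~ (V.~-reflexive (α-invol g))) gv))))) conn (proj₁ suit)

        -- If `A` and `Q` meet at a vertex of the source component, the drop of `p` between them
        -- puts weight on an edge. This is a step into the component that cannot be reversed; its
        -- origin lies in the component too, so it closes to a counterclockwise circuit.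
        no-entry : ∀ {g} → Walk g v → ¬ Entry g
        no-entry {g} gv (inj₁ (a , q)) = circuit-at gv
          (subst (λ x → 0ℤ < w x) (sym (α-invol g)) (u-ingoing (high-α a q)) , trans (cong A (α-invol g)) a)
          (λ s → true≢false q (not-true (proj₂ s))) (low-outside (sound q))
        -- The drop is across a new edge, so `α g` has weight -1 and the old edge can only be
        -- traversed towards the vertex of `g`. The other triangle is in `A` as well, because a drop
        -- across the old edge would need the weight that `unit-u` denies.
        no-entry {g} gv (inj₂ (a , q)) = circuit-at gv
          (subst (0ℤ <_) (sym (unit-opposite unit)) (1≤⇒0< 1≤B) , trans (cong A (α-invol g)) Ag)
          (λ s → ℤₚ.<⇒≱ (subst (0ℤ <_) (unit-negative unit) (proj₁ s)) -≤+)
          (_ , FF.Conn-~ (in?-invariant-F root) (F.~-sym α-face-σ) (proj₂ (low-outside (sound q))))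
          where
          unit : y (α g) ≡ 1ℤ
          unit = high-φ a (trans (cong Q (φα≡σ g)) q)
          Ag : A g ≡ true
          Ag = [ (λ t → t) , (λ f → ⊥-elim (1≰0 (subst (1ℤ ≤_) (unit-u unit) (high-α a (trans (cong Q (α-invol g)) (not-false f)))))) ]′ (bool (A g))

        rotate : ∀ k {g g₀} → Walk g v → A (α g) ≡ true → iter σ (suc k) g ≡ g₀ → (Q g₀ ≡ true) ⊎ (Q (α g₀) ≡ true) → ⊥
        rotate k {g} {g₀} gv a e q = cases k e (bool (Q (σ g))) (bool (Q (α (σ g))))
          where
          σgv : Walk (σ g) v
          σgv = walk-trans (walk-~ (V.~-sym V.~-π)) gv
          cases : ∀ k → iter σ (suc k) g ≡ g₀ → (Q (σ g) ≡ true) ⊎ (Q (σ g) ≡ false) → (Q (α (σ g)) ≡ true) ⊎ (Q (α (σ g)) ≡ false) → ⊥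
          cases _ _ (inj₁ t) _ = no-entry gv (inj₂ (a , t))
          cases _ _ (inj₂ f) (inj₁ t) = no-entry σgv (inj₁ (cong not f , t))
          cases zero refl (inj₂ f) (inj₂ f') = [ (λ t → true≢false t f) , (λ t → true≢false t f') ]′ q
          cases (suc k) e (inj₂ f) (inj₂ f') = rotate k σgv (cong not f')
            (trans (sym (V.iter-+ (suc k) 1 g)) (trans (cong (λ j → iter σ j g) (ℕₚ.+-comm (suc k) 1)) e)) q

        -- A turn about a vertex of the component starts at some triangle of `A` and, without
        -- entries, never leaves `A`.
        surrounded-by-A : ∀ {g} → Walk g v → (Q g ≡ true) ⊎ (Q (α g) ≡ true) → ⊥
        surrounded-by-A {g} gv q = begin-turn (walk-touches gv v-touches)
          where
          begin-turn : Touches g → ⊥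
          begin-turn (g₁ , e , a) = turn a (V.~-trans (V.~-sym V.~-π) (V.~-sym e))
            where
            g₁v : Walk g₁ v
            g₁v = walk-trans (walk-~ (V.~-sym e)) gv
            from-α : A (α g₁) ≡ true → σ g₁ V.~ g → ⊥
            from-α aα (k , e') = rotate k g₁v aα (trans (trans (cong (λ j → iter σ j g₁) (ℕₚ.+-comm 1 k)) (V.iter-+ k 1 g₁)) e') q
            turn : (A g₁ ≡ true) ⊎ (A (α g₁) ≡ true) → σ g₁ V.~ g → ⊥
            turn (inj₂ aα) e' = from-α aα e'
            turn (inj₁ a₁) e' = [ (λ t → no-entry g₁v (inj₁ (a₁ , t))) , (λ f → from-α (cong not f) e') ]′ (bool (Q (α g₁)))

        -- Since `A` surrounds the component, any traversable edge into it is a step, so its origin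
        -- belongs to the component as well. A path from the root vertex would thus start inside,
        -- although its triangle `root` is in `Q`.
        unreached : ∀ {g} → OReach PM w root g → ¬ Walk g v
        unreached (start e) gv = surrounded-by-A (walk-trans (walk-~ e) gv) (inj₁ (complete at-root))
        unreached (step {h} r t e) gv = unreached r (walk-trans (walk-step (t , inside)) αhv)
          where
          αhv : Walk (α h) v
          αhv = walk-trans (walk-~ e) gv
          inside : A (α h) ≡ true
          inside = [ (λ q → ⊥-elim (surrounded-by-A αhv (inj₁ q))) , cong not ]′ (bool (Q (α h)))

        absurd : ⊥
        absurd = unreached (proj₂ (proj₂ suit) root (root , V.~-refl , F.~-refl) v) (walk-~ V.~-refl)

      all-low : ∀ h → A h ≡ true → ⊥
      all-low h a = source h (λ { (v , vh , src) → Source.absurd v (walk-touches vh (h , V.~-refl , inj₁ a)) src })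

    nonpositive : ∀ h → p h ≤ 0ℤ
    nonpositive h = decidable-stable (p h ℤ.≤? 0ℤ) (λ ≰ → classify Low (λ { (Q , dQ) →
      all-low Q dQ h (cong not (Decides.reject dQ (λ l → ≰ (low≤0 l)))) }))

-- Comparison of two suitable orientations

module Uniqueness {n : ℕ} (PM : PlaneMap n) (b : ℕ) (deg : PlaneMap.outerDeg PM ≡ 2 ℕ.* b)
  (girth : PlaneMap.HasGirth PM (2 ℕ.* b)) (1≤b : 1 ℕ.≤ b)
  (even : ∀ h → + PlaneMap.faceDeg PM h ≡ + 2 * + (PlaneMap.faceDeg PM h DM./ 2))
  (w : ZBiorientation n) (ori : IsBOrientation PM w b) (suit : Suitable PM w)
  (w' : ZBiorientation n) (ori' : IsBOrientation PM w' b) (suit' : Suitable PM w') where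
  open PlaneMap PM
  open Planar pmap

  private
    module S  = StarOf PM b deg girth 1≤b even w ori suit
    module S' = StarOf PM b deg girth 1≤b even w' ori' suit'

    ω ζ : Fin n → ℤ
    ω h = S'.u h - S.u h
    ζ h = S'.y h - S.y h

    ω-anti : ∀ h → ω (α h) ≡ - ω h
    ω-anti h = trans (arrange (S.u h) (S.u (α h)) (S'.u h) (S'.u (α h)))
      (trans (cong (λ t → - (S'.u h - S.u h) + t) (trans (cong (_- (S.u h + S.u (α h))) same) (ℤₚ.+-inverseʳ (S.u h + S.u (α h))))) (ℤₚ.+-identityʳ _))
      where
      arrange : ∀ a b c d → d - b ≡ - (c - a) + ((c + d) - (a + b))
      arrange = solve-∀
      same : S'.u h + S'.u (α h) ≡ S.u h + S.u (α h)
      same = trans (S'.edge-total h) (trans (trans (S'.edge-weights h) (sym (S.edge-weights h))) (sym (S.edge-total h)))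

    ζ-conserved : ∀ h → F.osum ζ h ≡ 0ℤ
    ζ-conserved h = ℤₚ.*-cancelˡ-≡ (+ 2) (F.osum ζ h) 0ℤ (trans (double (F.osum ζ h)) (trans (sym (F.osum-+ ζ ζ h))
      (trans (F.osum-cong (λ g _ → arrange (S'.y g) (S.y g))) (trans (F.osum-minus _ _ h)
        (trans (cong₂ _-_ (S.face-total h) (S'.face-total h)) (ℤₚ.+-inverseʳ (+ 2 * + b)))))))
      where
      double : ∀ s → + 2 * s ≡ s + s
      double = solve-∀
      arrange : ∀ a b → (a - b) + (a - b) ≡ (1ℤ - + 2 * b) - (1ℤ - + 2 * a)
      arrange = solve-∀

    vertex : ∀ h → V.osum (λ g → ω g + ζ (α g)) h ≡ 0ℤ
    vertex h = trans (V.osum-cong (λ g _ → arrange (S'.x g) (S'.y (α g)) (S.x g) (S.y (α g)))) (trans (V.osum-minus S'.x S.x h)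
      (trans (cong (_- V.osum S.x h) (trans (S'.vertex-total h) (sym (S.vertex-total h)))) (ℤₚ.+-inverseʳ (V.osum S.x h))))
      where
      arrange : ∀ a b c d → ((a - b) - (c - d)) + (b - d) ≡ a - c
      arrange = solve-∀

    0<⇒ : ∀ {a b c} → 0ℤ ≤ a → c ≡ b - a → 0ℤ < c → 1ℤ ≤ b
    0<⇒ {a} {b} 0≤a refl l = ≤-by (gap (0<⇒1≤ l) ⊞ 0≤a) (arrange a b)
      where
      arrange : ∀ a b → ((b - a) - 1ℤ) + a ≡ b - 1ℤ
      arrange = solve-∀

    unit : ∀ {a} → (a ≡ 0ℤ) ⊎ (a ≡ 1ℤ) → 1ℤ ≤ a → a ≡ 1ℤ
    unit (inj₁ refl) l = ⊥-elim (1≰0 l)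
    unit (inj₂ e)    l = e

    module Compare (p : Fin n → ℤ) (p-root : p root ≡ 0ℤ) (p-φ : ∀ h → p (φ h) - p h ≡ ζ h) (p-α : ∀ h → p (α h) - p h ≡ ω h) where

      drop : ∀ {a b} → a < b → 0ℤ < b - a
      drop l = 1≤⇒0< (<⇒1≤- l)

      swap : ∀ a b → b - a ≡ - (a - b)
      swap = solve-∀

      neg-swap : ∀ a b → - b - - a ≡ a - b
      neg-swap = solve-∀

      y-cases : ∀ h → (S.y h ≡ 0ℤ) ⊎ (S.y h ≡ 1ℤ)
      y-cases h = [ inj₁ , (λ e → inj₂ (proj₂ e)) ]′ (S.y-value h)

      y'-cases : ∀ h → (S'.y h ≡ 0ℤ) ⊎ (S'.y h ≡ 1ℤ)
      y'-cases h = [ inj₁ , (λ e → inj₂ (proj₂ e)) ]′ (S'.y-value h)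

      -- Where `p` decreases, the first orientation exceeds the second, whose values are
      -- nonnegative, so the first one has something to give. For `above` the roles and the sign are
      -- exchanged.
      below : ∀ h → p h ≤ 0ℤ
      below = S.Nonpositive.nonpositive p p-root
        (λ h l → 0<⇒ (S'.0≤u h) (trans (swap (p (α h)) (p h)) (trans (cong -_ (p-α h)) (sym (swap (S'.u h) (S.u h))))) (drop l))
        (λ h l → unit (y-cases h) (0<⇒ (S'.0≤y h) (trans (swap (p (φ h)) (p h)) (trans (cong -_ (p-φ h)) (sym (swap (S'.y h) (S.y h))))) (drop l)))

      above : ∀ h → - p h ≤ 0ℤ
      above = S'.Nonpositive.nonpositive (λ h → - p h) (cong -_ p-root)
        (λ h l → 0<⇒ (S.0≤u h) (trans (neg-swap (p (α h)) (p h)) (p-α h)) (drop l))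
        (λ h l → unit (y'-cases h) (0<⇒ (S.0≤y h) (trans (neg-swap (p (φ h)) (p h)) (p-φ h)) (drop l)))

      p≡0 : ∀ h → p h ≡ 0ℤ
      p≡0 h = ℤₚ.≤-antisym (below h) (subst (0ℤ ≤_) (ℤₚ.neg-involutive (p h)) (ℤₚ.neg-mono-≤ (above h)))

      flat : ∀ {g h c} → p g - p h ≡ c → c ≡ 0ℤ
      flat {g} {h} e = trans (sym e) (cong₂ _-_ (p≡0 g) (p≡0 h))

      same-u : ∀ h → S'.u h ≡ S.u h
      same-u h = ℤₚ.i-j≡0⇒i≡j _ _ (flat (p-α h))

      same-y : ∀ h → S'.y h ≡ S.y h
      same-y h = ℤₚ.i-j≡0⇒i≡j _ _ (flat (p-φ h))

      same : ∀ h → w' h ≡ w h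
      same h = trans (recover (w' h) (S'.y h) (S'.y (α h))) (trans (cong₂ _+_ (cong₂ _-_ (same-u h) (same-y h)) (same-y (α h)))
        (sym (recover (w h) (S.y h) (S.y (α h)))))
        where
        recover : ∀ w y z → w ≡ ((w + y - z) - y) + z
        recover = solve-∀

  unique : ∀ h → w' h ≡ w h
  unique h = decidable-stable (w' h ℤ.≟ w h) (do
    (p , p-φ , p-α) ← star-potential root ω ζ ω-anti ζ-conserved vertex
    return (Compare.same (λ g → p g - p root) (ℤₚ.+-inverseʳ (p root)) (λ g → trans (cancel (p (φ g)) (p g) (p root)) (p-φ g))
      (λ g → trans (cancel (p (α g)) (p g) (p root)) (p-α g)) h))
    where
    cancel : ∀ a b r → (a - r) - (b - r) ≡ a - b
    cancel = solve-∀

-- Assembly of the equivalence, existence and uniqueness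

theorem4p2 : (b : ℕ) → 1 ℕ.≤ b → (n : ℕ) → (M : PlaneMap n) →
    PlaneMap.Bipartite M →
    PlaneMap.outerDeg M ≡ 2 ℕ.* b →
    (∀ h → 2 ℕ.* b ℕ.≤ PlaneMap.faceDeg M h) →
    ((∃[ w ] IsBOrientation M w b) ⇔ PlaneMap.HasGirth M (2 ℕ.* b))
    × (PlaneMap.HasGirth M (2 ℕ.* b) →
        Σ (ZBiorientation n) λ w →
          (IsBOrientation M w b × Suitable M w)
          × (∀ w′ → IsBOrientation M w′ b × Suitable M w′ → ∀ h → w′ h ≡ w h))
theorem4p2 b 1≤b n M bip deg _ = mk⇔ to (λ girth → proj₁ (exists girth) , proj₁ (proj₂ (exists girth))) ,
    λ girth → proj₁ (exists girth) , proj₂ (exists girth) ,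
      λ w′ (ori′ , suit′) → Uniqueness.unique M b deg girth 1≤b even (proj₁ (exists girth)) (proj₁ (proj₂ (exists girth)))
        (proj₂ (proj₂ (exists girth))) w′ ori′ suit′
  where
  open PlaneMap M using (pmap; contour; IsCycle; HasGirth)
  even = even-degree pmap bip
  to : ∃[ w ] IsBOrientation M w b → HasGirth (2 ℕ.* b)
  -- Admissibility already makes the contour a cycle of length `2b`; the count supplies the lower
  -- bound.
  to (w , ori) = subst (λ k → Σ (Fin k → Fin n) (IsCycle k)) deg (contour , proj₁ (proj₁ ori)) ,
    λ k c cyc → GirthBound.cycle-bound M b w ori even cyc
  exists : HasGirth (2 ℕ.* b) → Σ (ZBiorientation n) λ w → IsBOrientation M w b × Suitable M w
  exists girth = from (GoodOrientation.good M b deg girth 1≤b even)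
    where
    from : (Σ (Fin n → ℤ) λ u → Σ (Fin n → ℤ) λ z → StarMinimal.Good M b deg girth 1≤b even u z) →
      Σ (ZBiorientation n) λ w → IsBOrientation M w b × Suitable M w
    from (u , z , G) = w , isBOrientation , minimal , admissible ,
      Access.From.accessible M b deg girth 1≤b even w isBOrientation outer-cw minimal
      where
      open Transfer M b deg girth 1≤b even u z G
      open Planar.F pmap using (in?-true)
      outer-cw : ∀ h → PlaneMap.InRoot M h → (w h ≡ 1ℤ) × (w (PlaneMap.α M h) ≡ 0ℤ)
      outer-cw h r = w-root (in?-true r) , w-root-α (in?-true r)
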